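{- Let $D_S$ be a digraph with self-loops of order $n$ with $\sigma$ self-loops. Let $D_1,\dots,D_k$ be its strong components, where $D_i$ has order $n_i$ and $\sigma_i$ self-loops, such that $n=\sum_{i=1}^k n_i$ and $\sigma=\sum_{i=1}^k\sigma_i$, and let $\lambda_{i,1},\dots,\lambda_{i,n_i}$ be the eigenvalues of $A(D_i)$. Let $1\le l<k$ and suppose that $\frac{\sigma_i}{n_i}>\frac{\sigma}{n}$ for $i=1,\dots,l$ and $\frac{\sigma_i}{n_i}\le\frac{\sigma}{n}$ for $i=l+1,\dots,k$. For each $i$ let $$A_i=\left\{j\in\{1,\dots,n_i\}:\Re(\lambda_{i,j})>\frac{\sigma}{n}\right\}.$$ Then $$\sum_{i=1}^l\left(\frac{\sigma_i}{n_i}-\frac{\sigma}{n}\right)|A_i|\le\sum_{i=l+1}^k\left(\frac{\sigma}{n}-\frac{\sigma_i}{n_i}\right)|A_i|\quad\Longrightarrow\quad E(D_S)\le\sum_{i=1}^kE(D_i).$$ Moreover, if the inequality on the left-hand side of the implication is strict, then the inequality on the right-hand side is also strict.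
   Context: A digraph with self-loops $D_S$ is a pair $(V,\mathcal A)$ with $V$ a nonempty finite vertex set and $\mathcal A\subseteq V\times V$ a set of arcs; $S=\{v\in V:(v,v)\in\mathcal A\}$ is the self-loop set (possibly empty). The order is $n=|V|$ and the number of self-loops is $\sigma=|S|$. The adjacency matrix $A(D_S)=(a_{ij})$ has $a_{ij}=1$ if $(v_i,v_j)\in\mathcal A$ and $a_{ij}=0$ otherwise; eigenvalues are counted with algebraic multiplicity. The energy of a digraph with self-loops of order $n$ with $\sigma$ self-loops and eigenvalues $\lambda_1,\dots,\lambda_n$ is $\sum_{i=1}^n\left|\Re(\lambda_i)-\frac{\sigma}{n}\right|$; in particular $E(D_i)=\sum_{j=1}^{n_i}\left|\Re(\lambda_{i,j})-\frac{\sigma_i}{n_i}\right|$. A digraph is strongly connected if for any two distinct vertices $v,w$ there is a path from $v$ to $w$ and one from $w$ to $v$; a strong component is a maximal strongly connected sub-digraph (self-loops included). -}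

module Defs where

open import Level using (0ℓ)
open import Algebra.Bundles.Raw using (RawRing)
import Algebra.Definitions.RawMonoid as RawSum
open import Data.Bool.Base using (Bool; T; if_then_else_)
open import Data.Fin.Base using (Fin; zero; suc; toℕ; punchIn)
open import Data.Fin.Subset using (Subset; ∣_∣)
import Data.Integer.Base as ℤ
open import Data.Nat.Base as ℕ using (ℕ; zero; suc; NonZero; _<ᵇ_)
import Data.Nat.Properties as ℕₚ
open import Data.Product.Base using (∃; ∃₂; _×_; _,_)
open import Data.Rational.Base as ℚ using (ℚ; 0ℚ; 1ℚ; ½; _/_)
import Data.Rational.Properties as ℚₚ
open import Data.Rational.Solver using (module +-*-Solver)
import Data.Vec.Base as Vec
open import Data.Sum.Base using (inj₁; inj₂)
open import Data.Vec.Functional using (Vector)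
open import Function.Definitions using (Injective)
open import Relation.Binary.Core using (Rel; _=[_]⇒_)
open import Relation.Binary.Construct.Closure.ReflexiveTransitive using (Star)
open import Relation.Binary.PropositionalEquality
  using (_≡_; _≢_; refl; sym; trans; cong; subst; subst₂)
open import Relation.Nullary using (¬_)

------------------------------------------------------------------------
-- Real numbers as Cauchy sequences of rationals, with setoid equality.

IsCauchy : (ℕ → ℚ) → Set
IsCauchy s = ∀ ε → 0ℚ ℚ.< ε →
  ∃ λ N → ∀ m n → N ℕ.≤ m → N ℕ.≤ n → ℚ.∣ s m ℚ.- s n ∣ ℚ.< ε

record ℝ : Set where
  constructor mkℝ
  field
    seq    : ℕ → ℚ
    cauchy : IsCauchy seq

open ℝ public

private
  0<ε½ : ∀ {ε} → 0ℚ ℚ.< ε → 0ℚ ℚ.< ε ℚ.* ½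
  0<ε½ {ε} 0<ε = subst (ℚ._< ε ℚ.* ½) (ℚₚ.*-zeroˡ ½) (ℚₚ.*-monoˡ-<-pos ½ 0<ε)

  ε½+ε½ : ∀ ε → ε ℚ.* ½ ℚ.+ ε ℚ.* ½ ≡ ε
  ε½+ε½ ε = trans (sym (ℚₚ.*-distribˡ-+ ε ½ ½)) (ℚₚ.*-identityʳ ε)

  +-cauchy : ∀ {s t} → IsCauchy s → IsCauchy t → IsCauchy (λ n → s n ℚ.+ t n)
  +-cauchy {s} {t} cs ct ε 0<ε
    with cs (ε ℚ.* ½) (0<ε½ 0<ε) | ct (ε ℚ.* ½) (0<ε½ 0<ε)
  ... | M , hs | N , ht = M ℕ.⊔ N , λ m n p q → begin-strict
    ℚ.∣ (s m ℚ.+ t m) ℚ.- (s n ℚ.+ t n) ∣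
      ≡⟨ cong ℚ.∣_∣ (regroup (s m) (t m) (s n) (t n)) ⟩
    ℚ.∣ (s m ℚ.- s n) ℚ.+ (t m ℚ.- t n) ∣
      ≤⟨ ℚₚ.∣p+q∣≤∣p∣+∣q∣ (s m ℚ.- s n) (t m ℚ.- t n) ⟩
    ℚ.∣ s m ℚ.- s n ∣ ℚ.+ ℚ.∣ t m ℚ.- t n ∣
      <⟨ ℚₚ.+-mono-< (hs m n (ℕₚ.m⊔n≤o⇒m≤o M N p) (ℕₚ.m⊔n≤o⇒m≤o M N q))
                     (ht m n (ℕₚ.m⊔n≤o⇒n≤o M N p) (ℕₚ.m⊔n≤o⇒n≤o M N q)) ⟩
    ε ℚ.* ½ ℚ.+ ε ℚ.* ½
      ≡⟨ ε½+ε½ ε ⟩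
    ε ∎
    where
    open ℚₚ.≤-Reasoning
    open +-*-Solver
    regroup : ∀ a b c d → (a ℚ.+ b) ℚ.- (c ℚ.+ d) ≡ (a ℚ.- c) ℚ.+ (b ℚ.- d)
    regroup = solve 4 (λ a b c d → (a :+ b) :- (c :+ d) := (a :- c) :+ (b :- d)) refl

  neg-cauchy : ∀ {s} → IsCauchy s → IsCauchy (λ n → ℚ.- s n)
  neg-cauchy {s} cs ε 0<ε with cs ε 0<ε
  ... | N , h = N , λ m n p q →
    subst (ℚ._< ε) (trans (sym (ℚₚ.∣-p∣≡∣p∣ (s m ℚ.- s n)))
                          (cong ℚ.∣_∣ (ℚₚ.neg-distrib-+ (s m) (ℚ.- s n))))
          (h m n p q)

  Bounded : (ℕ → ℚ) → Set
  Bounded s = ∃₂ λ K N → (0ℚ ℚ.≤ K) × (∀ n → N ℕ.≤ n → ℚ.∣ s n ∣ ℚ.≤ K)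

  bounded : ∀ {s} → IsCauchy s → Bounded s
  bounded {s} cs with cs 1ℚ (ℚₚ.positive⁻¹ 1ℚ)
  ... | N , h = 1ℚ ℚ.+ ℚ.∣ s N ∣ , N
      , ℚₚ.+-mono-≤ (ℚₚ.nonNegative⁻¹ 1ℚ) (ℚₚ.0≤∣p∣ (s N))
      , λ n p → begin
    ℚ.∣ s n ∣                        ≡⟨ cong ℚ.∣_∣ (split (s n) (s N)) ⟩
    ℚ.∣ (s n ℚ.- s N) ℚ.+ s N ∣      ≤⟨ ℚₚ.∣p+q∣≤∣p∣+∣q∣ (s n ℚ.- s N) (s N) ⟩
    ℚ.∣ s n ℚ.- s N ∣ ℚ.+ ℚ.∣ s N ∣  ≤⟨ ℚₚ.+-monoˡ-≤ ℚ.∣ s N ∣ (ℚₚ.<⇒≤ (h n N p ℕₚ.≤-refl)) ⟩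
    1ℚ ℚ.+ ℚ.∣ s N ∣ ∎
    where
    open ℚₚ.≤-Reasoning
    open +-*-Solver
    split : ∀ a b → a ≡ (a ℚ.- b) ℚ.+ b
    split = solve 2 (λ a b → a := (a :- b) :+ b) refl

  module _ {s t : ℕ → ℚ} (cs : IsCauchy s) (ct : IsCauchy t)
           {K₁ K₂ K : ℚ} {B₁ B₂ : ℕ}
           (b₁ : ∀ n → B₁ ℕ.≤ n → ℚ.∣ s n ∣ ℚ.≤ K₁)
           (b₂ : ∀ n → B₂ ℕ.≤ n → ℚ.∣ t n ∣ ℚ.≤ K₂)
           (0<K : 0ℚ ℚ.< K) (K₁+K₂<K : K₁ ℚ.+ K₂ ℚ.< K) where

    scaled : ∀ {ε} → 0ℚ ℚ.< ε → ∃ λ δ → 0ℚ ℚ.< δ × K ℚ.* δ ≡ ε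
    scaled {ε} 0<ε = ε ℚ.* ℚ.1/ K , 0<δ ,
      trans (ℚₚ.*-comm K (ε ℚ.* ℚ.1/ K)) (trans (ℚₚ.*-assoc ε (ℚ.1/ K) K)
        (trans (cong (ε ℚ.*_) (ℚₚ.*-inverseˡ K)) (ℚₚ.*-identityʳ ε)))
      where
      instance
        K-pos : ℚ.Positive K
        K-pos = ℚ.positive 0<K
        K≢0 : ℚ.NonZero K
        K≢0 = ℚₚ.pos⇒nonZero K
        K⁻¹-pos : ℚ.Positive (ℚ.1/ K)
        K⁻¹-pos = ℚₚ.1/pos⇒pos K
      0<δ : 0ℚ ℚ.< ε ℚ.* ℚ.1/ K
      0<δ = subst (ℚ._< ε ℚ.* ℚ.1/ K) (ℚₚ.*-zeroˡ (ℚ.1/ K))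
                  (ℚₚ.*-monoˡ-<-pos (ℚ.1/ K) 0<ε)

    *-cauchy-bounded : IsCauchy (λ n → s n ℚ.* t n)
    *-cauchy-bounded ε 0<ε with scaled 0<ε
    ... | δ , 0<δ , Kδ with cs δ 0<δ | ct δ 0<δ
    ... | M , hs | N , ht = (B₁ ℕ.⊔ B₂) ℕ.⊔ (M ℕ.⊔ N) , λ m n p q →
      let pB = ℕₚ.m⊔n≤o⇒m≤o (B₁ ℕ.⊔ B₂) (M ℕ.⊔ N) p
          qB = ℕₚ.m⊔n≤o⇒m≤o (B₁ ℕ.⊔ B₂) (M ℕ.⊔ N) q
          pN = ℕₚ.m⊔n≤o⇒n≤o (B₁ ℕ.⊔ B₂) (M ℕ.⊔ N) p
          qN = ℕₚ.m⊔n≤o⇒n≤o (B₁ ℕ.⊔ B₂) (M ℕ.⊔ N) q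
      in begin-strict
        ℚ.∣ s m ℚ.* t m ℚ.- s n ℚ.* t n ∣
          ≡⟨ cong ℚ.∣_∣ (regroup (s m) (t m) (s n) (t n)) ⟩
        ℚ.∣ s m ℚ.* (t m ℚ.- t n) ℚ.+ t n ℚ.* (s m ℚ.- s n) ∣
          ≤⟨ ℚₚ.∣p+q∣≤∣p∣+∣q∣ (s m ℚ.* (t m ℚ.- t n)) (t n ℚ.* (s m ℚ.- s n)) ⟩
        ℚ.∣ s m ℚ.* (t m ℚ.- t n) ∣ ℚ.+ ℚ.∣ t n ℚ.* (s m ℚ.- s n) ∣
          ≤⟨ ℚₚ.+-mono-≤
               (step (s m) (t m ℚ.- t n) (b₁ m (ℕₚ.m⊔n≤o⇒m≤o B₁ B₂ pB))
                 (ht m n (ℕₚ.m⊔n≤o⇒n≤o M N pN) (ℕₚ.m⊔n≤o⇒n≤o M N qN)))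
               (step (t n) (s m ℚ.- s n) (b₂ n (ℕₚ.m⊔n≤o⇒n≤o B₁ B₂ qB))
                 (hs m n (ℕₚ.m⊔n≤o⇒m≤o M N pN) (ℕₚ.m⊔n≤o⇒m≤o M N qN))) ⟩
        K₁ ℚ.* δ ℚ.+ K₂ ℚ.* δ
          ≡⟨ sym (ℚₚ.*-distribʳ-+ δ K₁ K₂) ⟩
        (K₁ ℚ.+ K₂) ℚ.* δ
          <⟨ ℚₚ.*-monoˡ-<-pos δ {{ℚ.positive 0<δ}} K₁+K₂<K ⟩
        K ℚ.* δ
          ≡⟨ Kδ ⟩
        ε ∎
      where
      open ℚₚ.≤-Reasoning
      open +-*-Solver
      regroup : ∀ a b a′ b′ →
        (a ℚ.* b) ℚ.- (a′ ℚ.* b′) ≡ a ℚ.* (b ℚ.- b′) ℚ.+ b′ ℚ.* (a ℚ.- a′)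
      regroup = solve 4 (λ a b a′ b′ →
        (a :* b) :- (a′ :* b′) := a :* (b :- b′) :+ b′ :* (a :- a′)) refl
      step : ∀ x y {L} → ℚ.∣ x ∣ ℚ.≤ L → ℚ.∣ y ∣ ℚ.< δ → ℚ.∣ x ℚ.* y ∣ ℚ.≤ L ℚ.* δ
      step x y {L} x≤L y<δ = begin
        ℚ.∣ x ℚ.* y ∣        ≡⟨ ℚₚ.∣p*q∣≡∣p∣*∣q∣ x y ⟩
        ℚ.∣ x ∣ ℚ.* ℚ.∣ y ∣  ≤⟨ ℚₚ.*-monoˡ-≤-nonNeg ℚ.∣ x ∣ {{ℚₚ.∣-∣-nonNeg x}} (ℚₚ.<⇒≤ y<δ) ⟩
        ℚ.∣ x ∣ ℚ.* δ        ≤⟨ ℚₚ.*-monoʳ-≤-nonNeg δ {{ℚ.nonNegative (ℚₚ.<⇒≤ 0<δ)}} x≤L ⟩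
        L ℚ.* δ              ∎

  exceed : ∀ {p q} → 0ℚ ℚ.≤ p → 0ℚ ℚ.≤ q → ∃ λ r → 0ℚ ℚ.< r × p ℚ.+ q ℚ.< r
  exceed {p} {q} 0≤p 0≤q = 1ℚ ℚ.+ (p ℚ.+ q) , ℚₚ.≤-<-trans 0≤p+q p+q<r , p+q<r
    where
    0≤p+q : 0ℚ ℚ.≤ p ℚ.+ q
    0≤p+q = ℚₚ.+-mono-≤ {0ℚ} {p} {0ℚ} {q} 0≤p 0≤q
    p+q<r : p ℚ.+ q ℚ.< 1ℚ ℚ.+ (p ℚ.+ q)
    p+q<r = subst (ℚ._< 1ℚ ℚ.+ (p ℚ.+ q)) (ℚₚ.+-identityˡ (p ℚ.+ q))
      (ℚₚ.+-monoˡ-< (p ℚ.+ q) {0ℚ} {1ℚ} (ℚₚ.positive⁻¹ 1ℚ))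

  *-cauchy : ∀ {s t} → IsCauchy s → IsCauchy t → IsCauchy (λ n → s n ℚ.* t n)
  *-cauchy {s} {t} cs ct = combine (bounded {s} cs) (bounded {t} ct)
    where
    combine : Bounded s → Bounded t → IsCauchy (λ n → s n ℚ.* t n)
    combine (K₁ , B₁ , 0≤K₁ , b₁) (K₂ , B₂ , 0≤K₂ , b₂) =
      let K , 0<K , K₁+K₂<K = exceed {K₁} {K₂} 0≤K₁ 0≤K₂
      in *-cauchy-bounded {s} {t} cs ct {K₁} {K₂} {K} {B₁} {B₂} b₁ b₂ 0<K K₁+K₂<K

  ∣p∣-∣q∣≤∣p-q∣ : ∀ p q → ℚ.∣ p ∣ ℚ.- ℚ.∣ q ∣ ℚ.≤ ℚ.∣ p ℚ.- q ∣
  ∣p∣-∣q∣≤∣p-q∣ p q = begin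
    ℚ.∣ p ∣ ℚ.- ℚ.∣ q ∣
      ≡⟨ cong (λ x → ℚ.∣ x ∣ ℚ.- ℚ.∣ q ∣) (split p q) ⟩
    ℚ.∣ (p ℚ.- q) ℚ.+ q ∣ ℚ.- ℚ.∣ q ∣
      ≤⟨ ℚₚ.+-monoˡ-≤ (ℚ.- ℚ.∣ q ∣) (ℚₚ.∣p+q∣≤∣p∣+∣q∣ (p ℚ.- q) q) ⟩
    (ℚ.∣ p ℚ.- q ∣ ℚ.+ ℚ.∣ q ∣) ℚ.- ℚ.∣ q ∣
      ≡⟨ cancel ℚ.∣ p ℚ.- q ∣ ℚ.∣ q ∣ ⟩
    ℚ.∣ p ℚ.- q ∣ ∎
    where
    open ℚₚ.≤-Reasoning
    open +-*-Solver
    split : ∀ a b → a ≡ (a ℚ.- b) ℚ.+ b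
    split = solve 2 (λ a b → a := (a :- b) :+ b) refl
    cancel : ∀ a b → (a ℚ.+ b) ℚ.- b ≡ a
    cancel = solve 2 (λ a b → (a :+ b) :- b := a) refl

  ∣∣p∣-∣q∣∣≤∣p-q∣ : ∀ p q → ℚ.∣ ℚ.∣ p ∣ ℚ.- ℚ.∣ q ∣ ∣ ℚ.≤ ℚ.∣ p ℚ.- q ∣
  ∣∣p∣-∣q∣∣≤∣p-q∣ p q with ℚₚ.∣p∣≡p∨∣p∣≡-p (ℚ.∣ p ∣ ℚ.- ℚ.∣ q ∣)
  ... | inj₁ eq = subst (ℚ._≤ ℚ.∣ p ℚ.- q ∣) (sym eq) (∣p∣-∣q∣≤∣p-q∣ p q)
  ... | inj₂ eq = subst₂ ℚ._≤_ (trans (swap ℚ.∣ q ∣ ℚ.∣ p ∣) (sym eq))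
      (trans (cong ℚ.∣_∣ (swap q p)) (ℚₚ.∣-p∣≡∣p∣ (p ℚ.- q)))
      (∣p∣-∣q∣≤∣p-q∣ q p)
    where
    open +-*-Solver
    swap : ∀ a b → a ℚ.- b ≡ ℚ.- (b ℚ.- a)
    swap = solve 2 (λ a b → a :- b := :- (b :- a)) refl

  abs-cauchy : ∀ {s} → IsCauchy s → IsCauchy (λ n → ℚ.∣ s n ∣)
  abs-cauchy {s} cs ε 0<ε with cs ε 0<ε
  ... | N , h = N , λ m n p q →
    ℚₚ.≤-<-trans (∣∣p∣-∣q∣∣≤∣p-q∣ (s m) (s n)) (h m n p q)

fromℚ : ℚ → ℝ
fromℚ p = mkℝ (λ _ → p) λ ε 0<ε → 0 , λ _ _ _ _ →
  subst (ℚ._< ε) (cong ℚ.∣_∣ (sym (ℚₚ.+-inverseʳ p))) 0<ε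

0ℝ 1ℝ : ℝ
0ℝ = fromℚ 0ℚ
1ℝ = fromℚ 1ℚ

infixl 6 _+ℝ_ _-ℝ_
infixl 7 _*ℝ_
infix  8 -ℝ_
infix  4 _≈ℝ_ _<ℝ_ _≤ℝ_

_+ℝ_ _*ℝ_ : ℝ → ℝ → ℝ
x +ℝ y = mkℝ (λ n → seq x n ℚ.+ seq y n) (+-cauchy {seq x} {seq y} (cauchy x) (cauchy y))
x *ℝ y = mkℝ (λ n → seq x n ℚ.* seq y n) (*-cauchy {seq x} {seq y} (cauchy x) (cauchy y))

-ℝ_ ∣_∣ℝ : ℝ → ℝ
-ℝ x   = mkℝ (λ n → ℚ.- seq x n) (neg-cauchy {seq x} (cauchy x))
∣ x ∣ℝ = mkℝ (λ n → ℚ.∣ seq x n ∣) (abs-cauchy {seq x} (cauchy x))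

_-ℝ_ : ℝ → ℝ → ℝ
x -ℝ y = x +ℝ (-ℝ y)

record _≈ℝ_ (x y : ℝ) : Set where
  constructor mk≈
  field
    close : ∀ ε → 0ℚ ℚ.< ε →
      ∃ λ N → ∀ n → N ℕ.≤ n → ℚ.∣ seq x n ℚ.- seq y n ∣ ℚ.< ε

record _<ℝ_ (x y : ℝ) : Set where
  constructor mk<
  field
    gap     : ℚ
    gap-pos : 0ℚ ℚ.< gap
    apart   : ∃ λ N → ∀ n → N ℕ.≤ n → seq x n ℚ.+ gap ℚ.< seq y n

record _≤ℝ_ (x y : ℝ) : Set where
  constructor mk≤
  field
    below : ∀ ε → 0ℚ ℚ.< ε →
      ∃ λ N → ∀ n → N ℕ.≤ n → seq x n ℚ.< seq y n ℚ.+ ε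

∑ℝ : ∀ {n} → Vector ℝ n → ℝ
∑ℝ = RawSum.sum (record { Carrier = ℝ ; _≈_ = _≈ℝ_ ; _∙_ = _+ℝ_ ; ε = 0ℝ })

------------------------------------------------------------------------

record ℂ : Set where
  constructor _+i_
  field
    Re Im : ℝ

open ℂ public

ℂ-rawRing : RawRing 0ℓ 0ℓ
ℂ-rawRing = record
  { Carrier = ℂ
  ; _≈_     = λ z w → (Re z ≈ℝ Re w) × (Im z ≈ℝ Im w)
  ; _+_     = λ z w → (Re z +ℝ Re w) +i (Im z +ℝ Im w)
  ; _*_     = λ z w → (Re z *ℝ Re w -ℝ Im z *ℝ Im w) +i
                      (Re z *ℝ Im w +ℝ Im z *ℝ Re w)
  ; -_      = λ z → (-ℝ Re z) +i (-ℝ Im z)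
  ; 0#      = 0ℝ +i 0ℝ
  ; 1#      = 1ℝ +i 0ℝ
  }

------------------------------------------------------------------------

Matrix : Set → ℕ → Set
Matrix R n = Fin n → Fin n → R

module Determinant {c ℓ} (R : RawRing c ℓ) where
  open RawRing R

  -- (-1)ʲ x
  signed : ℕ → Carrier → Carrier
  signed zero    x = x
  signed (suc j) x = - signed j x

  -- Laplace expansion along the first row
  det : ∀ {n} → (Fin n → Fin n → Carrier) → Carrier
  det {zero}  M = 1#
  det {suc n} M = RawSum.sum +-rawMonoid λ j →
    signed (toℕ j) (M zero j * det (λ r c → M (suc r) (punchIn j c)))

open Determinant ℂ-rawRing public using () renaming (det to detℂ)

module _ where
  open RawRing ℂ-rawRing

  ∏ℂ : ∀ {n} → Vector ℂ n → ℂ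
  ∏ℂ = RawSum.sum *-rawMonoid

  scalarMatrix : ∀ {n} → ℂ → Matrix ℂ n
  scalarMatrix z zero    zero    = z
  scalarMatrix z zero    (suc _) = 0#
  scalarMatrix z (suc _) zero    = 0#
  scalarMatrix z (suc i) (suc j) = scalarMatrix z i j

  charPoly : ∀ {n} → Matrix ℂ n → ℂ → ℂ
  charPoly M z = detℂ (λ i j → scalarMatrix z i j + - M i j)

  -- λ₁,…,λₙ lists the eigenvalues of M with algebraic multiplicity:
  -- det (z I − M) = ∏ⱼ (z − λⱼ) as polynomial functions on ℂ, equivalently
  -- (ℂ being infinite) as polynomials.
  IsSpectrum : ∀ {n} → Matrix ℂ n → Vector ℂ n → Set
  IsSpectrum M λs = ∀ z → charPoly M z ≈ ∏ℂ (λ j → z + - λs j)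

------------------------------------------------------------------------
-- Digraphs with self-loops, with vertex set {0,…,n−1}

record Digraph : Set where
  field
    order       : ℕ
    {{nonEmpty}} : NonZero order
    arc         : Fin order → Fin order → Bool

  Vertex : Set
  Vertex = Fin order

  Arc : Rel Vertex 0ℓ
  Arc v w = T (arc v w)

  loops : Subset order
  loops = Vec.tabulate (λ v → arc v v)

  #loops : ℕ
  #loops = ∣ loops ∣

  loopRatio : ℚ
  loopRatio = ℤ.+ #loops / order

  adjacency : Matrix ℂ order
  adjacency v w = if arc v w then 1# else 0#
    where open RawRing ℂ-rawRing

  -- The argument is meant to be a spectrum of the adjacency matrix.
  energy : Vector ℂ order → ℝ
  energy λs = ∑ℝ (λ j → ∣ Re (λs j) -ℝ fromℚ loopRatio ∣ℝ)

  StronglyConnected : Set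
  StronglyConnected = ∀ v w → v ≢ w → Star Arc v w × Star Arc w v

open Digraph public
  using (order; Vertex; Arc; #loops; loopRatio; adjacency; energy; StronglyConnected)

-- A sub-digraph is a digraph whose vertices are relabelled by an injection
-- into those of D; its arcs may be any set of arcs of D between them.
record SubDigraph (D : Digraph) : Set where
  field
    digraph   : Digraph
    embed     : Vertex digraph → Vertex D
    injective : Injective _≡_ _≡_ embed
    arcs⊆     : Arc digraph =[ embed ]⇒ Arc D

open SubDigraph public using (digraph; embed)

module _ {D : Digraph} where

  infix 4 _⊆_ _≅_

  -- Both are independent of how the vertices are labelled: H ≅ K says that
  -- the images of H and K in D have the same vertices and the same arcs.
  _⊆_ _≅_ : Rel (SubDigraph D) 0ℓ
  H ⊆ K = ∃ λ (f : Vertex (digraph H) → Vertex (digraph K)) →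
    (∀ v → embed K (f v) ≡ embed H v) × (Arc (digraph H) =[ f ]⇒ Arc (digraph K))
  H ≅ K = H ⊆ K × K ⊆ H

  IsStrongComponent : SubDigraph D → Set
  IsStrongComponent H = StronglyConnected (digraph H) ×
    (∀ K → StronglyConnected (digraph K) → H ⊆ K → K ⊆ H)

  record AreTheStrongComponents {k : ℕ} (C : Fin k → SubDigraph D) : Set where
    field
      component : ∀ i → IsStrongComponent (C i)
      distinct  : ∀ i j → i ≢ j → ¬ (C i ≅ C j)
      complete  : ∀ H → IsStrongComponent H → ∃ λ i → H ≅ C i

------------------------------------------------------------------------
-- Finite sums over Fin k. Indexing is from 0: 1,…,l becomes 0,…,l−1 and
-- l+1,…,k becomes l,…,k−1.

∑ℕ : ∀ {k} → Vector ℕ k → ℕ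
∑ℕ = RawSum.sum ℕ.+-0-rawMonoid

∑ℚ : ∀ {k} → Vector ℚ k → ℚ
∑ℚ = RawSum.sum ℚ.+-0-rawMonoid

∑ℚ-upTo ∑ℚ-after : ∀ {k} → ℕ → Vector ℚ k → ℚ
∑ℚ-upTo  l f = ∑ℚ (λ i → if toℕ i <ᵇ l then f i else 0ℚ)
∑ℚ-after l f = ∑ℚ (λ i → if toℕ i <ᵇ l then 0ℚ else f i)

fromℕ : ℕ → ℚ
fromℕ m = ℤ.+ m / 1

{-# OPTIONS --safe #-}

-- The number h of vertices reachable from a vertex is constant on strong
-- components and strictly decreases along arcs between different components.
-- Conjugating zI − A(D) by the diagonal matrix of the powers t^h and setting t = 0
-- thus deletes these arcs, so that det (zI − A(D)) = ∏ᵢ det (zI − A(Dᵢ)). Hence the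
-- eigenvalues of D are the λᵢⱼ, and E(D) = ∑ᵢⱼ |Re λᵢⱼ − c| where c = σ/n.
--
-- Put cᵢ = σᵢ/nᵢ. With the sign + for j ∈ Aᵢ and − for j ∉ Aᵢ,
--   |Re λᵢⱼ − cᵢ| ≥ ±(Re λᵢⱼ − cᵢ) = |Re λᵢⱼ − c| ± (c − cᵢ).
-- Since ∑ᵢ (c − cᵢ) nᵢ = 0, summation gives ∑ᵢ E(Dᵢ) ≥ E(D) + 2 ∑ᵢ (c − cᵢ) |Aᵢ|, and
-- ∑ᵢ (c − cᵢ) |Aᵢ| is the right-hand side minus the left-hand side of the hypothesis.
--
-- Equality and ≤ of Cauchy reals are stable under double negation, which makes it
-- legitimate to decide reachability and to choose roots.

module Submission where

open import Defs
open import Level using (0ℓ)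
open import Algebra.Bundles using (CommutativeMonoid; CommutativeRing)
open import Algebra.Bundles.Raw using (RawRing)
import Algebra.Definitions.RawMonoid as RawMonoid
import Algebra.Properties.CommutativeMonoid.Sum as CommutativeMonoidSum
import Algebra.Properties.Ring as RingProperties
import Algebra.Properties.Semiring.Exp as Exponentiation
import Algebra.Properties.Semiring.Sum as SemiringSum
import Algebra.Solver.Ring.NaturalCoefficients.Default as SemiringSolver
open import Algebra.Structures using (IsAbelianGroup; IsCommutativeRing)
open import Data.Bool.Base using (true; false; T; if_then_else_)
open import Data.Empty using (⊥)
open import Data.Fin.Base using (Fin; zero; suc; toℕ; punchIn; punchOut; splitAt; join; _↑ˡ_; _↑ʳ_)
import Data.Fin.Properties as Finₚ
open import Data.Fin.Properties using (punchIn-punchOut; punchOut-injective; suc-injective; toℕ-↑ˡ; splitAt-↑ˡ; splitAt-↑ʳ; join-splitAt)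
open import Data.Fin.Subset using (Subset; _∈_; ∣_∣; inside; outside)
open import Data.Fin.Subset.Properties using (p⊆q⇒∣p∣≤∣q∣; p⊂q⇒∣p∣<∣q∣)
import Data.Integer.Base as ℤ
import Data.Integer.Properties as ℤₚ
import Data.List.Base as List
open import Data.List.Membership.Propositional.Properties using (∈-lookup; ∈-filter⁺; ∈-filter⁻; ∈-allFin)
import Data.List.Relation.Unary.All as All
open import Data.List.Relation.Unary.AllPairs using (_∷_)
import Data.List.Relation.Unary.Any as Any
open import Data.List.Relation.Unary.Any.Properties using (lookup-index)
open import Data.List.Relation.Unary.Unique.Propositional using (Unique)
open import Data.List.Relation.Unary.Unique.Propositional.Properties using (allFin⁺; filter⁺)
open import Data.Nat.Base as ℕ using (ℕ; zero; suc; NonZero; _<ᵇ_)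
import Data.Nat.Properties as ℕₚ
open import Data.Product.Base using (∃; ∃₂; Σ; _×_; _,_; proj₁; proj₂)
open import Data.Rational.Base as ℚ using (ℚ; 0ℚ; 1ℚ; ½)
import Data.Rational.Properties as ℚₚ
open import Data.Rational.Solver using (module +-*-Solver)
import Data.Rational.Unnormalised.Base as ℚᵘ
import Data.Rational.Unnormalised.Properties as ℚᵘₚ
open import Data.Sum.Base using (_⊎_; inj₁; inj₂; [_,_]′)
import Data.Vec.Base as Vec
import Data.Vec.Properties as Vecₚ
open import Data.Vec.Functional using (Vector; removeAt; tail)
open import Function.Base using (_∘_; id)
open import Function.Bundles using (_⇔_; Equivalence)
open import Function.Definitions using (Injective)
open import Relation.Binary.Construct.Closure.ReflexiveTransitive as Star using (Star; _◅_; _◅◅_)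
open import Relation.Binary.PropositionalEquality as ≡ using (_≡_; _≢_; _≗_; cong; cong₂; subst; subst₂)
import Relation.Binary.Reasoning.Setoid as SetoidReasoning
open import Relation.Binary.Structures using (IsEquivalence)
open import Relation.Nullary using (¬_; Dec; does; yes; no; contradiction)
open import Relation.Nullary.Decidable using (dec-true; T?; _×-dec_; ¬¬-excluded-middle)

-- The components are listed in an arbitrary order, so a block triangular form would need a
-- topological sorting of them. Deleting the arcs between components makes the matrix block diagonal
-- in whatever order is given. Conjugation by the powers of t makes sense only for t ≠ 0. The value
-- at t = 0 is reached because the determinant of the deformed matrix is a polynomial in t that is
-- constant on 1, 2, 3, ..., and in characteristic zero without zero divisors such a polynomial is
-- constant. The hypothesis n = ∑ᵢ nᵢ turns the injection of the disjoint union of the components'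
-- vertex sets into a relabelling of the rows and columns. The two lists of eigenvalues are not
-- matched by a permutation: equal products of linear factors give equal sums of any function over
-- the roots, up to double negation, and this is applied to z ↦ |Re z - c|. The strict inequality
-- does not pass through double negation: the classical steps enter only the equation for E(D), and
-- the gap is the explicit rational 2 ∑ᵢ (c - cᵢ) |Aᵢ|.

next : ∀ {k} (n : Vector ℕ (suc k)) → Σ (Fin k) (Fin ∘ tail n) → Σ (Fin (suc k)) (Fin ∘ n)
next n (i , a) = suc i , a

locate : ∀ {k} (n : Vector ℕ k) → Fin (∑ℕ n) → Σ (Fin k) (Fin ∘ n)
locate {suc k} n p = [ zero ,_ , next n ∘ locate (tail n) ]′ (splitAt (n zero) p)

locate-↑ˡ : ∀ {k} (n : Vector ℕ (suc k)) (a : Fin (n zero)) → locate n (a ↑ˡ ∑ℕ (tail n)) ≡ (zero , a)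
locate-↑ˡ n a = cong [ zero ,_ , next n ∘ locate (tail n) ]′ (splitAt-↑ˡ (n zero) a (∑ℕ (tail n)))

locate-↑ʳ : ∀ {k} (n : Vector ℕ (suc k)) (p : Fin (∑ℕ (tail n))) →
  locate n (n zero ↑ʳ p) ≡ next n (locate (tail n) p)
locate-↑ʳ n p = cong [ zero ,_ , next n ∘ locate (tail n) ]′ (splitAt-↑ʳ (n zero) (∑ℕ (tail n)) p)

-- Serves as a left inverse of `locate` and so gives its injectivity; bijectivity onto the vertices
-- of a digraph later comes from counting.
index : ∀ {k} (n : Vector ℕ k) → Σ (Fin k) (Fin ∘ n) → Fin (∑ℕ n)
index n (zero  , a) = a ↑ˡ ∑ℕ (tail n)
index n (suc i , a) = n zero ↑ʳ index (tail n) (i , a)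

index-locate : ∀ {k} (n : Vector ℕ k) p → index n (locate n p) ≡ p
index-locate {suc k} n p = ≡.trans (rejoin (splitAt (n zero) p)) (join-splitAt (n zero) (∑ℕ (tail n)) p)
  where
  rejoin : ∀ x → index n ([ zero ,_ , next n ∘ locate (tail n) ]′ x) ≡ join (n zero) (∑ℕ (tail n)) x
  rejoin (inj₁ a) = ≡.refl
  rejoin (inj₂ q) = cong (n zero ↑ʳ_) (index-locate (tail n) q)

locate-injective : ∀ {k} (n : Vector ℕ k) → Injective _≡_ _≡_ (locate n)
locate-injective n {p} {q} eq =
  ≡.trans (≡.sym (index-locate n p)) (≡.trans (cong (index n) eq) (index-locate n q))

module _ {c ℓ} (M : CommutativeMonoid c ℓ) where
  open CommutativeMonoid M
  open CommutativeMonoidSum M using (sum; sum-cong-≗)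

  sum-++ : ∀ m {n} (f : Vector Carrier (m ℕ.+ n)) →
    sum f ≈ sum (λ i → f (i ↑ˡ n)) ∙ sum (λ j → f (m ↑ʳ j))
  sum-++ zero    f = sym (identityˡ _)
  sum-++ (suc m) f = trans (∙-congˡ (sum-++ m (tail f))) (sym (assoc _ _ _))

  -- Stated for any commutative monoid, because it regroups both the product of the linear factors
  -- of the characteristic polynomials and the sum of the deviations of the eigenvalues.
  sum-locate : ∀ {k} (n : Vector ℕ k) (f : Σ (Fin k) (Fin ∘ n) → Carrier) →
    sum (f ∘ locate n) ≈ sum (λ i → sum (λ a → f (i , a)))
  sum-locate {zero}  n f = refl
  sum-locate {suc k} n f = trans (sum-++ (n zero) (f ∘ locate n)) (∙-cong
    (reflexive (sum-cong-≗ λ a → cong f (locate-↑ˡ n a)))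
    (trans (reflexive (sum-cong-≗ λ p → cong f (locate-↑ʳ n p)))
      (sum-locate (tail n) (λ { (i , a) → f (suc i , a) }))))

-- Determinants

module DeterminantProperties {ℓ} (R : CommutativeRing 0ℓ ℓ) where
  open CommutativeRing R hiding (zero)
  open Determinant rawRing
  open SemiringSum semiring using (sum; sum-cong-≋; ∑-comm; *-distribˡ-sum; *-distribʳ-sum; sum-replicate-zero)
  open CommutativeMonoidSum *-commutativeMonoid using () renaming (sum to product; sum-remove to product-remove)
  open RingProperties ring using (-‿distribʳ-*; -‿involutive; -‿+-comm; -0#≈0#)
  open SetoidReasoning setoid

  private
    x*yz≈y*xz : ∀ x y z → x * (y * z) ≈ y * (x * z)
    x*yz≈y*xz x y z = trans (sym (*-assoc x y z)) (trans (*-congʳ (*-comm x y)) (*-assoc y x z))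

  signed-cong : ∀ j {x y} → x ≈ y → signed j x ≈ signed j y
  signed-cong zero    x≈y = x≈y
  signed-cong (suc j) x≈y = -‿cong (signed-cong j x≈y)

  signed-zero : ∀ j → signed j 0# ≈ 0#
  signed-zero zero    = refl
  signed-zero (suc j) = trans (-‿cong (signed-zero j)) -0#≈0#

  signed-+ : ∀ j x y → signed j (x + y) ≈ signed j x + signed j y
  signed-+ zero    x y = refl
  signed-+ (suc j) x y = trans (-‿cong (signed-+ j x y)) (sym (-‿+-comm _ _))

  signed-*ˡ : ∀ j x y → signed j (x * y) ≈ x * signed j y
  signed-*ˡ zero    x y = refl
  signed-*ˡ (suc j) x y = trans (-‿cong (signed-*ˡ j x y)) (-‿distribʳ-* x _)

  signed-*ʳ : ∀ j x y → signed j (x * y) ≈ signed j x * y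
  signed-*ʳ j x y = trans (signed-cong j (*-comm x y)) (trans (signed-*ˡ j y x) (*-comm y _))

  signed-neg : ∀ j x → signed j (- x) ≈ - signed j x
  signed-neg zero    x = refl
  signed-neg (suc j) x = -‿cong (signed-neg j x)

  signed-comm : ∀ i j x → signed i (signed j x) ≈ signed j (signed i x)
  signed-comm zero    j x = refl
  signed-comm (suc i) j x = trans (-‿cong (signed-comm i j x)) (sym (signed-neg j _))

  signed-involutive : ∀ j x → signed j (signed j x) ≈ x
  signed-involutive zero    x = refl
  signed-involutive (suc j) x = trans (-‿cong (signed-neg j _))
    (trans (-‿involutive _) (signed-involutive j x))

  signed-signed : ∀ i j x → signed i (signed j x) ≈ signed (i ℕ.+ j) x
  signed-signed zero    j x = refl
  signed-signed (suc i) j x = -‿cong (signed-signed i j x)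

  signed-sum : ∀ {n} j (f : Vector Carrier n) → signed j (sum f) ≈ sum (signed j ∘ f)
  signed-sum {zero}  j f = signed-zero j
  signed-sum {suc n} j f = trans (signed-+ j _ _) (+-congˡ (signed-sum j (tail f)))

  sum-zero : ∀ {n} {f : Vector Carrier n} → (∀ i → f i ≈ 0#) → sum f ≈ 0#
  sum-zero {n} f≈0 = trans (sum-cong-≋ f≈0) (sum-replicate-zero n)

  minor : ∀ {n} → Matrix Carrier (suc n) → Fin (suc n) → Fin (suc n) → Matrix Carrier n
  minor M i j r c = M (punchIn i r) (punchIn j c)

  infix 8 _ᵀ
  _ᵀ : ∀ {n} → Matrix Carrier n → Matrix Carrier n
  (M ᵀ) i j = M j i

  det-cong : ∀ {n} {M N : Matrix Carrier n} → (∀ i j → M i j ≈ N i j) → det M ≈ det N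
  det-cong {zero}  M≈N = refl
  det-cong {suc n} M≈N = sum-cong-≋ λ j →
    signed-cong (toℕ j) (*-cong (M≈N zero j) (det-cong λ r c → M≈N (suc r) (punchIn j c)))

  det-scaleRows : ∀ {n} (d : Vector Carrier n) (M : Matrix Carrier n) →
    det (λ i j → d i * M i j) ≈ product d * det M
  det-scaleRows {zero}  d M = sym (*-identityˡ 1#)
  det-scaleRows {suc n} d M = begin
    sum (λ j → signed (toℕ j) (d zero * M zero j * det (λ r c → d (suc r) * minor M zero j r c)))
      ≈⟨ sum-cong-≋ (λ j → trans (signed-cong (toℕ j) (step j)) (signed-*ˡ (toℕ j) _ _)) ⟩
    sum (λ j → product d * signed (toℕ j) (M zero j * det (minor M zero j)))
      ≈⟨ *-distribˡ-sum (product d) (λ j → signed (toℕ j) (M zero j * det (minor M zero j))) ⟨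
    product d * det M ∎
    where
    step : ∀ j → d zero * M zero j * det (λ r c → d (suc r) * minor M zero j r c) ≈
      product d * (M zero j * det (minor M zero j))
    step j = begin
      d zero * M zero j * det (λ r c → d (suc r) * minor M zero j r c)
        ≈⟨ *-congˡ (det-scaleRows (tail d) (minor M zero j)) ⟩
      d zero * M zero j * (product (tail d) * det (minor M zero j))
        ≈⟨ *-assoc _ _ _ ⟩
      d zero * (M zero j * (product (tail d) * det (minor M zero j)))
        ≈⟨ *-congˡ (x*yz≈y*xz _ _ _) ⟩
      d zero * (product (tail d) * (M zero j * det (minor M zero j)))
        ≈⟨ *-assoc _ _ _ ⟨
      product d * (M zero j * det (minor M zero j)) ∎

  det-scaleColumns : ∀ {n} (d : Vector Carrier n) (M : Matrix Carrier n) →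
    det (λ i j → d j * M i j) ≈ product d * det M
  det-scaleColumns {zero}  d M = sym (*-identityˡ 1#)
  det-scaleColumns {suc n} d M = begin
    sum (λ j → signed (toℕ j) (d j * M zero j * det (λ r c → d (punchIn j c) * minor M zero j r c)))
      ≈⟨ sum-cong-≋ (λ j → trans (signed-cong (toℕ j) (step j)) (signed-*ˡ (toℕ j) _ _)) ⟩
    sum (λ j → product d * signed (toℕ j) (M zero j * det (minor M zero j)))
      ≈⟨ *-distribˡ-sum (product d) (λ j → signed (toℕ j) (M zero j * det (minor M zero j))) ⟨
    product d * det M ∎
    where
    step : ∀ j → d j * M zero j * det (λ r c → d (punchIn j c) * minor M zero j r c) ≈
      product d * (M zero j * det (minor M zero j))
    step j = begin
      d j * M zero j * det (λ r c → d (punchIn j c) * minor M zero j r c)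
        ≈⟨ *-congˡ (det-scaleColumns (removeAt d j) (minor M zero j)) ⟩
      d j * M zero j * (product (removeAt d j) * det (minor M zero j))
        ≈⟨ *-assoc _ _ _ ⟩
      d j * (M zero j * (product (removeAt d j) * det (minor M zero j)))
        ≈⟨ *-congˡ (x*yz≈y*xz _ _ _) ⟩
      d j * (product (removeAt d j) * (M zero j * det (minor M zero j)))
        ≈⟨ *-assoc _ _ _ ⟨
      d j * product (removeAt d j) * (M zero j * det (minor M zero j))
        ≈⟨ *-congʳ (product-remove {i = j} d) ⟨
      product d * (M zero j * det (minor M zero j)) ∎

  -- Both sides expand to M₀₀ det M^{00} + ∑ᵢⱼ ± Mᵢ₀ M₀ⱼ det M^{0i,0j}.
  det-column : ∀ {n} (M : Matrix Carrier (suc n)) →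
    det M ≈ sum (λ i → signed (toℕ i) (M i zero * det (minor M i zero)))
  det-column {zero}  M = refl
  det-column {suc n} M = +-congˡ (begin
    sum (λ j → - signed (toℕ j) (M zero (suc j) * det (minor M zero (suc j))))
      ≈⟨ sum-cong-≋ (λ j → -‿cong (trans
           (signed-cong (toℕ j) (*-congˡ (det-column (minor M zero (suc j)))))
           (expand (toℕ j) (M zero (suc j)) (λ i → M (suc i) zero) (λ i → det (minor² i j))))) ⟩
    sum (λ j → - sum (λ i → signed (toℕ j) (signed (toℕ i) (M zero (suc j) * (M (suc i) zero * det (minor² i j))))))
      ≈⟨ sum-cong-≋ (λ j → signed-sum 1 (λ i → signed (toℕ j) (signed (toℕ i) (M zero (suc j) * (M (suc i) zero * det (minor² i j)))))) ⟩
    sum (λ j → sum (λ i → - signed (toℕ j) (signed (toℕ i) (M zero (suc j) * (M (suc i) zero * det (minor² i j))))))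
      ≈⟨ ∑-comm (λ j i → - signed (toℕ j) (signed (toℕ i) (M zero (suc j) * (M (suc i) zero * det (minor² i j))))) ⟩
    sum (λ i → sum (λ j → - signed (toℕ j) (signed (toℕ i) (M zero (suc j) * (M (suc i) zero * det (minor² i j))))))
      ≈⟨ sum-cong-≋ (λ i → sum-cong-≋ {suc n} (λ j → -‿cong (trans (signed-comm (toℕ j) (toℕ i) _)
           (signed-cong (toℕ i) (signed-cong (toℕ j)
             (x*yz≈y*xz (M zero (suc j)) (M (suc i) zero) (det (minor² i j)))))))) ⟩
    sum (λ i → sum (λ j → - signed (toℕ i) (signed (toℕ j) (M (suc i) zero * (M zero (suc j) * det (minor² i j))))))
      ≈⟨ sum-cong-≋ (λ i → signed-sum 1 (λ j → signed (toℕ i) (signed (toℕ j) (M (suc i) zero * (M zero (suc j) * det (minor² i j)))))) ⟨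
    sum (λ i → - sum (λ j → signed (toℕ i) (signed (toℕ j) (M (suc i) zero * (M zero (suc j) * det (minor² i j))))))
      ≈⟨ sum-cong-≋ (λ i → -‿cong
           (expand (toℕ i) (M (suc i) zero) (λ j → M zero (suc j)) (λ j → det (minor² i j)))) ⟨
    sum (λ i → - signed (toℕ i) (M (suc i) zero * det (minor M (suc i) zero))) ∎)
    where
    minor² : Fin (suc n) → Fin (suc n) → Matrix Carrier n
    minor² i j r c = M (suc (punchIn i r)) (suc (punchIn j c))

    expand : ∀ s x (a b : Vector Carrier (suc n)) →
      signed s (x * sum (λ i → signed (toℕ i) (a i * b i))) ≈
      sum (λ i → signed s (signed (toℕ i) (x * (a i * b i))))
    expand s x a b = begin
      signed s (x * sum (λ i → signed (toℕ i) (a i * b i)))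
        ≈⟨ signed-cong s (*-distribˡ-sum x (λ i → signed (toℕ i) (a i * b i))) ⟩
      signed s (sum (λ i → x * signed (toℕ i) (a i * b i)))
        ≈⟨ signed-sum s (λ i → x * signed (toℕ i) (a i * b i)) ⟩
      sum (λ i → signed s (x * signed (toℕ i) (a i * b i)))
        ≈⟨ sum-cong-≋ (λ i → signed-cong s (signed-*ˡ (toℕ i) x (a i * b i))) ⟨
      sum (λ i → signed s (signed (toℕ i) (x * (a i * b i)))) ∎

  -- The expansion of `M ᵀ` along its first row is the expansion of `M` along its first column, with
  -- transposed minors.
  det-ᵀ : ∀ {n} (M : Matrix Carrier n) → det (M ᵀ) ≈ det M
  det-ᵀ {zero}  M = refl
  det-ᵀ {suc n} M = trans
    (sum-cong-≋ λ j → signed-cong (toℕ j) (*-congˡ {M j zero} (det-ᵀ (minor M j zero))))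
    (sym (det-column M))

  swap₀₁ : ∀ {n} → Fin (suc (suc n)) → Fin (suc (suc n))
  swap₀₁ zero          = suc zero
  swap₀₁ (suc zero)    = zero
  swap₀₁ (suc (suc i)) = suc (suc i)

  -- In the expansion along the first column the swap exchanges the first two terms, which carry
  -- opposite signs; in every other term it swaps the first two rows of the minor, so induction
  -- applies.
  det-swap₀₁ : ∀ {n} (M : Matrix Carrier (suc (suc n))) → det (M ∘ swap₀₁) ≈ - det M
  det-swap₀₁ {n} M = begin
    det (M ∘ swap₀₁)
      ≈⟨ det-column (M ∘ swap₀₁) ⟩
    t₁ + (- det₀ + sum (λ i → - - signed (toℕ i) (M (suc (suc i)) zero * det (minor (M ∘ swap₀₁) (suc (suc i)) zero))))
      ≈⟨ +-congˡ (+-cong (-‿cong (*-congˡ (det-cong {M = minor (M ∘ swap₀₁) (suc zero) zero} {N = minor M zero zero}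
             λ { zero _ → refl ; (suc _) _ → refl })))
           (trans (sum-cong-≋ tails) (sym (signed-sum 1 rest)))) ⟩
    t₁ + (- t₀ + - sum rest)
      ≈⟨ +-assoc _ _ _ ⟨
    (t₁ + - t₀) + - sum rest
      ≈⟨ +-congʳ (+-comm _ _) ⟩
    (- t₀ + t₁) + - sum rest
      ≈⟨ +-assoc _ _ _ ⟩
    - t₀ + (t₁ + - sum rest)
      ≈⟨ +-congˡ (+-congʳ (trans (sym (-‿involutive t₁)) (-‿cong (-‿cong (*-congˡ
           (det-cong {M = minor (M ∘ swap₀₁) zero zero} {N = minor M (suc zero) zero}
             λ { zero _ → refl ; (suc _) _ → refl })))))) ⟩
    - t₀ + (- - t₁′ + - sum rest)
      ≈⟨ +-congˡ (-‿+-comm _ _) ⟩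
    - t₀ + - (- t₁′ + sum rest)
      ≈⟨ -‿+-comm _ _ ⟩
    - (t₀ + (- t₁′ + sum rest))
      ≈⟨ -‿cong (det-column M) ⟨
    - det M ∎
    where
    t₀ = M zero zero * det (minor M zero zero)
    det₀ = M zero zero * det (minor (M ∘ swap₀₁) (suc zero) zero)
    t₁ = M (suc zero) zero * det (minor (M ∘ swap₀₁) zero zero)
    t₁′ = M (suc zero) zero * det (minor M (suc zero) zero)
    rest : Vector Carrier n
    rest i = - - signed (toℕ i) (M (suc (suc i)) zero * det (minor M (suc (suc i)) zero))
    tails : ∀ i → - - signed (toℕ i) (M (suc (suc i)) zero * det (minor (M ∘ swap₀₁) (suc (suc i)) zero)) ≈ - rest i
    tails = tails′ M
      where
      -- The size is quantified anew so that it can be matched: an index `i` exists only for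
      -- `suc n`, and then the minor is large enough for the inductive swap.
      tails′ : ∀ {n} (M : Matrix Carrier (suc (suc n))) i →
        - - signed (toℕ i) (M (suc (suc i)) zero * det (minor (M ∘ swap₀₁) (suc (suc i)) zero)) ≈
        - (- - signed (toℕ i) (M (suc (suc i)) zero * det (minor M (suc (suc i)) zero)))
      tails′ {suc n} M i = -‿cong (-‿cong (trans
        (signed-cong (toℕ i) (trans
          (*-congˡ (trans
            (det-cong {M = minor (M ∘ swap₀₁) (suc (suc i)) zero} {N = minor M (suc (suc i)) zero ∘ swap₀₁}
              λ { zero _ → refl ; (suc zero) _ → refl ; (suc (suc _)) _ → refl })
            (det-swap₀₁ (minor M (suc (suc i)) zero))))
          (sym (-‿distribʳ-* _ _))))
        (signed-neg (toℕ i) _)))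

  -- Only the existence of a sign independent of the matrix is recorded. When rows and columns are
  -- relabelled alike it occurs twice and cancels, so parities need not be computed.
  RowSigned : ∀ {n} → (Fin n → Fin n) → Set _
  RowSigned {n} φ = ∃ λ s → ∀ (M : Matrix Carrier n) → det (M ∘ φ) ≈ signed s (det M)

  lift₀ : ∀ {m n} → (Fin m → Fin n) → Fin (suc m) → Fin (suc n)
  lift₀ φ zero    = zero
  lift₀ φ (suc i) = suc (φ i)

  rowSigned-lift₀ : ∀ {n} {φ : Fin n → Fin n} → RowSigned φ → RowSigned (lift₀ φ)
  rowSigned-lift₀ (s , h) = s , λ M → trans
    (sum-cong-≋ λ j → trans
      (signed-cong (toℕ j) (trans (*-congˡ {M zero j} (h (minor M zero j))) (sym (signed-*ˡ s _ _))))
      (signed-comm (toℕ j) s _))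
    (sym (signed-sum s (λ j → signed (toℕ j) (M zero j * det (minor M zero j)))))

  rowSigned-∘ : ∀ {n} {φ ψ : Fin n → Fin n} → RowSigned φ → RowSigned ψ → RowSigned (φ ∘ ψ)
  rowSigned-∘ {φ = φ} (s , h) (t , k) = t ℕ.+ s , λ M →
    trans (k (M ∘ φ)) (trans (signed-cong t (h M)) (signed-signed t s _))

  rowSigned-resp : ∀ {n} {φ ψ : Fin n → Fin n} → φ ≗ ψ → RowSigned φ → RowSigned ψ
  rowSigned-resp φ≗ψ (s , h) = s , λ M →
    trans (det-cong λ i j → reflexive (cong (λ r → M r j) (≡.sym (φ≗ψ i)))) (h M)

  -- As a row map it brings row `a` to the front and keeps the order of the others. It is a
  -- composite of adjacent transpositions, hence built from `swap₀₁` and `lift₀`.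
  cycle : ∀ {n} → Fin (suc n) → Fin (suc n) → Fin (suc n)
  cycle a zero    = a
  cycle a (suc j) = punchIn a j

  rowSigned-cycle : ∀ {n} (a : Fin (suc n)) → RowSigned (cycle a)
  rowSigned-cycle zero = rowSigned-resp {φ = id} {ψ = cycle zero} (λ { zero → ≡.refl ; (suc _) → ≡.refl }) (0 , λ _ → refl)
  rowSigned-cycle {suc n} (suc a) = rowSigned-resp {φ = lift₀ (cycle a) ∘ swap₀₁} {ψ = cycle (suc a)}
    (λ { zero → ≡.refl ; (suc zero) → ≡.refl ; (suc (suc _)) → ≡.refl })
    (rowSigned-∘ {φ = lift₀ (cycle a)} {ψ = swap₀₁} (rowSigned-lift₀ {φ = cycle a} (rowSigned-cycle a)) (1 , det-swap₀₁))

  -- Insertion argument: φ is a map fixing 0, given by φ on the remaining rows with the value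
  -- `φ zero` punched out, followed by the cycle that sends 0 to `φ zero`.
  injective⇒rowSigned : ∀ {n} (φ : Fin n → Fin n) → Injective _≡_ _≡_ φ → RowSigned φ
  injective⇒rowSigned {zero}  φ φ-inj = 0 , λ _ → refl
  injective⇒rowSigned {suc n} φ φ-inj = rowSigned-resp {φ = cycle (φ zero) ∘ lift₀ φ′} {ψ = φ}
    (λ { zero → ≡.refl ; (suc j) → punchIn-punchOut (φ₀≢ j) })
    (rowSigned-∘ {φ = cycle (φ zero)} {ψ = lift₀ φ′} (rowSigned-cycle (φ zero))
      (rowSigned-lift₀ {φ = φ′} (injective⇒rowSigned φ′
        (λ {i} {j} eq → suc-injective (φ-inj (punchOut-injective (φ₀≢ i) (φ₀≢ j) eq))))))
    where
    φ₀≢ : ∀ j → φ zero ≢ φ (suc j)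
    φ₀≢ j eq with φ-inj eq
    ... | ()
    φ′ : Fin n → Fin n
    φ′ j = punchOut (φ₀≢ j)

  -- The two sizes are only propositionally equal because one will be the order of a digraph and the
  -- other the sum of the orders of its components.
  det-relabel : ∀ {m n} → m ≡ n → (φ : Fin m → Fin n) → Injective _≡_ _≡_ φ → (M : Matrix Carrier n) →
    det (λ i j → M (φ i) (φ j)) ≈ det M
  det-relabel ≡.refl φ φ-inj M = let s , h = injective⇒rowSigned φ φ-inj in begin
    det (λ i j → M (φ i) (φ j))          ≈⟨ h (λ i j → M i (φ j)) ⟩
    signed s (det (λ i j → M i (φ j)))   ≈⟨ signed-cong s (det-ᵀ (λ i j → M i (φ j))) ⟨
    signed s (det ((M ᵀ) ∘ φ))             ≈⟨ signed-cong s (h (M ᵀ)) ⟩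
    signed s (signed s (det (M ᵀ)))      ≈⟨ signed-involutive s _ ⟩
    det (M ᵀ)                            ≈⟨ det-ᵀ M ⟩
    det M                                ∎

  punchIn-↑ˡ : ∀ {m} n (j : Fin (suc m)) (c : Fin m) → punchIn (j ↑ˡ n) (c ↑ˡ n) ≡ punchIn j c ↑ˡ n
  punchIn-↑ˡ n zero    c       = ≡.refl
  punchIn-↑ˡ n (suc j) zero    = ≡.refl
  punchIn-↑ˡ n (suc j) (suc c) = cong suc (punchIn-↑ˡ n j c)

  punchIn-↑ʳ : ∀ m {n} (j : Fin (suc m)) (d : Fin n) → punchIn (j ↑ˡ n) (m ↑ʳ d) ≡ suc m ↑ʳ d
  punchIn-↑ʳ m       zero    d = ≡.refl
  punchIn-↑ʳ (suc m) (suc j) d = cong suc (punchIn-↑ʳ m j d)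

  -- Induction on the upper left block: the first row vanishes beyond it, and each remaining minor
  -- has the same shape with a smaller upper left block and an unchanged lower right one.
  det-block : ∀ m {n} (M : Matrix Carrier (m ℕ.+ n)) → (∀ i j → M (i ↑ˡ n) (m ↑ʳ j) ≈ 0#) →
    det M ≈ det (λ i j → M (i ↑ˡ n) (j ↑ˡ n)) * det (λ i j → M (m ↑ʳ i) (m ↑ʳ j))
  det-block zero        M M₁₂≈0 = sym (*-identityˡ _)
  det-block (suc m) {n} M M₁₂≈0 = begin
    sum t
      ≈⟨ sum-++ +-commutativeMonoid (suc m) t ⟩
    sum (λ j → t (j ↑ˡ n)) + sum (λ j → t (suc m ↑ʳ j))
      ≈⟨ +-congˡ (sum-zero λ j → trans (signed-cong (toℕ (suc m ↑ʳ j))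
           (trans (*-congʳ (M₁₂≈0 zero j)) (zeroˡ _))) (signed-zero (toℕ (suc m ↑ʳ j)))) ⟩
    sum (λ j → t (j ↑ˡ n)) + 0#
      ≈⟨ +-identityʳ _ ⟩
    sum (λ j → t (j ↑ˡ n))
      ≈⟨ sum-cong-≋ term ⟩
    sum (λ j → t₁₁ j * det M₂₂)
      ≈⟨ *-distribʳ-sum (det M₂₂) t₁₁ ⟨
    det M₁₁ * det M₂₂ ∎
    where
    M₁₁ : Matrix Carrier (suc m)
    M₁₁ i j = M (i ↑ˡ n) (j ↑ˡ n)
    M₂₂ : Matrix Carrier n
    M₂₂ i j = M (suc m ↑ʳ i) (suc m ↑ʳ j)
    t : Vector Carrier (suc m ℕ.+ n)
    t j = signed (toℕ j) (M zero j * det (minor M zero j))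
    t₁₁ : Vector Carrier (suc m)
    t₁₁ j = signed (toℕ j) (M₁₁ zero j * det (minor M₁₁ zero j))

    expand : ∀ j → det (minor M zero (j ↑ˡ n)) ≈ det (minor M₁₁ zero j) * det M₂₂
    expand j = trans
      (det-block m (minor M zero (j ↑ˡ n)) λ r d →
        trans (reflexive (cong (M (suc (r ↑ˡ n))) (punchIn-↑ʳ m j d))) (M₁₂≈0 (suc r) d))
      (*-cong
        (det-cong λ r c → reflexive (cong (M (suc (r ↑ˡ n))) (punchIn-↑ˡ n j c)))
        (det-cong λ r c → reflexive (cong (M (suc (m ↑ʳ r))) (punchIn-↑ʳ m j c))))

    term : ∀ j → t (j ↑ˡ n) ≈ t₁₁ j * det M₂₂
    term j = begin
      signed (toℕ (j ↑ˡ n)) (M zero (j ↑ˡ n) * det (minor M zero (j ↑ˡ n)))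
        ≡⟨ cong (λ s → signed s (M zero (j ↑ˡ n) * det (minor M zero (j ↑ˡ n)))) (toℕ-↑ˡ j n) ⟩
      signed (toℕ j) (M₁₁ zero j * det (minor M zero (j ↑ˡ n)))
        ≈⟨ signed-cong (toℕ j) (trans (*-congˡ (expand j)) (sym (*-assoc _ _ _))) ⟩
      signed (toℕ j) (M₁₁ zero j * det (minor M₁₁ zero j) * det M₂₂)
        ≈⟨ signed-*ʳ (toℕ j) _ _ ⟩
      t₁₁ j * det M₂₂ ∎

  det-blocks : ∀ {k} (n : Vector ℕ k) (B : Σ (Fin k) (Fin ∘ n) → Σ (Fin k) (Fin ∘ n) → Carrier) →
    (∀ i j a b → i ≢ j → B (i , a) (j , b) ≈ 0#) →
    det (λ p q → B (locate n p) (locate n q)) ≈ product (λ i → det (λ a b → B (i , a) (i , b)))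
  det-blocks {zero}  n B B≈0 = refl
  det-blocks {suc k} n B B≈0 = begin
    det (λ p q → B (locate n p) (locate n q))
      ≈⟨ det-block (n zero) (λ p q → B (locate n p) (locate n q)) (λ a q → trans
           (reflexive (cong₂ B (locate-↑ˡ n a) (locate-↑ʳ n q))) (B≈0 zero _ _ _ λ ())) ⟩
    det (λ (a b : Fin (n zero)) → B (locate n (a ↑ˡ ∑ℕ (tail n))) (locate n (b ↑ˡ ∑ℕ (tail n)))) *
    det (λ p q → B (locate n (n zero ↑ʳ p)) (locate n (n zero ↑ʳ q)))
      ≈⟨ *-cong
           (det-cong λ a b → reflexive (cong₂ B (locate-↑ˡ n a) (locate-↑ˡ n b)))
           (trans (det-cong λ p q → reflexive (cong₂ B (locate-↑ʳ n p) (locate-↑ʳ n q)))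
             (det-blocks (tail n) (λ x y → B (next n x) (next n y))
               λ i j a b i≢j → B≈0 (suc i) (suc j) a b (i≢j ∘ suc-injective))) ⟩
    product (λ i → det (λ a b → B (i , a) (i , b))) ∎

-- Polynomial functions

module PolynomialFunctions {ℓ} (R : CommutativeRing 0ℓ ℓ) where
  open CommutativeRing R hiding (zero)
  open Determinant rawRing
  open RingProperties ring using (-‿distribˡ-*)
  open SemiringSum semiring using (sum)
  open CommutativeMonoidSum *-commutativeMonoid using () renaming (sum to product)
  open Exponentiation semiring using (_^_)
  open SetoidReasoning setoid
  open SemiringSolver commutativeSemiring using (solve; _:=_; _:+_; _:*_)

  -- Horner form: f z = c₀ + z (c₁ + z (⋯ + z c_{d−1})).
  IsPolynomial : ℕ → (Carrier → Carrier) → Set ℓ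
  IsPolynomial zero    f = ∀ z → f z ≈ 0#
  IsPolynomial (suc d) f = ∃₂ λ c g → IsPolynomial d g × (∀ z → f z ≈ c + z * g z)

  Polynomial : (Carrier → Carrier) → Set ℓ
  Polynomial f = ∃ λ d → IsPolynomial d f

  isPolynomial-resp : ∀ d {f g} → (∀ z → f z ≈ g z) → IsPolynomial d f → IsPolynomial d g
  isPolynomial-resp zero    f≈g f≈0             = λ z → trans (sym (f≈g z)) (f≈0 z)
  isPolynomial-resp (suc d) f≈g (c , h , p , e) = c , h , p , λ z → trans (sym (f≈g z)) (e z)

  -- The Horner form forces the function to respect the setoid equality, so this need not be
  -- demanded in `IsPolynomial`.
  isPolynomial-cong : ∀ d {f} → IsPolynomial d f → ∀ {x y} → x ≈ y → f x ≈ f y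
  isPolynomial-cong zero    f≈0             {x} {y} x≈y = trans (f≈0 x) (sym (f≈0 y))
  isPolynomial-cong (suc d) (c , g , p , e) {x} {y} x≈y =
    trans (e x) (trans (+-congˡ (*-cong x≈y (isPolynomial-cong d p x≈y))) (sym (e y)))

  isPolynomial-+ : ∀ m n {f g} → IsPolynomial m f → IsPolynomial n g →
    IsPolynomial (m ℕ.⊔ n) (λ z → f z + g z)
  isPolynomial-+ zero n f≈0 q =
    isPolynomial-resp n (λ z → sym (trans (+-congʳ (f≈0 z)) (+-identityˡ _))) q
  isPolynomial-+ (suc m) zero p g≈0 =
    isPolynomial-resp (suc m) (λ z → sym (trans (+-congˡ (g≈0 z)) (+-identityʳ _))) p
  isPolynomial-+ (suc m) (suc n) {f} {g} (c , f′ , p , e) (d , g′ , q , e′) =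
    c + d , _ , isPolynomial-+ m n p q , λ z → trans (+-cong (e z) (e′ z)) (rearrange c d z (f′ z) (g′ z))
    where
    rearrange : ∀ c d z x y → (c + z * x) + (d + z * y) ≈ (c + d) + z * (x + y)
    rearrange = solve 5 (λ c d z x y → (c :+ z :* x) :+ (d :+ z :* y) := (c :+ d) :+ z :* (x :+ y)) refl

  isPolynomial-scale : ∀ d a {f} → IsPolynomial d f → IsPolynomial d (λ z → a * f z)
  isPolynomial-scale zero    a f≈0 = λ z → trans (*-congˡ (f≈0 z)) (zeroʳ a)
  isPolynomial-scale (suc d) a (c , g , p , e) = a * c , _ , isPolynomial-scale d a p ,
    λ z → trans (*-congˡ (e z)) (rearrange a c z (g z))
    where
    rearrange : ∀ a c z x → a * (c + z * x) ≈ a * c + z * (a * x)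
    rearrange = solve 4 (λ a c z x → a :* (c :+ z :* x) := a :* c :+ z :* (a :* x)) refl

  polynomial-resp : ∀ {f g} → (∀ z → f z ≈ g z) → Polynomial f → Polynomial g
  polynomial-resp f≈g (d , p) = d , isPolynomial-resp d f≈g p

  polynomial-+ : ∀ {f g} → Polynomial f → Polynomial g → Polynomial (λ z → f z + g z)
  polynomial-+ (m , p) (n , q) = m ℕ.⊔ n , isPolynomial-+ m n p q

  polynomial-const : ∀ c → Polynomial (λ _ → c)
  polynomial-const c = 1 , c , (λ _ → 0#) , (λ _ → refl) , λ z → sym (trans (+-congˡ (zeroʳ z)) (+-identityʳ c))

  polynomial-shift : ∀ {f} → Polynomial f → Polynomial (λ z → z * f z)
  polynomial-shift {f} (d , p) = suc d , 0# , f , p , λ z → sym (+-identityˡ _)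

  polynomial-id : Polynomial (λ z → z)
  polynomial-id = polynomial-resp (λ z → *-identityʳ z) (polynomial-shift (polynomial-const 1#))

  polynomial-* : ∀ {f g} → Polynomial f → Polynomial g → Polynomial (λ z → f z * g z)
  polynomial-* {f} {g} (m , p) (n , q) = multiply m p
    where
    rearrange : ∀ c z x y → c * y + z * (x * y) ≈ (c + z * x) * y
    rearrange = solve 4 (λ c z x y → c :* y :+ z :* (x :* y) := (c :+ z :* x) :* y) refl
    multiply : ∀ m {f} → IsPolynomial m f → Polynomial (λ z → f z * g z)
    multiply zero    f≈0 = 0 , λ z → trans (*-congʳ (f≈0 z)) (zeroˡ _)
    multiply (suc m) (c , h , p , e) = polynomial-resp
      (λ z → trans (rearrange c z (h z) (g z)) (*-congʳ (sym (e z))))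
      (polynomial-+ (n , isPolynomial-scale n c q) (polynomial-shift (multiply m p)))

  polynomial-neg : ∀ {f} → Polynomial f → Polynomial (λ z → - f z)
  polynomial-neg {f} p = polynomial-resp
    (λ z → trans (sym (-‿distribˡ-* 1# (f z))) (-‿cong (*-identityˡ (f z))))
    (polynomial-* (polynomial-const (- 1#)) p)

  polynomial-^ : ∀ k → Polynomial (_^ k)
  polynomial-^ zero    = polynomial-const 1#
  polynomial-^ (suc k) = polynomial-shift (polynomial-^ k)

  polynomial-product : ∀ {n} {f : Fin n → Carrier → Carrier} → (∀ i → Polynomial (f i)) →
    Polynomial (λ z → product (λ i → f i z))
  polynomial-product {zero}  p = polynomial-const 1#
  polynomial-product {suc n} p = polynomial-* (p zero) (polynomial-product (p ∘ suc))

  polynomial-sum : ∀ {n} {f : Fin n → Carrier → Carrier} → (∀ i → Polynomial (f i)) →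
    Polynomial (λ z → sum (λ i → f i z))
  polynomial-sum {zero}  p = polynomial-const 0#
  polynomial-sum {suc n} p = polynomial-+ (p zero) (polynomial-sum (p ∘ suc))

  polynomial-signed : ∀ j {f} → Polynomial f → Polynomial (λ z → signed j (f z))
  polynomial-signed zero    p = p
  polynomial-signed (suc j) p = polynomial-neg (polynomial-signed j p)

  polynomial-det : ∀ {n} {M : Carrier → Matrix Carrier n} → (∀ i j → Polynomial (λ z → M z i j)) →
    Polynomial (λ z → det (M z))
  polynomial-det {zero}  p = polynomial-const 1#
  polynomial-det {suc n} p = polynomial-sum λ j → polynomial-signed (toℕ j)
    (polynomial-* (p zero j) (polynomial-det λ r c → p (suc r) (punchIn j c)))

  -- The factor theorem f(z) = f(a) + (z − a) g(z), with z = a + w.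
  factor : ∀ d {f} → IsPolynomial (suc d) f → ∀ a →
    ∃ λ g → IsPolynomial d g × (∀ w → f (a + w) ≈ f a + w * g (a + w))
  factor zero {f} (c , h , h≈0 , e) a = (λ _ → 0#) , (λ _ → refl) , λ w → begin
    f (a + w)     ≈⟨ f≈c (a + w) ⟩
    c             ≈⟨ f≈c a ⟨
    f a           ≈⟨ +-identityʳ _ ⟨
    f a + 0#      ≈⟨ +-congˡ (zeroʳ w) ⟨
    f a + w * 0#  ∎
    where
    f≈c : ∀ z → f z ≈ c
    f≈c z = trans (e z) (trans (+-congˡ (trans (*-congˡ (h≈0 z)) (zeroʳ z))) (+-identityʳ c))
  factor (suc d) {f} (c , h , p , e) a = let k , q , e′ = factor d p a in
    -- Synthetic division: if `k` is the quotient of `h` at `a`, then the quotient of `f` has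
    -- constant coefficient `h a` and Horner remainder `k`.
    (λ z → h a + z * k z) , (h a , k , q , λ _ → refl) , λ w → begin
      f (a + w)                                              ≈⟨ e (a + w) ⟩
      c + (a + w) * h (a + w)                                ≈⟨ +-congˡ (*-congˡ (e′ w)) ⟩
      c + (a + w) * (h a + w * k (a + w))                    ≈⟨ rearrange c a w (h a) (k (a + w)) ⟩
      (c + a * h a) + w * (h a + (a + w) * k (a + w))        ≈⟨ +-congʳ (e a) ⟨
      f a + w * (h a + (a + w) * k (a + w))                  ∎
    where
    rearrange : ∀ c a w x y → c + (a + w) * (x + w * y) ≈ (c + a * x) + w * (x + (a + w) * y)
    rearrange = solve 5 (λ c a w x y →
      c :+ (a :+ w) :* (x :+ w :* y) := (c :+ a :* x) :+ w :* (x :+ (a :+ w) :* y)) refl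

-- Rings of characteristic zero without zero divisors

module _ {ℓ} (R : CommutativeRing 0ℓ ℓ) where
  open CommutativeRing R
  open RawMonoid +-rawMonoid using () renaming (_×_ to _·_)

  -- Phrased as cancellation of a nonzero factor and not as a disjunction, since for Cauchy complex
  -- numbers there is no deciding which factor of a vanishing product is zero.
  NoZeroDivisors : Set ℓ
  NoZeroDivisors = ∀ {x y} → x * y ≈ 0# → ¬ (x ≈ 0#) → y ≈ 0#

  CharacteristicZero : Set ℓ
  CharacteristicZero = ∀ n → ¬ (suc n · 1# ≈ 0#)

module CharacteristicZeroDomain {ℓ} (R : CommutativeRing 0ℓ ℓ)
  (cancel : NoZeroDivisors R) (char0 : CharacteristicZero R) where
  open CommutativeRing R
  open RawMonoid +-rawMonoid using () renaming (_×_ to _·_)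
  open Determinant rawRing
  open DeterminantProperties R using (det-scaleRows; det-scaleColumns; det-cong)
  open PolynomialFunctions R
  open RingProperties ring using (-‿distribʳ-*)
  open CommutativeMonoidSum *-commutativeMonoid using () renaming (sum to product; sum-remove to product-remove)
  open Exponentiation semiring using (_^_; ^-homo-*)
  open SetoidReasoning setoid

  x-y≈0⇒x≈y : ∀ {x y} → x - y ≈ 0# → x ≈ y
  x-y≈0⇒x≈y {x} {y} x-y≈0 = begin
    x              ≈⟨ +-identityʳ x ⟨
    x + 0#         ≈⟨ +-congˡ (-‿inverseˡ y) ⟨
    x + (- y + y)  ≈⟨ +-assoc x (- y) y ⟨
    (x - y) + y    ≈⟨ +-congʳ x-y≈0 ⟩
    0# + y         ≈⟨ +-identityˡ y ⟩
    y              ∎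

  x≈y⇒x-y≈0 : ∀ {x y} → x ≈ y → x - y ≈ 0#
  x≈y⇒x-y≈0 {y = y} x≈y = trans (+-congʳ x≈y) (-‿inverseʳ y)

  x+y-x≈y : ∀ x y → (x + y) - x ≈ y
  x+y-x≈y x y = begin
    (x + y) - x    ≈⟨ +-congʳ (+-comm x y) ⟩
    (y + x) - x    ≈⟨ +-assoc y x (- x) ⟩
    y + (x - x)    ≈⟨ +-congˡ (-‿inverseʳ x) ⟩
    y + 0#         ≈⟨ +-identityʳ y ⟩
    y              ∎

  *-cancelˡ-nonZero : ∀ {x y z} → ¬ (x ≈ 0#) → x * y ≈ x * z → y ≈ z
  *-cancelˡ-nonZero {x} {y} {z} x≉0 xy≈xz = x-y≈0⇒x≈y (cancel (begin
    x * (y - z)          ≈⟨ distribˡ x y (- z) ⟩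
    x * y + x * - z      ≈⟨ +-congˡ (-‿distribʳ-* x z) ⟨
    x * y - x * z        ≈⟨ x≈y⇒x-y≈0 xy≈xz ⟩
    0#                   ∎) x≉0)

  1≉0 : ¬ (1# ≈ 0#)
  1≉0 1≈0 = char0 0 (trans (+-identityʳ 1#) 1≈0)

  product-nonZero : ∀ {n} (x : Vector Carrier n) → (∀ i → ¬ (x i ≈ 0#)) → ¬ (product x ≈ 0#)
  product-nonZero {ℕ.zero}  x x≉0 = 1≉0
  product-nonZero {ℕ.suc n} x x≉0 = λ xs≈0 → product-nonZero (tail x) (x≉0 ∘ suc) (cancel xs≈0 (x≉0 Fin.zero))

  ^-nonZero : ∀ {x} k → ¬ (x ≈ 0#) → ¬ (x ^ k ≈ 0#)
  ^-nonZero ℕ.zero    x≉0 = 1≉0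
  ^-nonZero (ℕ.suc k) x≉0 = λ xx^k≈0 → ^-nonZero k x≉0 (cancel xx^k≈0 x≉0)

  -- The roots form an arithmetic progression a, a + 1, a + 2, .... Dividing out the root a leaves a
  -- quotient of lower degree that vanishes on the progression from a + 1, because the cancelled
  -- differences `suc n · 1#` are nonzero.
  isPolynomial-vanishing : ∀ d {f} → IsPolynomial d f → ∀ a → (∀ n → f (a + n · 1#) ≈ 0#) → ∀ z → f z ≈ 0#
  isPolynomial-vanishing ℕ.zero    f≈0 a roots = f≈0
  isPolynomial-vanishing (ℕ.suc d) {f} p a roots z with factor d p a
  ... | g , q , e = begin
    f z                            ≈⟨ isPolynomial-cong (suc d) p z≈a+[z-a] ⟩
    f (a + (z - a))                ≈⟨ e (z - a) ⟩
    f a + (z - a) * g (a + (z - a)) ≈⟨ +-cong fa≈0 (*-congˡ (g≈0 _)) ⟩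
    0# + (z - a) * 0#              ≈⟨ +-congˡ (zeroʳ _) ⟩
    0# + 0#                        ≈⟨ +-identityˡ 0# ⟩
    0#                             ∎
    where
    z≈a+[z-a] : z ≈ a + (z - a)
    z≈a+[z-a] = sym (trans (sym (+-assoc a z (- a))) (x+y-x≈y a z))
    fa≈0 : f a ≈ 0#
    fa≈0 = trans (isPolynomial-cong (suc d) p (sym (+-identityʳ a))) (roots 0)
    g≈0 : ∀ z → g z ≈ 0#
    g≈0 = isPolynomial-vanishing d q (a + 1#) λ n → trans
      (isPolynomial-cong d q (+-assoc a 1# (n · 1#)))
      (cancel (begin
        suc n · 1# * g (a + suc n · 1#)         ≈⟨ +-identityˡ _ ⟨
        0# + suc n · 1# * g (a + suc n · 1#)    ≈⟨ +-congʳ fa≈0 ⟨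
        f a + suc n · 1# * g (a + suc n · 1#)   ≈⟨ e (suc n · 1#) ⟨
        f (a + suc n · 1#)                      ≈⟨ roots (suc n) ⟩
        0#                                      ∎) (char0 n))

  -- The starting point is free so that the sample points can avoid the one place where a factor may
  -- not be cancelled: t = 0 for the deformation, z = x₀ for the removal of a common root x₀.
  polynomial-identity : ∀ {f g} → Polynomial f → Polynomial g → ∀ a →
    (∀ n → f (a + n · 1#) ≈ g (a + n · 1#)) → ∀ z → f z ≈ g z
  polynomial-identity p q a f≈g z = let d , r = polynomial-+ p (polynomial-neg q) in
    x-y≈0⇒x≈y (isPolynomial-vanishing d r a (λ n → x≈y⇒x-y≈0 (f≈g n)) z)

  -- Truncated subtraction makes every entry a polynomial in `t`, so that t = 0 may be inserted.
  -- Since `0# ^ 0` is `1#`, entries between equal heights survive there, while entries that go down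
  -- in height vanish.
  deform : ∀ {n} → (Fin n → ℕ) → Matrix Carrier n → Carrier → Matrix Carrier n
  deform h M t v w = M v w * t ^ (h v ℕ.∸ h w)

  -- For t ≠ 0 this is conjugation by the diagonal matrix of the t^(h v), and both
  -- sides are polynomials in t.
  det-deform : ∀ {n} (h : Fin n → ℕ) (M : Matrix Carrier n) → (∀ v w → M v w ≈ 0# ⊎ h w ℕ.≤ h v) →
    ∀ t → det (deform h M t) ≈ det M
  det-deform h M supp = polynomial-identity
    (polynomial-det λ v w → polynomial-* (polynomial-const (M v w)) (polynomial-^ (h v ℕ.∸ h w)))
    (polynomial-const (det M)) 1# λ n → conjugate (suc n · 1#) (char0 n)
    where
    entry : ∀ t v w → M v w ≈ 0# ⊎ h w ℕ.≤ h v → t ^ h w * deform h M t v w ≈ t ^ h v * M v w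
    entry t v w (inj₁ M≈0) = trans
      (trans (*-congˡ (trans (*-congʳ M≈0) (zeroˡ _))) (zeroʳ _))
      (sym (trans (*-congˡ M≈0) (zeroʳ _)))
    entry t v w (inj₂ hw≤hv) = begin
      t ^ h w * (M v w * t ^ (h v ℕ.∸ h w))   ≈⟨ *-congˡ (*-comm _ _) ⟩
      t ^ h w * (t ^ (h v ℕ.∸ h w) * M v w)   ≈⟨ *-assoc _ _ _ ⟨
      t ^ h w * t ^ (h v ℕ.∸ h w) * M v w     ≈⟨ *-congʳ (^-homo-* t (h w) (h v ℕ.∸ h w)) ⟨
      t ^ (h w ℕ.+ (h v ℕ.∸ h w)) * M v w     ≡⟨ cong (λ k → t ^ k * M v w) (ℕₚ.m+[n∸m]≡n hw≤hv) ⟩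
      t ^ h v * M v w                         ∎

    conjugate : ∀ t → ¬ (t ≈ 0#) → det (deform h M t) ≈ det M
    -- Scaling the columns of the deformed matrix gives the same matrix as scaling the rows of `M`;
    -- the common factor is cancelled, so `t` is never inverted.
    conjugate t t≉0 = *-cancelˡ-nonZero (product-nonZero (λ v → t ^ h v) λ v → ^-nonZero (h v) t≉0) (begin
      product (λ v → t ^ h v) * det (deform h M t)     ≈⟨ det-scaleColumns (λ v → t ^ h v) (deform h M t) ⟨
      det (λ v w → t ^ h w * deform h M t v w)         ≈⟨ det-cong (λ v w → entry t v w (supp v w)) ⟩
      det (λ v w → t ^ h v * M v w)                    ≈⟨ det-scaleRows (λ v → t ^ h v) M ⟩
      product (λ v → t ^ h v) * det M                  ∎)

  module _ {c ℓ′} (A : CommutativeMonoid c ℓ′) (G : Carrier → CommutativeMonoid.Carrier A)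
    (G-cong : ∀ {x y} → x ≈ y → CommutativeMonoid._≈_ A (G x) (G y)) where
    private module A = CommutativeMonoid A
    open CommutativeMonoidSum A using (sum; sum-remove)

    -- A root ys j equal to x₀ exists only classically, hence the double negation.
    sum-over-roots : ∀ {m n} → m ≡ n → (xs : Vector Carrier m) (ys : Vector Carrier n) →
      (∀ z → product (λ i → z - xs i) ≈ product (λ i → z - ys i)) →
      ¬ ¬ (sum (G ∘ xs) A.≈ sum (G ∘ ys))
    sum-over-roots {ℕ.zero}  ≡.refl xs ys eq k = k A.refl
    sum-over-roots {ℕ.suc n} ≡.refl xs ys eq k =
      -- If x₀ differed from every `ys j`, the right product would be nonzero at x₀, whereas the
      -- left one contains the factor x₀ - x₀.
      product-nonZero (λ j → x₀ - ys j) (λ j x₀-yⱼ≈0 → remove j (x-y≈0⇒x≈y x₀-yⱼ≈0)) (begin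
        product (λ j → x₀ - ys j)                     ≈⟨ eq x₀ ⟨
        (x₀ - x₀) * product (λ i → x₀ - tail xs i)    ≈⟨ *-congʳ (-‿inverseʳ x₀) ⟩
        0# * product (λ i → x₀ - tail xs i)           ≈⟨ zeroˡ _ ⟩
        0#                                            ∎)
      where
      x₀ = xs Fin.zero
      remove : ∀ j → x₀ ≈ ys j → ⊥
      remove j x₀≈yⱼ = sum-over-roots ≡.refl (tail xs) (removeAt ys j) reduced λ tails → k
        (A.trans (A.∙-cong (G-cong x₀≈yⱼ) tails) (A.sym (sum-remove {i = j} (G ∘ ys))))
        where
        linear : ∀ y → Polynomial (λ z → z - y)
        linear y = polynomial-+ polynomial-id (polynomial-const (- y))

        z-x₀ : ∀ n → (x₀ + 1# + n · 1#) - x₀ ≈ suc n · 1#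
        z-x₀ n = trans (+-congʳ (+-assoc x₀ 1# (n · 1#))) (x+y-x≈y x₀ (suc n · 1#))

        reduced : ∀ z → product (λ i → z - tail xs i) ≈ product (λ i → z - removeAt ys j i)
        -- The factor z - x₀ is cancelled only at z = x₀ + 1 + n, where it is the nonzero integer n
        -- + 1; the identity then spreads to all z.
        reduced = polynomial-identity
          (polynomial-product λ i → linear (tail xs i))
          (polynomial-product λ i → linear (removeAt ys j i)) (x₀ + 1#)
          λ n → let z = x₀ + 1# + n · 1# in *-cancelˡ-nonZero (char0 n) (begin
            suc n · 1# * product (λ i → z - tail xs i)         ≈⟨ *-congʳ (z-x₀ n) ⟨
            (z - x₀) * product (λ i → z - tail xs i)           ≈⟨ eq z ⟩
            product (λ i → z - ys i)                           ≈⟨ product-remove {i = j} (λ i → z - ys i) ⟩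
            (z - ys j) * product (λ i → z - removeAt ys j i)   ≈⟨ *-congʳ (+-congˡ (-‿cong x₀≈yⱼ)) ⟨
            (z - x₀) * product (λ i → z - removeAt ys j i)     ≈⟨ *-congʳ (z-x₀ n) ⟩
            suc n · 1# * product (λ i → z - removeAt ys j i)   ∎)

-- Strong components

open ≡ using (refl; sym; trans)

lookup-injective : ∀ {A : Set} {xs : List.List A} → Unique xs → Injective _≡_ _≡_ (List.lookup xs)
lookup-injective (x∉ ∷ xs!) {zero}  {zero}  eq = refl
lookup-injective (x∉ ∷ xs!) {zero}  {suc j} eq = contradiction eq (All.lookup x∉ (∈-lookup j))
lookup-injective (x∉ ∷ xs!) {suc i} {zero}  eq = contradiction (sym eq) (All.lookup x∉ (∈-lookup i))
lookup-injective (x∉ ∷ xs!) {suc i} {suc j} eq = cong suc (lookup-injective xs! eq)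

T-injective : ∀ {b c} → (T b → T c) → (T c → T b) → b ≡ c
T-injective {true}  {true}  f g = refl
T-injective {true}  {false} f g = contradiction (f _) λ ()
T-injective {false} {true}  f g = contradiction (g _) λ ()
T-injective {false} {false} f g = refl

⊆-trans : ∀ {D} {H K L : SubDigraph D} → H ⊆ K → K ⊆ L → H ⊆ L
⊆-trans (f , f-embed , f-arc) (g , g-embed , g-arc) =
  g ∘ f , (λ v → trans (g-embed (f v)) (f-embed v)) , g-arc ∘ f-arc

module Components (D : Digraph) (reaches? : ∀ v w → Dec (Star (Arc D) v w)) where

  Reaches : Vertex D → Vertex D → Set
  Reaches = Star (Arc D)

  _↔_ : Vertex D → Vertex D → Set
  v ↔ w = Reaches v w × Reaches w v

  _↔?_ : ∀ v w → Dec (v ↔ w)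
  v ↔? w = reaches? v w ×-dec reaches? w v

  ↔-trans : ∀ {u v w} → u ↔ v → v ↔ w → u ↔ w
  ↔-trans (p , q) (p′ , q′) = p ◅◅ p′ , q′ ◅◅ q

  -- The components are identified by comparing them, through their maximality,
  -- with the subdigraphs class v induced on the classes of mutual reachability.

  members : Vertex D → List.List (Vertex D)
  members v = List.filter (v ↔?_) (List.allFin (order D))

  members-unique : ∀ v → Unique (members v)
  members-unique v = filter⁺ (v ↔?_) (allFin⁺ (order D))

  member : ∀ {v w} → v ↔ w → Fin (List.length (members v))
  member {v} {w} v↔w = Any.index (∈-filter⁺ (v ↔?_) (∈-allFin w) v↔w)

  lookup-member : ∀ {v w} (v↔w : v ↔ w) → List.lookup (members v) (member v↔w) ≡ w
  lookup-member {v} {w} v↔w = sym (lookup-index (∈-filter⁺ (v ↔?_) (∈-allFin w) v↔w))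

  class : Vertex D → SubDigraph D
  class v = record
    { digraph   = record
      { order    = List.length (members v)
      ; nonEmpty = Finₚ.nonZeroIndex (member {v} {v} (Star.ε , Star.ε))
      ; arc      = λ a b → Digraph.arc D (List.lookup (members v) a) (List.lookup (members v) b)
      }
    ; embed     = List.lookup (members v)
    ; injective = lookup-injective (members-unique v)
    ; arcs⊆     = λ arc → arc
    }

  class-↔ : ∀ v a → v ↔ embed (class v) a
  class-↔ v a = proj₂ (∈-filter⁻ (v ↔?_) {xs = List.allFin (order D)} (∈-lookup a))

  -- A walk of `D` between two members of a class stays in the class: each vertex on it is reachable
  -- from the start and reaches the end. The endpoints enter through equations so that the recursion
  -- can follow the walk in `D`.
  class-walk : ∀ v {x y} a b → Reaches x y → embed (class v) a ≡ x → embed (class v) b ≡ y →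
    Star (Arc (digraph (class v))) a b
  class-walk v a b Star.ε a≡x b≡x = subst (Star _ a) (lookup-injective (members-unique v) (trans a≡x (sym b≡x))) Star.ε
  class-walk v a b (_◅_ {_} {w} x→w w→y) refl refl =
    subst (Arc D (embed (class v) a)) (sym (lookup-member v↔w)) x→w
      ◅ class-walk v (member v↔w) b w→y (lookup-member v↔w) refl
    where
    v↔w : v ↔ w
    v↔w = proj₁ (class-↔ v a) ◅◅ (x→w ◅ Star.ε) , w→y ◅◅ proj₂ (class-↔ v b)

  class-stronglyConnected : ∀ v → StronglyConnected (digraph (class v))
  class-stronglyConnected v a b _ =
      class-walk v a b (proj₂ (class-↔ v a) ◅◅ proj₁ (class-↔ v b)) refl refl
    , class-walk v b a (proj₂ (class-↔ v b) ◅◅ proj₁ (class-↔ v a)) refl refl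

  connected-↔ : (H : SubDigraph D) → StronglyConnected (digraph H) → ∀ a b → embed H a ↔ embed H b
  connected-↔ H sc a b with a Finₚ.≟ b
  ... | yes refl = Star.ε , Star.ε
  ... | no a≢b = let p , q = sc a b a≢b in
    Star.gmap (embed H) (SubDigraph.arcs⊆ H) p , Star.gmap (embed H) (SubDigraph.arcs⊆ H) q

  ⊆-class : (H : SubDigraph D) → StronglyConnected (digraph H) → ∀ {v} b → v ↔ embed H b → H ⊆ class v
  ⊆-class H sc {v} b v↔b = (λ a → member (v↔ a)) , (λ a → lookup-member (v↔ a)) , λ {a} {c} a→c →
    subst₂ (Arc D) (sym (lookup-member (v↔ a))) (sym (lookup-member (v↔ c))) (SubDigraph.arcs⊆ H a→c)
    where
    v↔ : ∀ a → v ↔ embed H a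
    v↔ a = ↔-trans v↔b (connected-↔ H sc b a)

  module _ {k} (C : Fin k → SubDigraph D) (areComponents : AreTheStrongComponents C) where
    open AreTheStrongComponents areComponents

    C-↔ : ∀ i a b → embed (C i) a ↔ embed (C i) b
    C-↔ i = connected-↔ (C i) (proj₁ (component i))

    C⊆class : ∀ i {v} a → v ↔ embed (C i) a → C i ⊆ class v
    C⊆class i = ⊆-class (C i) (proj₁ (component i))

    class⊆C : ∀ i {v} a → v ↔ embed (C i) a → class v ⊆ C i
    class⊆C i {v} a v↔a = proj₂ (component i) (class v) (class-stronglyConnected v) (C⊆class i a v↔a)

    -- Two components that meet the same class both coincide with it, hence with each other, which
    -- distinctness allows only for equal indices.
    ↔⇒≡ : ∀ {i j} a b → embed (C i) a ↔ embed (C j) b → i ≡ j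
    ↔⇒≡ {i} {j} a b a↔b with i Finₚ.≟ j
    ... | yes i≡j = i≡j
    ... | no i≢j = contradiction
      ( ⊆-trans {H = C i} {K = class v} {L = C j} (C⊆class i a (Star.ε , Star.ε)) (class⊆C j b a↔b)
      , ⊆-trans {H = C j} {K = class v} {L = C i} (C⊆class j b a↔b) (class⊆C i a (Star.ε , Star.ε)))
      (distinct i j i≢j)
      where v = embed (C i) a

    -- A sub-digraph may omit arcs of `D`, but a strong component may not: by maximality it contains
    -- the class induced on its own vertices.
    arc-embed : ∀ i a b → Digraph.arc (digraph (C i)) a b ≡ Digraph.arc D (embed (C i) a) (embed (C i) b)
    arc-embed i a b = T-injective (SubDigraph.arcs⊆ (C i)) λ a→b →
      let g , g-embed , g-arc = class⊆C i a (Star.ε , Star.ε)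
          v = embed (C i) a
          a′ = member {v} {v} (Star.ε , Star.ε)
          b′ = member (C-↔ i a b)
          a′≡ = lookup-member {v} {v} (Star.ε , Star.ε)
          b′≡ = lookup-member (C-↔ i a b)
      in subst₂ (Arc (digraph (C i)))
           (SubDigraph.injective (C i) (trans (g-embed a′) a′≡))
           (SubDigraph.injective (C i) (trans (g-embed b′) b′≡))
           (g-arc (subst₂ (Arc D) (sym a′≡) (sym b′≡) a→b))

    orders : Vector ℕ k
    orders i = order (digraph (C i))

    vertex : Σ (Fin k) (Fin ∘ orders) → Vertex D
    vertex (i , a) = embed (C i) a

    vertex-injective : Injective _≡_ _≡_ vertex
    vertex-injective {i , a} {j , b} eq with ↔⇒≡ {i} {j} a b (subst (embed (C i) a ↔_) eq (Star.ε , Star.ε))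
    ... | refl = cong (i ,_) (SubDigraph.injective (C i) eq)

  -- The height of v is constant on strong components and decreases along the
  -- arcs between different ones.

  reachable : Vertex D → Subset (order D)
  reachable v = Vec.tabulate (λ w → does (reaches? v w))

  ∈-reachable : ∀ {v w} → Reaches v w → w ∈ reachable v
  ∈-reachable {v} {w} v→w = Vecₚ.lookup⇒[]= w (reachable v)
    (trans (Vecₚ.lookup∘tabulate _ w) (dec-true (reaches? v w) v→w))

  reachable-∈ : ∀ {v w} → w ∈ reachable v → Reaches v w
  reachable-∈ {v} {w} w∈ = witness (reaches? v w)
    (trans (sym (Vecₚ.lookup∘tabulate _ w)) (Vecₚ.[]=⇒lookup w∈))
    where
    witness : ∀ {P : Set} (P? : Dec P) → does P? ≡ true → P
    witness (yes p) _ = p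

  height : Vertex D → ℕ
  height v = ∣ reachable v ∣

  height-mono : ∀ {v w} → Reaches v w → height w ℕ.≤ height v
  height-mono v→w = p⊆q⇒∣p∣≤∣q∣ λ x∈ → ∈-reachable (v→w ◅◅ reachable-∈ x∈)

  -- The inclusion of reachable sets is strict because `v` reaches itself and is not reached from
  -- `w`.
  height-strict : ∀ {v w} → Reaches v w → ¬ Reaches w v → height w ℕ.< height v
  height-strict {v} v→w w↛v = p⊂q⇒∣p∣<∣q∣
    ((λ x∈ → ∈-reachable (v→w ◅◅ reachable-∈ x∈)) , v , ∈-reachable Star.ε , w↛v ∘ reachable-∈)

-- Factorization of a determinant along the strong components

module DeterminantFactorization {ℓ} (R : CommutativeRing 0ℓ ℓ)
  (cancel : NoZeroDivisors R) (char0 : CharacteristicZero R)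
  (D : Digraph) (reaches? : ∀ v w → Dec (Star (Arc D) v w)) where
  open CommutativeRing R
  open Determinant rawRing
  open DeterminantProperties R
  open CharacteristicZeroDomain R cancel char0 using (deform; det-deform)
  open Components D reaches?
  open Exponentiation semiring using (_^_)
  open CommutativeMonoidSum *-commutativeMonoid using () renaming (sum to product; sum-cong-≋ to product-cong)
  open SetoidReasoning setoid

  -- The zero pattern is prescribed off the diagonal only, since the diagonal entries of zI - A
  -- contain z even at vertices without a loop.
  det-components : ∀ {k} (C : Fin k → SubDigraph D) → AreTheStrongComponents C →
    order D ≡ ∑ℕ (λ i → order (digraph (C i))) →
    (M : Matrix Carrier (order D)) → (∀ {v w} → v ≢ w → ¬ Arc D v w → M v w ≈ 0#) →
    det M ≈ product (λ i → det (λ a b → M (embed (C i) a) (embed (C i) b)))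
  det-components C areComponents n≡∑ M M≈0 = begin
    det M
      ≈⟨ det-deform height M supported 0# ⟨
    det N
      -- Distinct components share no vertex, so the labelling is injective; equality of the orders
      -- makes it a permutation.
      ≈⟨ det-relabel (≡.sym n≡∑) (vertexᶜ ∘ locate n)
           (locate-injective n ∘ vertex-injective C areComponents) N ⟨
    det (λ p q → N (vertexᶜ (locate n p)) (vertexᶜ (locate n q)))
      ≈⟨ det-blocks n (λ x y → N (vertexᶜ x) (vertexᶜ y)) off-block ⟩
    product (λ i → det (λ a b → N (embed (C i) a) (embed (C i) b)))
      ≈⟨ product-cong (λ i → det-cong (block i)) ⟩
    product (λ i → det (λ a b → M (embed (C i) a) (embed (C i) b))) ∎
    where
    n = orders C areComponents
    vertexᶜ = vertex C areComponents
    N = deform height M 0#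

    supported : ∀ v w → M v w ≈ 0# ⊎ height w ℕ.≤ height v
    supported v w with v Finₚ.≟ w | T? (Digraph.arc D v w)
    ... | yes ≡.refl | _       = inj₂ ℕₚ.≤-refl
    ... | no _     | yes v→w = inj₂ (height-mono (v→w ◅ Star.ε))
    ... | no v≢w   | no v↛w  = inj₁ (M≈0 v≢w v↛w)

    block : ∀ i a b → N (embed (C i) a) (embed (C i) b) ≈ M (embed (C i) a) (embed (C i) b)
    block i a b = begin
      N v w             ≡⟨ cong (λ d → M v w * 0# ^ d) (≡.trans (cong (height v ℕ.∸_) hw≡hv) (ℕₚ.n∸n≡0 (height v))) ⟩
      M v w * 1#        ≈⟨ *-identityʳ (M v w) ⟩
      M v w             ∎
      where
      v = embed (C i) a
      w = embed (C i) b
      hw≡hv : height w ≡ height v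
      hw≡hv = let v→w , w→v = C-↔ C areComponents i a b in ℕₚ.≤-antisym (height-mono v→w) (height-mono w→v)

    off-block : ∀ i j a b → i ≢ j → N (embed (C i) a) (embed (C j) b) ≈ 0#
    off-block i j a b i≢j with T? (Digraph.arc D (embed (C i) a) (embed (C j) b))
    ... | no v↛w = CommutativeRing.trans R (*-congʳ (M≈0 (λ v≡w → i≢j (↔⇒≡ C areComponents a b (subst (embed (C i) a ↔_) v≡w (Star.ε , Star.ε)))) v↛w)) (zeroˡ _)
    -- An arc between different components lowers the height strictly, so the exponent is positive
    -- and a factor `0#` can be split off.
    ... | yes v→w = begin
      M v w * 0# ^ (height v ℕ.∸ height w)
        ≡⟨ cong (λ d → M v w * 0# ^ d) (≡.sym (ℕₚ.suc-pred (height v ℕ.∸ height w) {{ℕ.>-nonZero (ℕₚ.m<n⇒0<n∸m hw<hv)}})) ⟩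
      M v w * (0# * 0# ^ ℕ.pred (height v ℕ.∸ height w))
        ≈⟨ *-congˡ (zeroˡ _) ⟩
      M v w * 0#
        ≈⟨ zeroʳ _ ⟩
      0# ∎
      where
      v = embed (C i) a
      w = embed (C j) b
      hw<hv : height w ℕ.< height v
      hw<hv = height-strict (v→w ◅ Star.ε) λ w→v → i≢j (↔⇒≡ C areComponents a b (v→w ◅ Star.ε , w→v))

-- Real and complex numbers

open +-*-Solver using (solve; con; _:=_; _:+_; _:*_; _:-_; :-_)

Eventually : (ℕ → Set) → Set
Eventually P = ∃ λ N → ∀ n → N ℕ.≤ n → P n

always : ∀ {P} → (∀ n → P n) → Eventually P
always p = 0 , λ n _ → p n

eventually₁ : ∀ {P Q : ℕ → Set} → (∀ n → P n → Q n) → Eventually P → Eventually Q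
eventually₁ f (N , p) = N , λ n N≤n → f n (p n N≤n)

eventually₂ : ∀ {P Q R : ℕ → Set} → (∀ n → P n → Q n → R n) →
  Eventually P → Eventually Q → Eventually R
eventually₂ f (M , p) (N , q) = M ℕ.⊔ N , λ n l →
  f n (p n (ℕₚ.m⊔n≤o⇒m≤o M N l)) (q n (ℕₚ.m⊔n≤o⇒n≤o M N l))

eventually⇒∃ : ∀ {P : ℕ → Set} → Eventually P → ∃ P
eventually⇒∃ (N , p) = N , p N ℕₚ.≤-refl

0<1ℚ : 0ℚ ℚ.< 1ℚ
0<1ℚ = ℚₚ.positive⁻¹ 1ℚ

half-pos : ∀ {ε} → 0ℚ ℚ.< ε → 0ℚ ℚ.< ε ℚ.* ½
half-pos {ε} 0<ε = subst (ℚ._< ε ℚ.* ½) (ℚₚ.*-zeroˡ ½) (ℚₚ.*-monoˡ-<-pos ½ 0<ε)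

half+half : ∀ ε → ε ℚ.* ½ ℚ.+ ε ℚ.* ½ ≡ ε
half+half ε = trans (sym (ℚₚ.*-distribˡ-+ ε ½ ½)) (ℚₚ.*-identityʳ ε)

pos*pos : ∀ {p q} → 0ℚ ℚ.< p → 0ℚ ℚ.< q → 0ℚ ℚ.< p ℚ.* q
pos*pos {p} {q} 0<p 0<q = subst (ℚ._< p ℚ.* q) (ℚₚ.*-zeroˡ q)
  (ℚₚ.*-monoˡ-<-pos q {{ℚ.positive 0<q}} 0<p)

quotient : ∀ {K ε} → 0ℚ ℚ.< K → 0ℚ ℚ.< ε → ∃ λ δ → 0ℚ ℚ.< δ × K ℚ.* δ ≡ ε
quotient {K} {ε} 0<K 0<ε = ε ℚ.* ℚ.1/ K , pos*pos 0<ε (ℚₚ.positive⁻¹ (ℚ.1/ K)) ,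
  trans (ℚₚ.*-comm K (ε ℚ.* ℚ.1/ K)) (trans (ℚₚ.*-assoc ε (ℚ.1/ K) K)
    (trans (cong (ε ℚ.*_) (ℚₚ.*-inverseˡ K)) (ℚₚ.*-identityʳ ε)))
  where
  instance
    K-pos : ℚ.Positive K
    K-pos = ℚ.positive 0<K
    K-nonZero : ℚ.NonZero K
    K-nonZero = ℚₚ.pos⇒nonZero K
    1/K-pos : ℚ.Positive (ℚ.1/ K)
    1/K-pos = ℚₚ.1/pos⇒pos K

p<p+ε : ∀ p {ε} → 0ℚ ℚ.< ε → p ℚ.< p ℚ.+ ε
p<p+ε p {ε} 0<ε = subst (ℚ._< p ℚ.+ ε) (ℚₚ.+-identityʳ p) (ℚₚ.+-monoʳ-< p 0<ε)

p<q+r⇒p-q<r : ∀ p q {r} → p ℚ.< q ℚ.+ r → p ℚ.- q ℚ.< r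
p<q+r⇒p-q<r p q {r} h = subst (p ℚ.- q ℚ.<_) (cancel q r) (ℚₚ.+-monoˡ-< (ℚ.- q) h)
  where
  cancel : ∀ q r → q ℚ.+ r ℚ.- q ≡ r
  cancel = solve 2 (λ q r → q :+ r :- q := r) refl

p-q<r⇒p<q+r : ∀ p q {r} → p ℚ.- q ℚ.< r → p ℚ.< q ℚ.+ r
p-q<r⇒p<q+r p q h = subst (ℚ._< q ℚ.+ _) (cancel q p) (ℚₚ.+-monoʳ-< q h)
  where
  cancel : ∀ q p → q ℚ.+ (p ℚ.- q) ≡ p
  cancel = solve 2 (λ q p → q :+ (p :- q) := p) refl

p≤∣p∣ : ∀ p → p ℚ.≤ ℚ.∣ p ∣
p≤∣p∣ p with ℚₚ.≤-total 0ℚ p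
... | inj₁ 0≤p = ℚₚ.≤-reflexive (sym (ℚₚ.0≤p⇒∣p∣≡p 0≤p))
... | inj₂ p≤0 = ℚₚ.≤-trans p≤0 (ℚₚ.0≤∣p∣ p)

-p≤∣p∣ : ∀ p → ℚ.- p ℚ.≤ ℚ.∣ p ∣
-p≤∣p∣ p = subst (ℚ.- p ℚ.≤_) (ℚₚ.∣-p∣≡∣p∣ p) (p≤∣p∣ (ℚ.- p))

0≤p*p : ∀ p → 0ℚ ℚ.≤ p ℚ.* p
0≤p*p p with ℚₚ.≤-total 0ℚ p
... | inj₁ 0≤p = ℚₚ.nonNegative⁻¹ (p ℚ.* p)
  {{ℚₚ.nonNeg*nonNeg⇒nonNeg p {{ℚ.nonNegative 0≤p}} p {{ℚ.nonNegative 0≤p}}}}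
... | inj₂ p≤0 = ℚₚ.nonNegative⁻¹ (p ℚ.* p)
  {{ℚₚ.nonPos*nonPos⇒nonPos p {{ℚ.nonPositive p≤0}} p {{ℚ.nonPositive p≤0}}}}

-‿swap : ∀ p q → ℚ.- (p ℚ.- q) ≡ q ℚ.- p
-‿swap = solve 2 (λ p q → :- (p :- q) := q :- p) refl

∣p-q∣≡∣q-p∣ : ∀ p q → ℚ.∣ p ℚ.- q ∣ ≡ ℚ.∣ q ℚ.- p ∣
∣p-q∣≡∣q-p∣ p q = trans (sym (ℚₚ.∣-p∣≡∣p∣ (p ℚ.- q))) (cong ℚ.∣_∣ (-‿swap p q))

∣∣<-elim : ∀ p q {ε} → ℚ.∣ p ℚ.- q ∣ ℚ.< ε → p ℚ.< q ℚ.+ ε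
∣∣<-elim p q h = p-q<r⇒p<q+r p q (ℚₚ.≤-<-trans (p≤∣p∣ (p ℚ.- q)) h)

∣∣<-intro : ∀ p q {ε} → p ℚ.< q ℚ.+ ε → q ℚ.< p ℚ.+ ε → ℚ.∣ p ℚ.- q ∣ ℚ.< ε
∣∣<-intro p q h k with ℚₚ.∣p∣≡p∨∣p∣≡-p (ℚ.∣ p ℚ.- q ∣) | ℚₚ.∣p∣≡p∨∣p∣≡-p (p ℚ.- q)
... | _ | inj₁ eq = subst (ℚ._< _) (sym eq) (p<q+r⇒p-q<r p q h)
... | _ | inj₂ eq = subst (ℚ._< _) (sym (trans eq (-‿swap p q))) (p<q+r⇒p-q<r q p k)

≗⇒≈ℝ : ∀ {x y} → (∀ n → seq x n ≡ seq y n) → x ≈ℝ y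
≗⇒≈ℝ {x} {y} eq = mk≈ λ ε 0<ε → always λ n → subst (ℚ._< ε)
  (cong ℚ.∣_∣ (sym (trans (cong (ℚ._- seq y n) (eq n)) (ℚₚ.+-inverseʳ (seq y n))))) 0<ε

≤ℝ-antisym : ∀ {x y} → x ≤ℝ y → y ≤ℝ x → x ≈ℝ y
≤ℝ-antisym {x} {y} (mk≤ p) (mk≤ q) = mk≈ λ ε 0<ε →
  eventually₂ (λ n → ∣∣<-intro (seq x n) (seq y n)) (p ε 0<ε) (q ε 0<ε)

≈⇒≤ℝ : ∀ {x y} → x ≈ℝ y → x ≤ℝ y
≈⇒≤ℝ {x} {y} (mk≈ p) = mk≤ λ ε 0<ε → eventually₁ (λ n → ∣∣<-elim (seq x n) (seq y n)) (p ε 0<ε)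

≈ℝ-sym : ∀ {x y} → x ≈ℝ y → y ≈ℝ x
≈ℝ-sym {x} {y} (mk≈ p) = mk≈ λ ε 0<ε →
  eventually₁ (λ n → subst (ℚ._< ε) (∣p-q∣≡∣q-p∣ (seq x n) (seq y n))) (p ε 0<ε)

≤ℝ-trans : ∀ {x y z} → x ≤ℝ y → y ≤ℝ z → x ≤ℝ z
≤ℝ-trans {x} {y} {z} (mk≤ p) (mk≤ q) = mk≤ λ ε 0<ε →
  eventually₂ (λ n x<y y<z → let open ℚₚ.≤-Reasoning in begin-strict
      seq x n                               <⟨ x<y ⟩
      seq y n ℚ.+ ε ℚ.* ½                   <⟨ ℚₚ.+-monoˡ-< (ε ℚ.* ½) y<z ⟩
      (seq z n ℚ.+ ε ℚ.* ½) ℚ.+ ε ℚ.* ½     ≡⟨ ℚₚ.+-assoc (seq z n) (ε ℚ.* ½) (ε ℚ.* ½) ⟩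
      seq z n ℚ.+ (ε ℚ.* ½ ℚ.+ ε ℚ.* ½)     ≡⟨ cong (seq z n ℚ.+_) (half+half ε) ⟩
      seq z n ℚ.+ ε                         ∎)
    (p (ε ℚ.* ½) (half-pos 0<ε)) (q (ε ℚ.* ½) (half-pos 0<ε))

≈ℝ-refl : ∀ {x} → x ≈ℝ x
≈ℝ-refl = ≗⇒≈ℝ λ _ → refl

≈ℝ-trans : ∀ {x y z} → x ≈ℝ y → y ≈ℝ z → x ≈ℝ z
≈ℝ-trans p q = ≤ℝ-antisym (≤ℝ-trans (≈⇒≤ℝ p) (≈⇒≤ℝ q))
  (≤ℝ-trans (≈⇒≤ℝ (≈ℝ-sym q)) (≈⇒≤ℝ (≈ℝ-sym p)))

private
  regroup : ∀ a b c d → (a ℚ.+ c) ℚ.+ (b ℚ.+ d) ≡ (a ℚ.+ b) ℚ.+ (c ℚ.+ d)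
  regroup = solve 4 (λ a b c d → (a :+ c) :+ (b :+ d) := (a :+ b) :+ (c :+ d)) refl

+ℝ-mono-≤ : ∀ {x y u v} → x ≤ℝ y → u ≤ℝ v → x +ℝ u ≤ℝ y +ℝ v
+ℝ-mono-≤ {x} {y} {u} {v} (mk≤ p) (mk≤ q) = mk≤ λ ε 0<ε →
  eventually₂ (λ n x<y u<v → subst (seq x n ℚ.+ seq u n ℚ.<_)
      (trans (regroup (seq y n) (seq v n) (ε ℚ.* ½) (ε ℚ.* ½))
        (cong (seq y n ℚ.+ seq v n ℚ.+_) (half+half ε)))
      (ℚₚ.+-mono-< x<y u<v))
    (p (ε ℚ.* ½) (half-pos 0<ε)) (q (ε ℚ.* ½) (half-pos 0<ε))

<ℝ⇒≱ℝ : ∀ {x y} → x <ℝ y → ¬ (y ≤ℝ x)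
<ℝ⇒≱ℝ (mk< g 0<g a) (mk≤ b) with eventually⇒∃ (eventually₂ (λ _ → _,_) a (b g 0<g))
... | n , x+g<y , y<x+g = ℚₚ.<-asym x+g<y y<x+g

-- Although the reals cannot be compared, their rational approximations at one late index can. The
-- outcome shows either that y exceeds x by less than ε from there on, or a definite gap x < y,
-- which is excluded.
≮ℝ⇒≥ℝ : ∀ {x y} → ¬ (x <ℝ y) → y ≤ℝ x
≮ℝ⇒≥ℝ {x} {y} x≮y = mk≤ λ ε 0<ε → decide ε 0<ε
  (cauchy x (ε ℚ.* ½ ℚ.* ½ ℚ.* ½) (half-pos (half-pos (half-pos 0<ε))))
  (cauchy y (ε ℚ.* ½ ℚ.* ½ ℚ.* ½) (half-pos (half-pos (half-pos 0<ε))))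
  where
  decide : ∀ ε → 0ℚ ℚ.< ε → let δ = ε ℚ.* ½ ℚ.* ½ ℚ.* ½ in
    (∃ λ N → ∀ m n → N ℕ.≤ m → N ℕ.≤ n → ℚ.∣ seq x m ℚ.- seq x n ∣ ℚ.< δ) →
    (∃ λ N → ∀ m n → N ℕ.≤ m → N ℕ.≤ n → ℚ.∣ seq y m ℚ.- seq y n ∣ ℚ.< δ) →
    Eventually (λ n → seq y n ℚ.< seq x n ℚ.+ ε)
  decide ε 0<ε (M , cx) (N , cy) = compare (y₀ ℚₚ.<? x₀ ℚ.+ η)
    where
    -- The threshold of the comparison is η = ε/2 and the oscillation past `L` is below δ = ε/8. The
    -- first case costs η + 2δ = 3ε/4 < ε, and the second leaves the gap η - 2δ = θ = ε/4.
    η = ε ℚ.* ½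
    θ = η ℚ.* ½
    δ = θ ℚ.* ½
    L = M ℕ.⊔ N
    x₀ = seq x L
    y₀ = seq y L
    open ℚₚ.≤-Reasoning

    x≈x₀ : ∀ n → L ℕ.≤ n → ℚ.∣ seq x n ℚ.- x₀ ∣ ℚ.< δ
    x≈x₀ n l = cx n L (ℕₚ.m⊔n≤o⇒m≤o M N l) (ℕₚ.m≤m⊔n M N)

    y≈y₀ : ∀ n → L ℕ.≤ n → ℚ.∣ seq y n ℚ.- y₀ ∣ ℚ.< δ
    y≈y₀ n l = cy n L (ℕₚ.m⊔n≤o⇒n≤o M N l) (ℕₚ.m≤n⊔m M N)

    compare : Dec (y₀ ℚ.< x₀ ℚ.+ η) → Eventually (λ n → seq y n ℚ.< seq x n ℚ.+ ε)
    compare (yes y₀<x₀+η) = L , λ n l → begin-strict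
      seq y n
        <⟨ ∣∣<-elim (seq y n) y₀ (y≈y₀ n l) ⟩
      y₀ ℚ.+ δ
        <⟨ ℚₚ.+-monoˡ-< δ y₀<x₀+η ⟩
      x₀ ℚ.+ η ℚ.+ δ
        <⟨ ℚₚ.+-monoˡ-< δ (ℚₚ.+-monoˡ-< η
             (∣∣<-elim x₀ (seq x n) (subst (ℚ._< δ) (∣p-q∣≡∣q-p∣ (seq x n) x₀) (x≈x₀ n l)))) ⟩
      seq x n ℚ.+ δ ℚ.+ η ℚ.+ δ
        ≡⟨ solve 3 (λ a d e → a :+ d :+ e :+ d := a :+ (e :+ (d :+ d))) refl (seq x n) δ η ⟩
      seq x n ℚ.+ (η ℚ.+ (δ ℚ.+ δ))
        ≡⟨ cong (λ r → seq x n ℚ.+ (η ℚ.+ r)) (half+half θ) ⟩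
      seq x n ℚ.+ (η ℚ.+ θ)
        <⟨ ℚₚ.+-monoʳ-< (seq x n) (ℚₚ.+-monoʳ-< η (p<p+ε θ (half-pos (half-pos 0<ε)))) ⟩
      seq x n ℚ.+ (η ℚ.+ (θ ℚ.+ θ))
        ≡⟨ cong (λ r → seq x n ℚ.+ (η ℚ.+ r)) (half+half η) ⟩
      seq x n ℚ.+ (η ℚ.+ η)
        ≡⟨ cong (seq x n ℚ.+_) (half+half ε) ⟩
      seq x n ℚ.+ ε ∎
    compare (no y₀≮x₀+η) = contradiction
      (mk< θ (half-pos (half-pos 0<ε)) (L , λ n l →
        subst₂ ℚ._<_ (cancel (seq x n ℚ.+ θ) δ) (cancel (seq y n) δ)
          (ℚₚ.+-monoˡ-< (ℚ.- δ) (begin-strict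
            seq x n ℚ.+ θ ℚ.+ δ
              <⟨ ℚₚ.+-monoˡ-< δ (ℚₚ.+-monoˡ-< θ (∣∣<-elim (seq x n) x₀ (x≈x₀ n l))) ⟩
            x₀ ℚ.+ δ ℚ.+ θ ℚ.+ δ
              ≡⟨ solve 3 (λ a d e → a :+ d :+ e :+ d := a :+ (e :+ (d :+ d))) refl x₀ δ θ ⟩
            x₀ ℚ.+ (θ ℚ.+ (δ ℚ.+ δ))
              ≡⟨ cong (λ r → x₀ ℚ.+ (θ ℚ.+ r)) (half+half θ) ⟩
            x₀ ℚ.+ (θ ℚ.+ θ)
              ≡⟨ cong (x₀ ℚ.+_) (half+half η) ⟩
            x₀ ℚ.+ η
              ≤⟨ ℚₚ.≮⇒≥ y₀≮x₀+η ⟩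
            y₀
              <⟨ ∣∣<-elim y₀ (seq y n) (subst (ℚ._< δ) (∣p-q∣≡∣q-p∣ (seq y n) y₀) (y≈y₀ n l)) ⟩
            seq y n ℚ.+ δ ∎))))
      x≮y
      where
      cancel : ∀ a d → a ℚ.+ d ℚ.- d ≡ a
      cancel = solve 2 (λ a d → a :+ d :- d := a) refl

-- On Cauchy reals ≤ is the negation of the reversed <, and negations are stable.
≤ℝ-stable : ∀ {x y} → ¬ ¬ (x ≤ℝ y) → x ≤ℝ y
≤ℝ-stable ¬¬x≤y = ≮ℝ⇒≥ℝ λ y<x → ¬¬x≤y (<ℝ⇒≱ℝ y<x)

≈ℝ-stable : ∀ {x y} → ¬ ¬ (x ≈ℝ y) → x ≈ℝ y
≈ℝ-stable ¬¬x≈y = ≤ℝ-antisym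
  (≤ℝ-stable λ ¬x≤y → ¬¬x≈y λ x≈y → ¬x≤y (≈⇒≤ℝ x≈y))
  (≤ℝ-stable λ ¬y≤x → ¬¬x≈y λ x≈y → ¬y≤x (≈⇒≤ℝ (≈ℝ-sym x≈y)))

+ℝ-cong : ∀ {x y u v} → x ≈ℝ y → u ≈ℝ v → x +ℝ u ≈ℝ y +ℝ v
+ℝ-cong {x} {y} {u} {v} p q = ≤ℝ-antisym {x +ℝ u} {y +ℝ v}
  (+ℝ-mono-≤ {x} {y} {u} {v} (≈⇒≤ℝ p) (≈⇒≤ℝ q))
  (+ℝ-mono-≤ {y} {x} {v} {u} (≈⇒≤ℝ (≈ℝ-sym p)) (≈⇒≤ℝ (≈ℝ-sym q)))

-ℝ-cong : ∀ {x y} → x ≈ℝ y → -ℝ x ≈ℝ -ℝ y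
-ℝ-cong {x} {y} (mk≈ p) = mk≈ λ ε 0<ε → eventually₁
  (λ n → subst (ℚ._< ε) (trans (∣p-q∣≡∣q-p∣ (seq x n) (seq y n)) (cong ℚ.∣_∣ (neg (seq x n) (seq y n)))))
  (p ε 0<ε)
  where
  neg : ∀ a b → b ℚ.- a ≡ (ℚ.- a) ℚ.- (ℚ.- b)
  neg = solve 2 (λ a b → b :- a := (:- a) :- (:- b)) refl

bounded : ∀ x → ∃ λ K → 0ℚ ℚ.< K × Eventually (λ n → ℚ.∣ seq x n ∣ ℚ.< K)
bounded x = let N , h = cauchy x 1ℚ 0<1ℚ ; x₀ = seq x N in
  1ℚ ℚ.+ ℚ.∣ x₀ ∣ , ℚₚ.+-mono-<-≤ 0<1ℚ (ℚₚ.0≤∣p∣ x₀) , N , λ n N≤n → begin-strict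
  ℚ.∣ seq x n ∣                       ≡⟨ cong ℚ.∣_∣ (split (seq x n) (seq x N)) ⟩
  ℚ.∣ (seq x n ℚ.- x₀) ℚ.+ x₀ ∣       ≤⟨ ℚₚ.∣p+q∣≤∣p∣+∣q∣ (seq x n ℚ.- x₀) x₀ ⟩
  ℚ.∣ seq x n ℚ.- x₀ ∣ ℚ.+ ℚ.∣ x₀ ∣   <⟨ ℚₚ.+-monoˡ-< ℚ.∣ x₀ ∣ (h n N N≤n ℕₚ.≤-refl) ⟩
  1ℚ ℚ.+ ℚ.∣ x₀ ∣                     ∎
  where
  open ℚₚ.≤-Reasoning
  split : ∀ a b → a ≡ (a ℚ.- b) ℚ.+ b
  split = solve 2 (λ a b → a := (a :- b) :+ b) refl

*ℝ-congˡ : ∀ x {y z} → y ≈ℝ z → x *ℝ y ≈ℝ x *ℝ z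
*ℝ-congˡ x {y} {z} (mk≈ p) = mk≈ λ ε 0<ε → combine ε 0<ε (bounded x)
  where
  open ℚₚ.≤-Reasoning

  factor : ∀ a b c → a ℚ.* b ℚ.- a ℚ.* c ≡ a ℚ.* (b ℚ.- c)
  factor = solve 3 (λ a b c → a :* b :- a :* c := a :* (b :- c)) refl

  scale : ∀ {K δ ε} → 0ℚ ℚ.< K → K ℚ.* δ ≡ ε → ∀ a b c → ℚ.∣ a ∣ ℚ.< K → ℚ.∣ b ℚ.- c ∣ ℚ.< δ →
    ℚ.∣ a ℚ.* b ℚ.- a ℚ.* c ∣ ℚ.< ε
  scale {K} {δ} {ε} 0<K Kδ≡ε a b c a<K b-c<δ = begin-strict
    ℚ.∣ a ℚ.* b ℚ.- a ℚ.* c ∣       ≡⟨ cong ℚ.∣_∣ (factor a b c) ⟩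
    ℚ.∣ a ℚ.* (b ℚ.- c) ∣           ≡⟨ ℚₚ.∣p*q∣≡∣p∣*∣q∣ a (b ℚ.- c) ⟩
    ℚ.∣ a ∣ ℚ.* ℚ.∣ b ℚ.- c ∣       ≤⟨ ℚₚ.*-monoʳ-≤-nonNeg ℚ.∣ b ℚ.- c ∣ {{ℚₚ.∣-∣-nonNeg (b ℚ.- c)}} (ℚₚ.<⇒≤ a<K) ⟩
    K ℚ.* ℚ.∣ b ℚ.- c ∣             <⟨ ℚₚ.*-monoʳ-<-pos K {{ℚ.positive 0<K}} b-c<δ ⟩
    K ℚ.* δ                         ≡⟨ Kδ≡ε ⟩
    ε                               ∎

  combine : ∀ ε → 0ℚ ℚ.< ε → (∃ λ K → 0ℚ ℚ.< K × Eventually (λ n → ℚ.∣ seq x n ∣ ℚ.< K)) →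
    Eventually (λ n → ℚ.∣ seq x n ℚ.* seq y n ℚ.- seq x n ℚ.* seq z n ∣ ℚ.< ε)
  combine ε 0<ε (K , 0<K , b) = let δ , 0<δ , Kδ≡ε = quotient 0<K 0<ε in
    eventually₂ (λ n → scale {K} {δ} {ε} 0<K Kδ≡ε (seq x n) (seq y n) (seq z n)) b (p δ 0<δ)

*ℝ-comm : ∀ x y → x *ℝ y ≈ℝ y *ℝ x
*ℝ-comm x y = ≗⇒≈ℝ {x *ℝ y} {y *ℝ x} λ n → ℚₚ.*-comm (seq x n) (seq y n)

*ℝ-cong : ∀ {x y u v} → x ≈ℝ y → u ≈ℝ v → x *ℝ u ≈ℝ y *ℝ v
*ℝ-cong {x} {y} {u} {v} p q = ≈ℝ-trans {x *ℝ u} {x *ℝ v} {y *ℝ v} (*ℝ-congˡ x {u} {v} q)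
  (≈ℝ-trans {x *ℝ v} {v *ℝ x} {y *ℝ v} (*ℝ-comm x v)
    (≈ℝ-trans {v *ℝ x} {v *ℝ y} {y *ℝ v} (*ℝ-congˡ v {x} {y} p) (*ℝ-comm v y)))

∣∣ℝ-cong : ∀ {x y} → x ≈ℝ y → ∣ x ∣ℝ ≈ℝ ∣ y ∣ℝ
∣∣ℝ-cong {x} {y} (mk≈ p) = mk≈ λ ε 0<ε → eventually₁ (λ n h →
    ∣∣<-intro _ _ (reverse (seq x n) (seq y n) h)
      (reverse (seq y n) (seq x n) (subst (ℚ._< ε) (∣p-q∣≡∣q-p∣ (seq x n) (seq y n)) h)))
  (p ε 0<ε)
  where
  open ℚₚ.≤-Reasoning
  reverse : ∀ a b {ε} → ℚ.∣ a ℚ.- b ∣ ℚ.< ε → ℚ.∣ a ∣ ℚ.< ℚ.∣ b ∣ ℚ.+ ε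
  reverse a b {ε} h = begin-strict
    ℚ.∣ a ∣                       ≡⟨ cong ℚ.∣_∣ (solve 2 (λ a b → a := b :+ (a :- b)) refl a b) ⟩
    ℚ.∣ b ℚ.+ (a ℚ.- b) ∣         ≤⟨ ℚₚ.∣p+q∣≤∣p∣+∣q∣ b (a ℚ.- b) ⟩
    ℚ.∣ b ∣ ℚ.+ ℚ.∣ a ℚ.- b ∣     <⟨ ℚₚ.+-monoʳ-< ℚ.∣ b ∣ h ⟩
    ℚ.∣ b ∣ ℚ.+ ε                 ∎

≈ℝ-isEquivalence : IsEquivalence _≈ℝ_
≈ℝ-isEquivalence = record { refl = ≈ℝ-refl ; sym = ≈ℝ-sym ; trans = ≈ℝ-trans }

ℝ-commutativeRing : CommutativeRing 0ℓ 0ℓ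
ℝ-commutativeRing = record
  { Carrier = ℝ ; _≈_ = _≈ℝ_ ; _+_ = _+ℝ_ ; _*_ = _*ℝ_ ; -_ = -ℝ_ ; 0# = 0ℝ ; 1# = 1ℝ
  ; isCommutativeRing = record
    { isRing = record
      { +-isAbelianGroup = record
        { isGroup = record
          { isMonoid = record
            { isSemigroup = record
              { isMagma = record { isEquivalence = ≈ℝ-isEquivalence ; ∙-cong = λ {x} {y} {u} {v} → +ℝ-cong {x} {y} {u} {v} }
              ; assoc = λ x y z → ≗⇒≈ℝ λ n → ℚₚ.+-assoc (seq x n) (seq y n) (seq z n)
              }
            ; identity = (λ x → ≗⇒≈ℝ λ n → ℚₚ.+-identityˡ (seq x n))
                       , (λ x → ≗⇒≈ℝ λ n → ℚₚ.+-identityʳ (seq x n))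
            }
          ; inverse = (λ x → ≗⇒≈ℝ λ n → ℚₚ.+-inverseˡ (seq x n))
                    , (λ x → ≗⇒≈ℝ λ n → ℚₚ.+-inverseʳ (seq x n))
          ; ⁻¹-cong = λ {x} {y} → -ℝ-cong {x} {y}
          }
        ; comm = λ x y → ≗⇒≈ℝ λ n → ℚₚ.+-comm (seq x n) (seq y n)
        }
      ; *-cong = λ {x} {y} {u} {v} → *ℝ-cong {x} {y} {u} {v}
      ; *-assoc = λ x y z → ≗⇒≈ℝ λ n → ℚₚ.*-assoc (seq x n) (seq y n) (seq z n)
      ; *-identity = (λ x → ≗⇒≈ℝ λ n → ℚₚ.*-identityˡ (seq x n))
                   , (λ x → ≗⇒≈ℝ λ n → ℚₚ.*-identityʳ (seq x n))
      ; distrib = (λ x y z → ≗⇒≈ℝ λ n → ℚₚ.*-distribˡ-+ (seq x n) (seq y n) (seq z n))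
                , (λ x y z → ≗⇒≈ℝ λ n → ℚₚ.*-distribʳ-+ (seq x n) (seq y n) (seq z n))
      }
    ; *-comm = *ℝ-comm
    }
  }

-- The gap g bounds r from below at late indices, so tolerance g ε for the product yields tolerance
-- ε for x.
*ℝ-cancel-pos : ∀ {r x} → 0ℝ <ℝ r → r *ℝ x ≈ℝ 0ℝ → x ≈ℝ 0ℝ
*ℝ-cancel-pos {r} {x} (mk< g 0<g g<r) (mk≈ p) = mk≈ λ ε 0<ε →
  eventually₂ (step ε) g<r (p (g ℚ.* ε) (pos*pos 0<g 0<ε))
  where
  open ℚₚ.≤-Reasoning
  p-0 : ∀ p → p ℚ.- 0ℚ ≡ p
  p-0 = ℚₚ.+-identityʳ
  step : ∀ ε n → 0ℚ ℚ.+ g ℚ.< seq r n → ℚ.∣ seq r n ℚ.* seq x n ℚ.- 0ℚ ∣ ℚ.< g ℚ.* ε →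
    ℚ.∣ seq x n ℚ.- 0ℚ ∣ ℚ.< ε
  step ε n 0+g<r rx<gε = subst (λ q → ℚ.∣ q ∣ ℚ.< ε) (sym (p-0 (seq x n)))
    (ℚₚ.*-cancelˡ-<-nonNeg g {{ℚ.nonNegative (ℚₚ.<⇒≤ 0<g)}} (begin-strict
      g ℚ.* ℚ.∣ b ∣           ≤⟨ ℚₚ.*-monoʳ-≤-nonNeg ℚ.∣ b ∣ {{ℚₚ.∣-∣-nonNeg b}} g≤∣a∣ ⟩
      ℚ.∣ a ∣ ℚ.* ℚ.∣ b ∣     ≡⟨ sym (ℚₚ.∣p*q∣≡∣p∣*∣q∣ a b) ⟩
      ℚ.∣ a ℚ.* b ∣           ≡⟨ cong ℚ.∣_∣ (sym (p-0 (a ℚ.* b))) ⟩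
      ℚ.∣ a ℚ.* b ℚ.- 0ℚ ∣    <⟨ rx<gε ⟩
      g ℚ.* ε                 ∎))
    where
    a = seq r n
    b = seq x n
    g≤∣a∣ : g ℚ.≤ ℚ.∣ a ∣
    g≤∣a∣ = ℚₚ.≤-trans (ℚₚ.<⇒≤ (subst (ℚ._< a) (ℚₚ.+-identityˡ g) 0+g<r)) (p≤∣p∣ a)

-- A late term of absolute value at least ε would push a² + b² to at least ε², against the
-- hypothesis at tolerance ε².
a²+b²≤0⇒a≈0 : ∀ a b → a *ℝ a +ℝ b *ℝ b ≤ℝ 0ℝ → a ≈ℝ 0ℝ
a²+b²≤0⇒a≈0 a b (mk≤ p) = mk≈ λ ε 0<ε → eventually₁ (step ε 0<ε) (p (ε ℚ.* ε) (pos*pos 0<ε 0<ε))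
  where
  open ℚₚ.≤-Reasoning
  step : ∀ ε → 0ℚ ℚ.< ε → ∀ n →
    seq a n ℚ.* seq a n ℚ.+ seq b n ℚ.* seq b n ℚ.< 0ℚ ℚ.+ ε ℚ.* ε → ℚ.∣ seq a n ℚ.- 0ℚ ∣ ℚ.< ε
  step ε 0<ε n h = subst (λ q → ℚ.∣ q ∣ ℚ.< ε) (sym (ℚₚ.+-identityʳ s)) (ℚₚ.≰⇒> λ ε≤∣s∣ →
    ℚₚ.<-irrefl refl (begin-strict
      ε ℚ.* ε                  ≤⟨ ℚₚ.*-monoʳ-≤-nonNeg ε {{ℚ.nonNegative (ℚₚ.<⇒≤ 0<ε)}} ε≤∣s∣ ⟩
      ℚ.∣ s ∣ ℚ.* ε            ≤⟨ ℚₚ.*-monoˡ-≤-nonNeg ℚ.∣ s ∣ {{ℚₚ.∣-∣-nonNeg s}} ε≤∣s∣ ⟩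
      ℚ.∣ s ∣ ℚ.* ℚ.∣ s ∣      ≡⟨ sym (ℚₚ.∣p*q∣≡∣p∣*∣q∣ s s) ⟩
      ℚ.∣ s ℚ.* s ∣            ≡⟨ ℚₚ.0≤p⇒∣p∣≡p (0≤p*p s) ⟩
      s ℚ.* s                  ≡⟨ sym (ℚₚ.+-identityʳ (s ℚ.* s)) ⟩
      s ℚ.* s ℚ.+ 0ℚ           ≤⟨ ℚₚ.+-monoʳ-≤ (s ℚ.* s) (0≤p*p t) ⟩
      s ℚ.* s ℚ.+ t ℚ.* t      <⟨ h ⟩
      0ℚ ℚ.+ ε ℚ.* ε           ≡⟨ ℚₚ.+-identityˡ (ε ℚ.* ε) ⟩
      ε ℚ.* ε                  ∎))
    where
    s = seq a n
    t = seq b n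

-- The commutative ring of complex numbers

open RawRing ℂ-rawRing using () renaming (_≈_ to _≈ℂ_; _+_ to _+ℂ_; _*_ to _*ℂ_; -_ to -ℂ_; 0# to 0ℂ; 1# to 1ℂ)

private
  open import Algebra.Definitions _≈ℂ_

  ℂ-isEquivalence : IsEquivalence _≈ℂ_
  ℂ-isEquivalence = record
    { refl  = ≈ℝ-refl , ≈ℝ-refl
    ; sym   = λ (p , q) → ≈ℝ-sym p , ≈ℝ-sym q
    ; trans = λ (p , q) (p′ , q′) → ≈ℝ-trans p p′ , ≈ℝ-trans q q′
    }

  +ℂ-cong : Congruent₂ _+ℂ_
  +ℂ-cong {x} {y} {z} {w} (p , q) (p′ , q′) =
    +ℝ-cong {Re x} {Re y} {Re z} {Re w} p p′ , +ℝ-cong {Im x} {Im y} {Im z} {Im w} q q′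

  -ℂ-cong : Congruent₁ -ℂ_
  -ℂ-cong {x} {y} (p , q) = -ℝ-cong {Re x} {Re y} p , -ℝ-cong {Im x} {Im y} q

  *ℂ-cong : Congruent₂ _*ℂ_
  *ℂ-cong {x} {y} {z} {w} (p , q) (p′ , q′) =
      +ℝ-cong {Re x *ℝ Re z} {Re y *ℝ Re w} { -ℝ (Im x *ℝ Im z)} { -ℝ (Im y *ℝ Im w)}
        (*ℝ-cong {Re x} {Re y} {Re z} {Re w} p p′)
        (-ℝ-cong {Im x *ℝ Im z} {Im y *ℝ Im w} (*ℝ-cong {Im x} {Im y} {Im z} {Im w} q q′))
    , +ℝ-cong {Re x *ℝ Im z} {Re y *ℝ Im w} {Im x *ℝ Re z} {Im y *ℝ Re w}
        (*ℝ-cong {Re x} {Re y} {Im z} {Im w} p q′)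
        (*ℝ-cong {Im x} {Im y} {Re z} {Re w} q p′)

  +ℂ-assoc : Associative _+ℂ_
  +ℂ-assoc x y z = (≗⇒≈ℝ λ n → ℚₚ.+-assoc (seq (Re x) n) (seq (Re y) n) (seq (Re z) n))
    , (≗⇒≈ℝ λ n → ℚₚ.+-assoc (seq (Im x) n) (seq (Im y) n) (seq (Im z) n))

  +ℂ-comm : Commutative _+ℂ_
  +ℂ-comm x y = (≗⇒≈ℝ λ n → ℚₚ.+-comm (seq (Re x) n) (seq (Re y) n))
    , (≗⇒≈ℝ λ n → ℚₚ.+-comm (seq (Im x) n) (seq (Im y) n))

  +ℂ-identityˡ : LeftIdentity 0ℂ _+ℂ_
  +ℂ-identityˡ x = (≗⇒≈ℝ λ n → ℚₚ.+-identityˡ (seq (Re x) n))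
    , (≗⇒≈ℝ λ n → ℚₚ.+-identityˡ (seq (Im x) n))

  +ℂ-identityʳ : RightIdentity 0ℂ _+ℂ_
  +ℂ-identityʳ x = (≗⇒≈ℝ λ n → ℚₚ.+-identityʳ (seq (Re x) n))
    , (≗⇒≈ℝ λ n → ℚₚ.+-identityʳ (seq (Im x) n))

  -ℂ-inverseˡ : LeftInverse 0ℂ -ℂ_ _+ℂ_
  -ℂ-inverseˡ x = (≗⇒≈ℝ λ n → ℚₚ.+-inverseˡ (seq (Re x) n))
    , (≗⇒≈ℝ λ n → ℚₚ.+-inverseˡ (seq (Im x) n))

  -ℂ-inverseʳ : RightInverse 0ℂ -ℂ_ _+ℂ_
  -ℂ-inverseʳ x = (≗⇒≈ℝ λ n → ℚₚ.+-inverseʳ (seq (Re x) n))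
    , (≗⇒≈ℝ λ n → ℚₚ.+-inverseʳ (seq (Im x) n))

  *ℂ-assoc : Associative _*ℂ_
  *ℂ-assoc x y z =
      (≗⇒≈ℝ λ n → real (seq (Re x) n) (seq (Im x) n) (seq (Re y) n) (seq (Im y) n) (seq (Re z) n) (seq (Im z) n))
    , (≗⇒≈ℝ λ n → imag (seq (Re x) n) (seq (Im x) n) (seq (Re y) n) (seq (Im y) n) (seq (Re z) n) (seq (Im z) n))
    where
    real : ∀ a b c d e f → ((a ℚ.* c ℚ.- b ℚ.* d) ℚ.* e ℚ.- (a ℚ.* d ℚ.+ b ℚ.* c) ℚ.* f) ≡ (a ℚ.* (c ℚ.* e ℚ.- d ℚ.* f) ℚ.- b ℚ.* (c ℚ.* f ℚ.+ d ℚ.* e))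
    real = solve 6 (λ a b c d e f → ((a :* c :- b :* d) :* e :- (a :* d :+ b :* c) :* f) := (a :* (c :* e :- d :* f) :- b :* (c :* f :+ d :* e))) refl
    imag : ∀ a b c d e f → ((a ℚ.* c ℚ.- b ℚ.* d) ℚ.* f ℚ.+ (a ℚ.* d ℚ.+ b ℚ.* c) ℚ.* e) ≡ (a ℚ.* (c ℚ.* f ℚ.+ d ℚ.* e) ℚ.+ b ℚ.* (c ℚ.* e ℚ.- d ℚ.* f))
    imag = solve 6 (λ a b c d e f → ((a :* c :- b :* d) :* f :+ (a :* d :+ b :* c) :* e) := (a :* (c :* f :+ d :* e) :+ b :* (c :* e :- d :* f))) refl

  *ℂ-comm : Commutative _*ℂ_
  *ℂ-comm x y =
      (≗⇒≈ℝ λ n → real (seq (Re x) n) (seq (Im x) n) (seq (Re y) n) (seq (Im y) n))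
    , (≗⇒≈ℝ λ n → imag (seq (Re x) n) (seq (Im x) n) (seq (Re y) n) (seq (Im y) n))
    where
    real : ∀ a b c d → (a ℚ.* c ℚ.- b ℚ.* d) ≡ (c ℚ.* a ℚ.- d ℚ.* b)
    real = solve 4 (λ a b c d → (a :* c :- b :* d) := (c :* a :- d :* b)) refl
    imag : ∀ a b c d → (a ℚ.* d ℚ.+ b ℚ.* c) ≡ (c ℚ.* b ℚ.+ d ℚ.* a)
    imag = solve 4 (λ a b c d → (a :* d :+ b :* c) := (c :* b :+ d :* a)) refl

  *ℂ-identityˡ : LeftIdentity 1ℂ _*ℂ_
  *ℂ-identityˡ x =
      (≗⇒≈ℝ λ n → real (seq (Re x) n) (seq (Im x) n))
    , (≗⇒≈ℝ λ n → imag (seq (Re x) n) (seq (Im x) n))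
    where
    real : ∀ a b → (1ℚ ℚ.* a ℚ.- 0ℚ ℚ.* b) ≡ a
    real = solve 2 (λ a b → (con 1ℚ :* a :- con 0ℚ :* b) := a) refl
    imag : ∀ a b → (1ℚ ℚ.* b ℚ.+ 0ℚ ℚ.* a) ≡ b
    imag = solve 2 (λ a b → (con 1ℚ :* b :+ con 0ℚ :* a) := b) refl

  *ℂ-identityʳ : RightIdentity 1ℂ _*ℂ_
  *ℂ-identityʳ x =
      (≗⇒≈ℝ λ n → real (seq (Re x) n) (seq (Im x) n))
    , (≗⇒≈ℝ λ n → imag (seq (Re x) n) (seq (Im x) n))
    where
    real : ∀ a b → (a ℚ.* 1ℚ ℚ.- b ℚ.* 0ℚ) ≡ a
    real = solve 2 (λ a b → (a :* con 1ℚ :- b :* con 0ℚ) := a) refl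
    imag : ∀ a b → (a ℚ.* 0ℚ ℚ.+ b ℚ.* 1ℚ) ≡ b
    imag = solve 2 (λ a b → (a :* con 0ℚ :+ b :* con 1ℚ) := b) refl

  *ℂ-distribˡ : _*ℂ_ DistributesOverˡ _+ℂ_
  *ℂ-distribˡ x y z =
      (≗⇒≈ℝ λ n → real (seq (Re x) n) (seq (Im x) n) (seq (Re y) n) (seq (Im y) n) (seq (Re z) n) (seq (Im z) n))
    , (≗⇒≈ℝ λ n → imag (seq (Re x) n) (seq (Im x) n) (seq (Re y) n) (seq (Im y) n) (seq (Re z) n) (seq (Im z) n))
    where
    real : ∀ a b c d e f → (a ℚ.* (c ℚ.+ e) ℚ.- b ℚ.* (d ℚ.+ f)) ≡ ((a ℚ.* c ℚ.- b ℚ.* d) ℚ.+ (a ℚ.* e ℚ.- b ℚ.* f))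
    real = solve 6 (λ a b c d e f → (a :* (c :+ e) :- b :* (d :+ f)) := ((a :* c :- b :* d) :+ (a :* e :- b :* f))) refl
    imag : ∀ a b c d e f → (a ℚ.* (d ℚ.+ f) ℚ.+ b ℚ.* (c ℚ.+ e)) ≡ ((a ℚ.* d ℚ.+ b ℚ.* c) ℚ.+ (a ℚ.* f ℚ.+ b ℚ.* e))
    imag = solve 6 (λ a b c d e f → (a :* (d :+ f) :+ b :* (c :+ e)) := ((a :* d :+ b :* c) :+ (a :* f :+ b :* e))) refl

  *ℂ-distribʳ : _*ℂ_ DistributesOverʳ _+ℂ_
  *ℂ-distribʳ x y z =
      (≗⇒≈ℝ λ n → real (seq (Re x) n) (seq (Im x) n) (seq (Re y) n) (seq (Im y) n) (seq (Re z) n) (seq (Im z) n))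
    , (≗⇒≈ℝ λ n → imag (seq (Re x) n) (seq (Im x) n) (seq (Re y) n) (seq (Im y) n) (seq (Re z) n) (seq (Im z) n))
    where
    real : ∀ a b c d e f → ((c ℚ.+ e) ℚ.* a ℚ.- (d ℚ.+ f) ℚ.* b) ≡ ((c ℚ.* a ℚ.- d ℚ.* b) ℚ.+ (e ℚ.* a ℚ.- f ℚ.* b))
    real = solve 6 (λ a b c d e f → ((c :+ e) :* a :- (d :+ f) :* b) := ((c :* a :- d :* b) :+ (e :* a :- f :* b))) refl
    imag : ∀ a b c d e f → ((c ℚ.+ e) ℚ.* b ℚ.+ (d ℚ.+ f) ℚ.* a) ≡ ((c ℚ.* b ℚ.+ d ℚ.* a) ℚ.+ (e ℚ.* b ℚ.+ f ℚ.* a))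
    imag = solve 6 (λ a b c d e f → ((c :+ e) :* b :+ (d :+ f) :* a) := ((c :* b :+ d :* a) :+ (e :* b :+ f :* a))) refl

  +ℂ-isAbelianGroup : IsAbelianGroup _≈ℂ_ _+ℂ_ 0ℂ -ℂ_
  +ℂ-isAbelianGroup = record
    { isGroup = record
      { isMonoid = record
        { isSemigroup = record
          { isMagma = record { isEquivalence = ℂ-isEquivalence ; ∙-cong = λ {x} {y} {z} {w} → +ℂ-cong {x} {y} {z} {w} }
          ; assoc = +ℂ-assoc
          }
        ; identity = +ℂ-identityˡ , +ℂ-identityʳ
        }
      ; inverse = -ℂ-inverseˡ , -ℂ-inverseʳ
      ; ⁻¹-cong = λ {x} {y} → -ℂ-cong {x} {y}
      }
    ; comm = +ℂ-comm
    }

  ℂ-isCommutativeRing : IsCommutativeRing _≈ℂ_ _+ℂ_ _*ℂ_ -ℂ_ 0ℂ 1ℂ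
  ℂ-isCommutativeRing = record
    { isRing = record
      { +-isAbelianGroup = +ℂ-isAbelianGroup
      ; *-cong = λ {x} {y} {z} {w} → *ℂ-cong {x} {y} {z} {w}
      ; *-assoc = *ℂ-assoc
      ; *-identity = *ℂ-identityˡ , *ℂ-identityʳ
      ; distrib = *ℂ-distribˡ , *ℂ-distribʳ
      }
    ; *-comm = *ℂ-comm
    }

ℂ-commutativeRing : CommutativeRing 0ℓ 0ℓ
ℂ-commutativeRing = record { isCommutativeRing = ℂ-isCommutativeRing }

module ℂᵣ = CommutativeRing ℂ-commutativeRing

-- A nonzero x is cancelled by multiplying with its conjugate, which leaves the
-- positive real factor |x|².
ℂ-noZeroDivisors : NoZeroDivisors ℂ-commutativeRing
ℂ-noZeroDivisors {x} {y} (mk≈ p , mk≈ q) x≉0 =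
    ≈ℝ-stable {c} {0ℝ} (λ c≉0 → ¬¬0<∣x∣² λ 0<∣x∣² → c≉0 (*ℝ-cancel-pos {∣x∣²} {c} 0<∣x∣² ∣x∣²c≈0))
  , ≈ℝ-stable {d} {0ℝ} (λ d≉0 → ¬¬0<∣x∣² λ 0<∣x∣² → d≉0 (*ℝ-cancel-pos {∣x∣²} {d} 0<∣x∣² ∣x∣²d≈0))
  where
  a = Re x
  b = Im x
  c = Re y
  d = Im y
  u = a *ℝ c -ℝ b *ℝ d
  v = a *ℝ d +ℝ b *ℝ c
  ∣x∣² = a *ℝ a +ℝ b *ℝ b

  u≈0 : u ≈ℝ 0ℝ
  u≈0 = mk≈ p

  v≈0 : v ≈ℝ 0ℝ
  v≈0 = mk≈ q

  -- That x is not zero supplies no rational gap, so |x|² is positive only up to double negation;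
  -- this is enough because the conclusion is a stable equality.
  ¬¬0<∣x∣² : ¬ ¬ (0ℝ <ℝ ∣x∣²)
  ¬¬0<∣x∣² ¬0<∣x∣² = x≉0
    ( a²+b²≤0⇒a≈0 a b ∣x∣²≤0
    , a²+b²≤0⇒a≈0 b a (≤ℝ-trans {b *ℝ b +ℝ a *ℝ a} {∣x∣²} {0ℝ}
        (≈⇒≤ℝ (≗⇒≈ℝ λ n → ℚₚ.+-comm (seq b n ℚ.* seq b n) (seq a n ℚ.* seq a n))) ∣x∣²≤0))
    where
    ∣x∣²≤0 : ∣x∣² ≤ℝ 0ℝ
    ∣x∣²≤0 = ≮ℝ⇒≥ℝ {0ℝ} {∣x∣²} ¬0<∣x∣²

  ∣x∣²c≈0 : ∣x∣² *ℝ c ≈ℝ 0ℝ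
  ∣x∣²c≈0 = ≈ℝ-trans {∣x∣² *ℝ c} {a *ℝ u +ℝ b *ℝ v} {0ℝ}
    (≗⇒≈ℝ λ n → expand (seq a n) (seq b n) (seq c n) (seq d n))
    (≈ℝ-trans {a *ℝ u +ℝ b *ℝ v} {a *ℝ 0ℝ +ℝ b *ℝ 0ℝ} {0ℝ}
      (+ℝ-cong {a *ℝ u} {a *ℝ 0ℝ} {b *ℝ v} {b *ℝ 0ℝ} (*ℝ-congˡ a {u} {0ℝ} u≈0) (*ℝ-congˡ b {v} {0ℝ} v≈0))
      (≗⇒≈ℝ λ n → vanish (seq a n) (seq b n)))
    where
    expand : ∀ a b c d → (a ℚ.* a ℚ.+ b ℚ.* b) ℚ.* c
      ≡ a ℚ.* (a ℚ.* c ℚ.- b ℚ.* d) ℚ.+ b ℚ.* (a ℚ.* d ℚ.+ b ℚ.* c)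
    expand = solve 4 (λ a b c d → (a :* a :+ b :* b) :* c :=
      a :* (a :* c :- b :* d) :+ b :* (a :* d :+ b :* c)) refl
    vanish : ∀ a b → a ℚ.* 0ℚ ℚ.+ b ℚ.* 0ℚ ≡ 0ℚ
    vanish = solve 2 (λ a b → a :* con 0ℚ :+ b :* con 0ℚ := con 0ℚ) refl

  ∣x∣²d≈0 : ∣x∣² *ℝ d ≈ℝ 0ℝ
  ∣x∣²d≈0 = ≈ℝ-trans {∣x∣² *ℝ d} {a *ℝ v -ℝ b *ℝ u} {0ℝ}
    (≗⇒≈ℝ λ n → expand (seq a n) (seq b n) (seq c n) (seq d n))
    (≈ℝ-trans {a *ℝ v -ℝ b *ℝ u} {a *ℝ 0ℝ -ℝ b *ℝ 0ℝ} {0ℝ}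
      (+ℝ-cong {a *ℝ v} {a *ℝ 0ℝ} { -ℝ (b *ℝ u)} { -ℝ (b *ℝ 0ℝ)} (*ℝ-congˡ a {v} {0ℝ} v≈0)
        (-ℝ-cong {b *ℝ u} {b *ℝ 0ℝ} (*ℝ-congˡ b {u} {0ℝ} u≈0)))
      (≗⇒≈ℝ λ n → vanish (seq a n) (seq b n)))
    where
    expand : ∀ a b c d → (a ℚ.* a ℚ.+ b ℚ.* b) ℚ.* d
      ≡ a ℚ.* (a ℚ.* d ℚ.+ b ℚ.* c) ℚ.- b ℚ.* (a ℚ.* c ℚ.- b ℚ.* d)
    expand = solve 4 (λ a b c d → (a :* a :+ b :* b) :* d :=
      a :* (a :* d :+ b :* c) :- b :* (a :* c :- b :* d)) refl
    vanish : ∀ a b → a ℚ.* 0ℚ ℚ.- b ℚ.* 0ℚ ≡ 0ℚ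
    vanish = solve 2 (λ a b → a :* con 0ℚ :- b :* con 0ℚ := con 0ℚ) refl

open RawMonoid (CommutativeRing.+-rawMonoid ℂ-commutativeRing) using () renaming (_×_ to _×ℂ_)

0≤Re[n×1] : ∀ n m → 0ℚ ℚ.≤ seq (Re (n ×ℂ 1ℂ)) m
0≤Re[n×1] zero    m = ℚₚ.≤-refl
0≤Re[n×1] (suc n) m = ℚₚ.+-mono-≤ {0ℚ} {1ℚ} {0ℚ} {seq (Re (n ×ℂ 1ℂ)) m} (ℚₚ.<⇒≤ 0<1ℚ) (0≤Re[n×1] n m)

-- Every term of the real part of `suc n ×ℂ 1ℂ` is at least 1, which contradicts closeness to 0
-- within 1.
ℂ-characteristicZero : CharacteristicZero ℂ-commutativeRing
ℂ-characteristicZero n (mk≈ p , _) = let m , h = eventually⇒∃ (p 1ℚ 0<1ℚ) in ℚₚ.<-irrefl refl (begin-strict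
  1ℚ                                             ≡⟨ sym (ℚₚ.+-identityʳ 1ℚ) ⟩
  1ℚ ℚ.+ 0ℚ                                      ≤⟨ ℚₚ.+-monoʳ-≤ 1ℚ (0≤Re[n×1] n m) ⟩
  1ℚ ℚ.+ seq (Re (n ×ℂ 1ℂ)) m                    ≡⟨ sym (ℚₚ.+-identityʳ _) ⟩
  1ℚ ℚ.+ seq (Re (n ×ℂ 1ℂ)) m ℚ.- 0ℚ             ≤⟨ p≤∣p∣ _ ⟩
  ℚ.∣ 1ℚ ℚ.+ seq (Re (n ×ℂ 1ℂ)) m ℚ.- 0ℚ ∣       <⟨ h ⟩
  1ℚ                                             ∎)
  where open ℚₚ.≤-Reasoning

-- Finite sums and estimates of absolute values

module ℚ-Sum = SemiringSum (CommutativeRing.semiring ℚₚ.+-*-commutativeRing)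

-- The quotient is reduced to lowest terms and does not compute for variable `n`; among unnormalised
-- fractions the claim is a cross multiplication.
/-*-cancel : ∀ i n .{{_ : NonZero n}} → (i ℚ./ n) ℚ.* fromℕ n ≡ i ℚ./ 1
/-*-cancel i n@(suc d) = ℚₚ.toℚᵘ-injective (begin
  ℚ.toℚᵘ ((i ℚ./ n) ℚ.* fromℕ n)
    ≈⟨ ℚₚ.toℚᵘ-homo-* (i ℚ./ n) (fromℕ n) ⟩
  ℚ.toℚᵘ (i ℚ./ n) ℚᵘ.* ℚ.toℚᵘ (fromℕ n)
    ≈⟨ ℚᵘₚ.*-cong (ℚₚ.toℚᵘ-fromℚᵘ (ℚᵘ.mkℚᵘ i d)) (ℚₚ.toℚᵘ-fromℚᵘ (ℚᵘ.mkℚᵘ (ℤ.+ n) 0)) ⟩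
  ℚᵘ.mkℚᵘ i d ℚᵘ.* ℚᵘ.mkℚᵘ (ℤ.+ n) 0
    ≈⟨ ℚᵘ.*≡* (trans (ℤₚ.*-identityʳ (i ℤ.* ℤ.+ n)) (cong (λ m → i ℤ.* ℤ.+ m) (sym (ℕₚ.*-identityʳ n)))) ⟩
  ℚᵘ.mkℚᵘ i 0
    ≈⟨ ℚₚ.toℚᵘ-fromℚᵘ (ℚᵘ.mkℚᵘ i 0) ⟨
  ℚ.toℚᵘ (i ℚ./ 1) ∎)
  where open ℚᵘₚ.≃-Reasoning

fromℕ-+ : ∀ m n → fromℕ (m ℕ.+ n) ≡ fromℕ m ℚ.+ fromℕ n
fromℕ-+ m n = ℚₚ.toℚᵘ-injective (begin
  ℚ.toℚᵘ (fromℕ (m ℕ.+ n))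
    ≈⟨ ℚₚ.toℚᵘ-fromℚᵘ (ℚᵘ.mkℚᵘ (ℤ.+ (m ℕ.+ n)) 0) ⟩
  ℚᵘ.mkℚᵘ (ℤ.+ (m ℕ.+ n)) 0
    ≡⟨ cong (λ i → ℚᵘ.mkℚᵘ i 0) (sym (cong₂ ℤ._+_ (ℤₚ.*-identityʳ (ℤ.+ m)) (ℤₚ.*-identityʳ (ℤ.+ n)))) ⟩
  ℚᵘ.mkℚᵘ (ℤ.+ m) 0 ℚᵘ.+ ℚᵘ.mkℚᵘ (ℤ.+ n) 0
    ≈⟨ ℚᵘₚ.+-cong (ℚₚ.toℚᵘ-fromℚᵘ (ℚᵘ.mkℚᵘ (ℤ.+ m) 0)) (ℚₚ.toℚᵘ-fromℚᵘ (ℚᵘ.mkℚᵘ (ℤ.+ n) 0)) ⟨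
  ℚ.toℚᵘ (fromℕ m) ℚᵘ.+ ℚ.toℚᵘ (fromℕ n)
    ≈⟨ ℚₚ.toℚᵘ-homo-+ (fromℕ m) (fromℕ n) ⟨
  ℚ.toℚᵘ (fromℕ m ℚ.+ fromℕ n) ∎)
  where open ℚᵘₚ.≃-Reasoning

∑-fromℕ : ∀ {k} (n : Vector ℕ k) → ∑ℚ (fromℕ ∘ n) ≡ fromℕ (∑ℕ n)
∑-fromℕ {zero}  n = refl
∑-fromℕ {suc k} n = trans (cong (fromℕ (n zero) ℚ.+_) (∑-fromℕ (tail n))) (sym (fromℕ-+ (n zero) (∑ℕ (tail n))))

-- This is e |A| - e (n - |A|), expanded so that no subtraction of natural numbers occurs.
∑-± : ∀ e {n} (A : Subset n) →
  ∑ℚ (λ j → if Vec.lookup A j then e else ℚ.- e) ≡ e ℚ.* fromℕ ∣ A ∣ ℚ.+ e ℚ.* fromℕ ∣ A ∣ ℚ.- e ℚ.* fromℕ n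
∑-± e Vec.[] = solve 1 (λ e → con 0ℚ := e :* con 0ℚ :+ e :* con 0ℚ :- e :* con 0ℚ) refl e
∑-± e {suc n} (inside Vec.∷ A) = trans (cong (e ℚ.+_) (∑-± e A)) (trans
  (rearrange e (fromℕ ∣ A ∣) (fromℕ n))
  (cong₂ (λ a m → e ℚ.* a ℚ.+ e ℚ.* a ℚ.- e ℚ.* m) (sym (fromℕ-+ 1 ∣ A ∣)) (sym (fromℕ-+ 1 n))))
  where
  rearrange : ∀ e a m → e ℚ.+ (e ℚ.* a ℚ.+ e ℚ.* a ℚ.- e ℚ.* m)
    ≡ e ℚ.* (1ℚ ℚ.+ a) ℚ.+ e ℚ.* (1ℚ ℚ.+ a) ℚ.- e ℚ.* (1ℚ ℚ.+ m)
  rearrange = solve 3 (λ e a m → e :+ (e :* a :+ e :* a :- e :* m)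
    := e :* (con 1ℚ :+ a) :+ e :* (con 1ℚ :+ a) :- e :* (con 1ℚ :+ m)) refl
∑-± e {suc n} (outside Vec.∷ A) = trans (cong (ℚ.- e ℚ.+_) (∑-± e A)) (trans
  (rearrange e (fromℕ ∣ A ∣) (fromℕ n))
  (cong (λ m → e ℚ.* fromℕ ∣ A ∣ ℚ.+ e ℚ.* fromℕ ∣ A ∣ ℚ.- e ℚ.* m) (sym (fromℕ-+ 1 n))))
  where
  rearrange : ∀ e a m → ℚ.- e ℚ.+ (e ℚ.* a ℚ.+ e ℚ.* a ℚ.- e ℚ.* m)
    ≡ e ℚ.* a ℚ.+ e ℚ.* a ℚ.- e ℚ.* (1ℚ ℚ.+ m)
  rearrange = solve 3 (λ e a m → :- e :+ (e :* a :+ e :* a :- e :* m)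
    := e :* a :+ e :* a :- e :* (con 1ℚ :+ m)) refl

-- Before the cut `f i` cancels `g i`, and from the cut on only `g i` is left.
∑-after≡∑-upTo+∑ : ∀ {k} l (f g : Vector ℚ k) → (∀ i → f i ≡ ℚ.- g i) →
  ∑ℚ-after l g ≡ ∑ℚ-upTo l f ℚ.+ ∑ℚ g
∑-after≡∑-upTo+∑ l f g f≡-g = trans
  (ℚ-Sum.sum-cong-≗ λ i → split (toℕ i <ᵇ l) (f i) (g i) (f≡-g i))
  (ℚ-Sum.∑-distrib-+ (λ i → if toℕ i <ᵇ l then f i else 0ℚ) g)
  where
  split : ∀ b x y → x ≡ ℚ.- y → (if b then 0ℚ else y) ≡ (if b then x else 0ℚ) ℚ.+ y
  split true  x y x≡-y = sym (trans (cong (ℚ._+ y) x≡-y) (ℚₚ.+-inverseˡ y))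
  split false x y x≡-y = sym (ℚₚ.+-identityˡ y)

seq-∑ : ∀ {k} (f : Vector ℝ k) n → seq (∑ℝ f) n ≡ ∑ℚ (λ i → seq (f i) n)
seq-∑ {zero}  f n = refl
seq-∑ {suc k} f n = cong (seq (f zero) n ℚ.+_) (seq-∑ (tail f) n)

-- Unwrapping and rewrapping an inequality changes its sides to definitionally
-- equal ones while comparing only the sequences, not the Cauchy proofs.
∑ℝ-mono-≤ : ∀ {k} {f g : Vector ℝ k} → (∀ i → f i ≤ℝ g i) → ∑ℝ f ≤ℝ ∑ℝ g
∑ℝ-mono-≤ {zero}          f≤g = ≈⇒≤ℝ (≈ℝ-refl {0ℝ})
∑ℝ-mono-≤ {suc k} {f} {g} f≤g = mk≤ (_≤ℝ_.below
  (+ℝ-mono-≤ {f zero} {g zero} {∑ℝ (tail f)} {∑ℝ (tail g)} (f≤g zero) (∑ℝ-mono-≤ {k} {tail f} {tail g} (f≤g ∘ suc))))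

∑ℝ-+-fromℚ : ∀ {k} (f : Vector ℝ k) (q : Vector ℚ k) →
  ∑ℝ f +ℝ fromℚ (∑ℚ q) ≤ℝ ∑ℝ (λ i → f i +ℝ fromℚ (q i))
∑ℝ-+-fromℚ f q = ≈⇒≤ℝ {∑ℝ f +ℝ fromℚ (∑ℚ q)} {∑ℝ (λ i → f i +ℝ fromℚ (q i))} (≗⇒≈ℝ λ n → trans
  (cong (ℚ._+ ∑ℚ q) (seq-∑ f n))
  (trans (sym (ℚ-Sum.∑-distrib-+ (λ i → seq (f i) n) q)) (sym (seq-∑ (λ i → f i +ℝ fromℚ (q i)) n))))

abs-member : ∀ x c d → fromℚ c <ℝ x →
  ∣ x -ℝ fromℚ c ∣ℝ +ℝ fromℚ (c ℚ.- d) ≤ℝ ∣ x -ℝ fromℚ d ∣ℝ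
abs-member x c d (mk< g 0<g c+g<x) = mk≤ λ ε 0<ε → eventually₁ (λ n → step ε 0<ε (seq x n)) c+g<x
  where
  open ℚₚ.≤-Reasoning
  step : ∀ ε → 0ℚ ℚ.< ε → ∀ y → c ℚ.+ g ℚ.< y → ℚ.∣ y ℚ.- c ∣ ℚ.+ (c ℚ.- d) ℚ.< ℚ.∣ y ℚ.- d ∣ ℚ.+ ε
  step ε 0<ε y c+g<y = begin-strict
    ℚ.∣ y ℚ.- c ∣ ℚ.+ (c ℚ.- d)   ≡⟨ cong (ℚ._+ (c ℚ.- d)) (ℚₚ.0≤p⇒∣p∣≡p 0≤y-c) ⟩
    (y ℚ.- c) ℚ.+ (c ℚ.- d)       ≡⟨ solve 3 (λ y c d → (y :- c) :+ (c :- d) := y :- d) refl y c d ⟩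
    y ℚ.- d                       ≤⟨ p≤∣p∣ (y ℚ.- d) ⟩
    ℚ.∣ y ℚ.- d ∣                 <⟨ p<p+ε ℚ.∣ y ℚ.- d ∣ 0<ε ⟩
    ℚ.∣ y ℚ.- d ∣ ℚ.+ ε           ∎
    where
    0≤y-c : 0ℚ ℚ.≤ y ℚ.- c
    0≤y-c = subst (ℚ._≤ y ℚ.- c) (ℚₚ.+-inverseʳ c)
      (ℚₚ.+-monoˡ-≤ (ℚ.- c) (ℚₚ.<⇒≤ (ℚₚ.<-trans (p<p+ε c 0<g) c+g<y)))

-- Non-membership in Aᵢ says only that Re λᵢⱼ ≤ c, so the approximations of Re λᵢⱼ - c may still be
-- slightly positive. Opening the absolute value of such a p with the minus sign costs 2p, which is
-- below 2η.
∣p∣<-p+2η : ∀ p {η} → 0ℚ ℚ.< η → p ℚ.< η → ℚ.∣ p ∣ ℚ.< ℚ.- p ℚ.+ (η ℚ.+ η)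
∣p∣<-p+2η p {η} 0<η p<η with ℚₚ.∣p∣≡p∨∣p∣≡-p p
... | inj₁ eq = begin-strict
  ℚ.∣ p ∣                  ≡⟨ eq ⟩
  p                        ≡⟨ solve 1 (λ p → p := :- p :+ (p :+ p)) refl p ⟩
  ℚ.- p ℚ.+ (p ℚ.+ p)      <⟨ ℚₚ.+-monoʳ-< (ℚ.- p) (ℚₚ.+-mono-< p<η p<η) ⟩
  ℚ.- p ℚ.+ (η ℚ.+ η)      ∎
  where
  open ℚₚ.≤-Reasoning
... | inj₂ eq = subst (ℚ._< ℚ.- p ℚ.+ (η ℚ.+ η)) (sym eq)
  (p<p+ε (ℚ.- p) (ℚₚ.+-mono-< 0<η 0<η))

abs-nonmember : ∀ x c d → ¬ (fromℚ c <ℝ x) →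
  ∣ x -ℝ fromℚ c ∣ℝ +ℝ fromℚ (ℚ.- (c ℚ.- d)) ≤ℝ ∣ x -ℝ fromℚ d ∣ℝ
abs-nonmember x c d c≮x = mk≤ λ ε 0<ε →
  eventually₁ (λ n → step ε 0<ε (seq x n)) (_≤ℝ_.below (≮ℝ⇒≥ℝ {fromℚ c} {x} c≮x) (ε ℚ.* ½) (half-pos 0<ε))
  where
  open ℚₚ.≤-Reasoning
  step : ∀ ε → 0ℚ ℚ.< ε → ∀ y → y ℚ.< c ℚ.+ ε ℚ.* ½ →
    ℚ.∣ y ℚ.- c ∣ ℚ.+ ℚ.- (c ℚ.- d) ℚ.< ℚ.∣ y ℚ.- d ∣ ℚ.+ ε
  step ε 0<ε y y<c+η = begin-strict
    ℚ.∣ y ℚ.- c ∣ ℚ.+ ℚ.- (c ℚ.- d)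
      <⟨ ℚₚ.+-monoˡ-< (ℚ.- (c ℚ.- d)) (∣p∣<-p+2η (y ℚ.- c) (half-pos 0<ε) (p<q+r⇒p-q<r y c y<c+η)) ⟩
    ℚ.- (y ℚ.- c) ℚ.+ (η ℚ.+ η) ℚ.+ ℚ.- (c ℚ.- d)
      ≡⟨ solve 4 (λ y c d e → :- (y :- c) :+ e :+ :- (c :- d) := :- (y :- d) :+ e) refl y c d (η ℚ.+ η) ⟩
    ℚ.- (y ℚ.- d) ℚ.+ (η ℚ.+ η)
      ≡⟨ cong (ℚ.- (y ℚ.- d) ℚ.+_) (half+half ε) ⟩
    ℚ.- (y ℚ.- d) ℚ.+ ε
      ≤⟨ ℚₚ.+-monoˡ-≤ ε (-p≤∣p∣ (y ℚ.- d)) ⟩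
    ℚ.∣ y ℚ.- d ∣ ℚ.+ ε ∎
    where η = ε ℚ.* ½

x+q≤y⇒x≤y : ∀ {x y q} → 0ℚ ℚ.≤ q → x +ℝ fromℚ q ≤ℝ y → x ≤ℝ y
x+q≤y⇒x≤y {x} {y} {q} 0≤q (mk≤ p) = mk≤ λ ε 0<ε → eventually₁
  (λ n → ℚₚ.≤-<-trans (subst (ℚ._≤ seq x n ℚ.+ q) (ℚₚ.+-identityʳ (seq x n)) (ℚₚ.+-monoʳ-≤ (seq x n) 0≤q)))
  (p ε 0<ε)

x+q≤y⇒x<y : ∀ {x y q} → 0ℚ ℚ.< q → x +ℝ fromℚ q ≤ℝ y → x <ℝ y
-- Half of q absorbs the tolerance of ≤, and the other half remains as the gap.
x+q≤y⇒x<y {x} {y} {q} 0<q (mk≤ p) = mk< (q ℚ.* ½) (half-pos 0<q) (eventually₁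
  (λ n h → subst₂ ℚ._<_ (left (seq x n)) (cancel (seq y n) (q ℚ.* ½)) (ℚₚ.+-monoˡ-< (ℚ.- (q ℚ.* ½)) h))
  (p (q ℚ.* ½) (half-pos 0<q)))
  where
  cancel : ∀ a b → a ℚ.+ b ℚ.- b ≡ a
  cancel = solve 2 (λ a b → a :+ b :- b := a) refl
  left : ∀ a → a ℚ.+ q ℚ.- q ℚ.* ½ ≡ a ℚ.+ q ℚ.* ½
  left a = trans (cong (λ r → a ℚ.+ r ℚ.- q ℚ.* ½) (sym (half+half q)))
    (solve 2 (λ a h → a :+ (h :+ h) :- h := a :+ h) refl a (q ℚ.* ½))

-- Spectra of digraphs

-- Double negation commutes with finite quantifiers, which allows reachability to be decided for all
-- pairs of vertices at once.
¬¬-∀ : ∀ {n} {P : Fin n → Set} → (∀ i → ¬ ¬ P i) → ¬ ¬ (∀ i → P i)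
¬¬-∀ {zero}  ¬¬p k = k λ ()
¬¬-∀ {suc n} ¬¬p k = ¬¬p zero λ p₀ → ¬¬-∀ (¬¬p ∘ suc) λ p → k λ { zero → p₀ ; (suc i) → p i }

scalarMatrix-≢ : ∀ {n} z {i j : Fin n} → i ≢ j → scalarMatrix z i j ≡ 0ℂ
scalarMatrix-≢ z {zero}  {zero}  i≢j = contradiction refl i≢j
scalarMatrix-≢ z {zero}  {suc j} i≢j = refl
scalarMatrix-≢ z {suc i} {zero}  i≢j = refl
scalarMatrix-≢ z {suc i} {suc j} i≢j = scalarMatrix-≢ z (i≢j ∘ cong suc)

scalarMatrix-injective : ∀ {m n} z (f : Fin m → Fin n) → (∀ {i j} → f i ≡ f j → i ≡ j) → ∀ i j →
  scalarMatrix z (f i) (f j) ≡ scalarMatrix z i j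
scalarMatrix-injective z f f-inj i j with i Finₚ.≟ j
... | yes refl = trans (scalarMatrix-diagonal (f i)) (sym (scalarMatrix-diagonal i))
  where
  scalarMatrix-diagonal : ∀ {n} (i : Fin n) → scalarMatrix z i i ≡ z
  scalarMatrix-diagonal zero    = refl
  scalarMatrix-diagonal (suc i) = scalarMatrix-diagonal i
... | no i≢j = trans (scalarMatrix-≢ z (i≢j ∘ f-inj)) (sym (scalarMatrix-≢ z i≢j))

adjacency-nonArc : ∀ D {v w} → ¬ Arc D v w → adjacency D v w ≡ 0ℂ
adjacency-nonArc D {v} {w} v↛w with Digraph.arc D v w
... | true  = contradiction _ v↛w
... | false = refl

adjacency-cong : ∀ D E {v w a b} → Digraph.arc D v w ≡ Digraph.arc E a b → adjacency D v w ≡ adjacency E a b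
adjacency-cong D E {v} {w} {a} {b} eq with Digraph.arc D v w | Digraph.arc E a b
adjacency-cong D E refl | true  | true  = refl
adjacency-cong D E refl | false | false = refl

module ℂ-Product = CommutativeMonoidSum ℂᵣ.*-commutativeMonoid

det-componentsℂ : ∀ D → (∀ v w → Dec (Star (Arc D) v w)) →
  ∀ {k} (C : Fin k → SubDigraph D) → AreTheStrongComponents C →
  order D ≡ ∑ℕ (λ i → order (digraph (C i))) →
  (M : Matrix ℂ (order D)) → (∀ {v w} → v ≢ w → ¬ Arc D v w → M v w ℂᵣ.≈ ℂᵣ.0#) →
  detℂ M ℂᵣ.≈ ∏ℂ (λ i → detℂ (λ a b → M (embed (C i) a) (embed (C i) b)))
det-componentsℂ D reaches? = DeterminantFactorization.det-components
  ℂ-commutativeRing (λ {x} {y} → ℂ-noZeroDivisors {x} {y}) ℂ-characteristicZero D reaches?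

det-congℂ : ∀ {n} {M N : Matrix ℂ n} → (∀ i j → M i j ≡ N i j) → detℂ M ℂᵣ.≈ detℂ N
det-congℂ M≡N = DeterminantProperties.det-cong ℂ-commutativeRing λ i j → ℂᵣ.reflexive (M≡N i j)

zI-_ : ∀ {n} → Matrix ℂ n → ℂ → Matrix ℂ n
(zI- A) z v w = scalarMatrix z v w +ℂ (-ℂ A v w)

-- The entries are compared through their sequences, which leaves the Cauchy proofs aside.
charPoly≈det : ∀ {n} (A : Matrix ℂ n) z → charPoly A z ℂᵣ.≈ detℂ ((zI- A) z)
charPoly≈det A z = DeterminantProperties.det-cong ℂ-commutativeRing {N = (zI- A) z}
  λ v w → (≗⇒≈ℝ λ _ → refl) , (≗⇒≈ℝ λ _ → refl)

zI-A-nonArc : ∀ D z {v w} → v ≢ w → ¬ Arc D v w → (zI- adjacency D) z v w ℂᵣ.≈ ℂᵣ.0#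
zI-A-nonArc D z v≢w v↛w =
    (≗⇒≈ℝ λ n → cong₂ (λ s a → seq (Re s) n ℚ.- seq (Re a) n) s≡0 a≡0)
  , (≗⇒≈ℝ λ n → cong₂ (λ s a → seq (Im s) n ℚ.- seq (Im a) n) s≡0 a≡0)
  where
  s≡0 = scalarMatrix-≢ z v≢w
  a≡0 = adjacency-nonArc D v↛w

zI-A-embed : ∀ D H z (e : Vertex H → Vertex D) → (∀ {a b} → e a ≡ e b → a ≡ b) →
  (∀ a b → Digraph.arc H a b ≡ Digraph.arc D (e a) (e b)) → ∀ a b →
  (zI- adjacency D) z (e a) (e b) ≡ (zI- adjacency H) z a b
zI-A-embed D H z e e-inj arc-e a b = cong₂ (λ s x → s +ℂ (-ℂ x))
  {scalarMatrix z (e a) (e b)} {scalarMatrix z a b} {adjacency D (e a) (e b)} {adjacency H a b}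
  (scalarMatrix-injective z e e-inj a b) (adjacency-cong D H (sym (arc-e a b)))

charPoly-embed : ∀ D H z (e : Vertex H → Vertex D) → (∀ {a b} → e a ≡ e b → a ≡ b) →
  (∀ a b → Digraph.arc H a b ≡ Digraph.arc D (e a) (e b)) →
  detℂ (λ a b → (zI- adjacency D) z (e a) (e b)) ℂᵣ.≈ charPoly (adjacency H) z
charPoly-embed D H z e e-inj arc-e = ℂᵣ.trans
  {detℂ (λ a b → (zI- adjacency D) z (e a) (e b))} {detℂ ((zI- adjacency H) z)} {charPoly (adjacency H) z}
  (det-congℂ {M = λ a b → (zI- adjacency D) z (e a) (e b)} {N = (zI- adjacency H) z}
    (zI-A-embed D H z e e-inj arc-e))
  (ℂᵣ.sym {charPoly (adjacency H) z} {detℂ ((zI- adjacency H) z)} (charPoly≈det (adjacency H) z))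

charPoly-components : ∀ D → (∀ v w → Dec (Star (Arc D) v w)) →
  ∀ {k} (C : Fin k → SubDigraph D) → AreTheStrongComponents C →
  order D ≡ ∑ℕ (λ i → order (digraph (C i))) →
  ∀ z → charPoly (adjacency D) z ℂᵣ.≈ ∏ℂ (λ i → charPoly (adjacency (digraph (C i))) z)
charPoly-components D reaches? {k} C areComponents n≡∑ z =
  ℂᵣ.trans {charPoly (adjacency D) z} {detℂ M} {∏ℂ χ} (charPoly≈det (adjacency D) z)
    (ℂᵣ.trans {detℂ M} {∏ℂ blocks} {∏ℂ χ}
      (det-componentsℂ D reaches? C areComponents n≡∑ M (zI-A-nonArc D z))
      (ℂ-Product.sum-cong-≋ {k} {blocks} {χ} λ i →
        charPoly-embed D (digraph (C i)) z (embed (C i)) (SubDigraph.injective (C i))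
          (Components.arc-embed D reaches? C areComponents i)))
  where
  M : Matrix ℂ (order D)
  M = (zI- adjacency D) z
  χ blocks : Vector ℂ k
  χ i = charPoly (adjacency (digraph (C i))) z
  blocks i = detℂ (λ a b → M (embed (C i) a) (embed (C i) b))

≈-∏-cong : ∀ {n x} {f g : Vector ℂ n} → x ℂᵣ.≈ ∏ℂ f → (∀ j → f j ℂᵣ.≈ g j) → x ℂᵣ.≈ ∏ℂ g
≈-∏-cong {n} {x} {f} {g} x≈∏f f≈g = ℂᵣ.trans {x} {∏ℂ f} {∏ℂ g} x≈∏f (ℂ-Product.sum-cong-≋ {n} {f} {g} f≈g)

charPoly-factors : ∀ {n} (A : Matrix ℂ n) (λs : Vector ℂ n) → IsSpectrum A λs → ∀ z →
  charPoly A z ℂᵣ.≈ ∏ℂ (λ j → z ℂᵣ.- λs j)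
charPoly-factors {n} A λs spectrum z = ≈-∏-cong {n} {charPoly A z} {_} {λ j → z ℂᵣ.- λs j} (spectrum z)
  λ j → (≗⇒≈ℝ λ _ → refl) , (≗⇒≈ℝ λ _ → refl)

-- The centre is a parameter because the eigenvalues of a component are measured both from σ/n and
-- from the component's own loop ratio.
deviation : ℚ → ℂ → ℝ
deviation c z = ∣ Re z -ℝ fromℚ c ∣ℝ

deviation-cong : ∀ c {x y} → x ℂᵣ.≈ y → deviation c x ≈ℝ deviation c y
deviation-cong c {x} {y} (mk≈ p , _) = ∣∣ℝ-cong {Re x -ℝ fromℚ c} {Re y -ℝ fromℚ c}
  (+ℝ-cong {Re x} {Re y} { -ℝ fromℚ c} { -ℝ fromℚ c} (mk≈ p) (≈ℝ-refl { -ℝ fromℚ c}))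

module ℝ-Sum = CommutativeMonoidSum (CommutativeRing.+-commutativeMonoid ℝ-commutativeRing)

energy≈∑deviation : ∀ D (μ : Vector ℂ (order D)) → energy D μ ≈ℝ ∑ℝ (deviation (loopRatio D) ∘ μ)
energy≈∑deviation D μ = ℝ-Sum.sum-cong-≋ {order D} {_} {deviation (loopRatio D) ∘ μ} λ j → ≗⇒≈ℝ λ _ → refl

module _ (D : Digraph) {k} (C : Fin k → SubDigraph D) (areComponents : AreTheStrongComponents C)
  (n≡∑ : order D ≡ ∑ℕ (λ i → order (digraph (C i))))
  (μ : Vector ℂ (order D)) (μ-spectrum : IsSpectrum (adjacency D) μ)
  (λs : ∀ i → Vector ℂ (order (digraph (C i))))
  (λs-spectrum : ∀ i → IsSpectrum (adjacency (digraph (C i))) (λs i)) where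

  private
    n : Vector ℕ k
    n i = order (digraph (C i))

    λ′ : Σ (Fin k) (Fin ∘ n) → ℂ
    λ′ (i , j) = λs i j

    χ : ℂ → Vector ℂ k
    χ z i = charPoly (adjacency (digraph (C i))) z

    ∏χ : ℂ → Vector ℂ k
    ∏χ z i = ∏ℂ (λ j → z ℂᵣ.- λ′ (i , j))

  ∏-spectra : (∀ v w → Dec (Star (Arc D) v w)) → ∀ z →
    ∏ℂ (λ j → z ℂᵣ.- μ j) ℂᵣ.≈ ∏ℂ (λ p → z ℂᵣ.- λ′ (locate n p))
  ∏-spectra reaches? z =
    ℂᵣ.trans {∏ℂ (λ j → z ℂᵣ.- μ j)} {charPoly (adjacency D) z} {∏ℂ (λ p → z ℂᵣ.- λ′ (locate n p))}
      (ℂᵣ.sym {charPoly (adjacency D) z} {∏ℂ (λ j → z ℂᵣ.- μ j)} (charPoly-factors (adjacency D) μ μ-spectrum z))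
    (ℂᵣ.trans {charPoly (adjacency D) z} {∏ℂ (χ z)} {∏ℂ (λ p → z ℂᵣ.- λ′ (locate n p))}
      (charPoly-components D reaches? C areComponents n≡∑ z)
    (ℂᵣ.trans {∏ℂ (χ z)} {∏ℂ (∏χ z)} {∏ℂ (λ p → z ℂᵣ.- λ′ (locate n p))}
      (ℂ-Product.sum-cong-≋ {k} {χ z} {∏χ z} λ i →
        ≈-∏-cong {n i} {χ z i} {_} {λ j → z ℂᵣ.- λ′ (i , j)} (λs-spectrum i z)
          λ j → (≗⇒≈ℝ λ _ → refl) , (≗⇒≈ℝ λ _ → refl))
      (ℂᵣ.sym {∏ℂ (λ p → z ℂᵣ.- λ′ (locate n p))} {∏ℂ (∏χ z)}
        (sum-locate ℂᵣ.*-commutativeMonoid n (λ x → z ℂᵣ.- λ′ x)))))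

  ∑-deviation-locate : ∀ c →
    ∑ℝ (λ p → deviation c (λ′ (locate n p))) ≈ℝ ∑ℝ (λ i → ∑ℝ (λ j → deviation c (λ′ (i , j))))
  ∑-deviation-locate c = sum-locate (CommutativeRing.+-commutativeMonoid ℝ-commutativeRing) n (λ x → deviation c (λ′ x))

  ∑-deviation-roots : ∀ c → (∀ v w → Dec (Star (Arc D) v w)) →
    ¬ ¬ (∑ℝ (deviation c ∘ μ) ≈ℝ ∑ℝ (λ p → deviation c (λ′ (locate n p))))
  ∑-deviation-roots c reaches? = sum-over-roots (CommutativeRing.+-commutativeMonoid ℝ-commutativeRing) (deviation c)
    (λ {x} {y} → deviation-cong c {x} {y}) n≡∑ μ (λ′ ∘ locate n) (∏-spectra reaches?)
    where
    open CharacteristicZeroDomain ℂ-commutativeRing (λ {x} {y} → ℂ-noZeroDivisors {x} {y}) ℂ-characteristicZero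

  energy-components : energy D μ ≈ℝ ∑ℝ (λ i → ∑ℝ (λ j → deviation (loopRatio D) (λs i j)))
  energy-components =
    ≈ℝ-trans {energy D μ} {∑μ} {∑λs} (energy≈∑deviation D μ)
    (≈ℝ-trans {∑μ} {∑λ′} {∑λs}
      -- By stability it suffices to refute the negated equation, and for a refutation reachability
      -- may be assumed decidable.
      (≈ℝ-stable {∑μ} {∑λ′} λ sums≉ →
        ¬¬-∀ (λ v → ¬¬-∀ λ w → ¬¬-excluded-middle {A = Star (Arc D) v w}) λ reaches? →
          ∑-deviation-roots (loopRatio D) reaches? sums≉)
    (≈ℝ-trans {∑λ′} {∑ℝ ∑λ′ᵢ} {∑λs} (∑-deviation-locate (loopRatio D))
      (ℝ-Sum.sum-cong-≋ {k} {∑λ′ᵢ} {∑λsᵢ} λ i →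
        ℝ-Sum.sum-cong-≋ {n i} {λ j → deviation (loopRatio D) (λ′ (i , j))} {λ j → deviation (loopRatio D) (λs i j)}
          λ j → ≗⇒≈ℝ λ _ → refl)))
    where
    ∑λ′ᵢ ∑λsᵢ : Vector ℝ k
    ∑λ′ᵢ i = ∑ℝ (λ j → deviation (loopRatio D) (λ′ (i , j)))
    ∑λsᵢ i = ∑ℝ (λ j → deviation (loopRatio D) (λs i j))
    ∑μ  = ∑ℝ (deviation (loopRatio D) ∘ μ)
    ∑λ′ = ∑ℝ (λ p → deviation (loopRatio D) (λ′ (locate n p)))
    ∑λs = ∑ℝ (λ i → ∑ℝ (λ j → deviation (loopRatio D) (λs i j)))

-- The energy estimate

deviation-shift : ∀ c d z b → (b ≡ true → fromℚ c <ℝ Re z) → (b ≡ false → ¬ (fromℚ c <ℝ Re z)) →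
  deviation c z +ℝ fromℚ (if b then c ℚ.- d else ℚ.- (c ℚ.- d)) ≤ℝ deviation d z
deviation-shift c d z true  c<z c≮z = mk≤ (_≤ℝ_.below (abs-member (Re z) c d (c<z refl)))
deviation-shift c d z false c<z c≮z = mk≤ (_≤ℝ_.below (abs-nonmember (Re z) c d (c≮z refl)))

-- Applied at two levels: to the eigenvalues of a single component, and then to the components,
-- where `q i` is the total shift inside component i.
∑ℝ-lowerBound : ∀ {n x y} (f : Vector ℝ n) (q : Vector ℚ n) (h : Vector ℝ n) →
  x ≈ℝ ∑ℝ f → (∀ j → f j +ℝ fromℚ (q j) ≤ℝ h j) → ∑ℝ h ≈ℝ y → x +ℝ fromℚ (∑ℚ q) ≤ℝ y
∑ℝ-lowerBound {n} {x} {y} f q h x≈∑f f+q≤h ∑h≈y =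
  ≤ℝ-trans {x +ℝ fromℚ (∑ℚ q)} {∑ℝ f +ℝ fromℚ (∑ℚ q)} {y}
    (+ℝ-mono-≤ {x} {∑ℝ f} {fromℚ (∑ℚ q)} {fromℚ (∑ℚ q)} (≈⇒≤ℝ {x} {∑ℝ f} x≈∑f)
      (≈⇒≤ℝ {fromℚ (∑ℚ q)} {fromℚ (∑ℚ q)} (≈ℝ-refl {fromℚ (∑ℚ q)})))
  (≤ℝ-trans {∑ℝ f +ℝ fromℚ (∑ℚ q)} {∑ℝ (λ j → f j +ℝ fromℚ (q j))} {y} (∑ℝ-+-fromℚ f q)
  (≤ℝ-trans {∑ℝ (λ j → f j +ℝ fromℚ (q j))} {∑ℝ h} {y} (∑ℝ-mono-≤ {n} {λ j → f j +ℝ fromℚ (q j)} {h} f+q≤h)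
    (≈⇒≤ℝ {∑ℝ h} {y} ∑h≈y)))

∑ℝ-compare : ∀ {n x y} (f : Vector ℝ n) (q : Vector ℚ n) (h : Vector ℝ n) →
  x ≈ℝ ∑ℝ f → (∀ j → f j +ℝ fromℚ (q j) ≤ℝ h j) → ∑ℝ h ≈ℝ y →
  (0ℚ ℚ.≤ ∑ℚ q → x ≤ℝ y) × (0ℚ ℚ.< ∑ℚ q → x <ℝ y)
∑ℝ-compare {n} {x} {y} f q h x≈∑f f+q≤h ∑h≈y =
    (λ 0≤∑q → x+q≤y⇒x≤y {x} {y} {∑ℚ q} 0≤∑q (∑ℝ-lowerBound {n} {x} {y} f q h x≈∑f f+q≤h ∑h≈y))
  , (λ 0<∑q → x+q≤y⇒x<y {x} {y} {∑ℚ q} 0<∑q (∑ℝ-lowerBound {n} {x} {y} f q h x≈∑f f+q≤h ∑h≈y))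

energy-lowerBound : ∀ H (λs : Vector ℂ (order H)) c (A : Subset (order H)) →
  (∀ j → j ∈ A ⇔ fromℚ c <ℝ Re (λs j)) →
  ∑ℝ (λ j → deviation c (λs j)) +ℝ
    fromℚ (∑ℚ (λ j → if Vec.lookup A j then c ℚ.- loopRatio H else ℚ.- (c ℚ.- loopRatio H))) ≤ℝ energy H λs
energy-lowerBound H λs c A ∈A⇔ = ∑ℝ-lowerBound {order H} {∑ℝ (λ j → deviation c (λs j))} {energy H λs}
  (λ j → deviation c (λs j)) (λ j → if Vec.lookup A j then c ℚ.- loopRatio H else ℚ.- (c ℚ.- loopRatio H))
  (deviation (loopRatio H) ∘ λs)
  (≈ℝ-refl {∑ℝ (λ j → deviation c (λs j))})
  (λ j → deviation-shift c (loopRatio H) (λs j) (Vec.lookup A j)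
    (λ j∈A → Equivalence.to (∈A⇔ j) (Vecₚ.lookup⇒[]= j A j∈A))
    (λ j∉A c<λ → contradiction (trans (sym (Vecₚ.[]=⇒lookup (Equivalence.from (∈A⇔ j) c<λ))) j∉A) λ ()))
  (≈ℝ-sym {energy H λs} {∑ℝ (deviation (loopRatio H) ∘ λs)} (energy≈∑deviation H λs))

loopRatio-*-order : ∀ H → loopRatio H ℚ.* fromℕ (order H) ≡ fromℕ (#loops H)
loopRatio-*-order H = /-*-cancel (ℤ.+ #loops H) (order H) {{Digraph.nonEmpty H}}

-- Since ∑ᵢ (c − cᵢ) nᵢ = cn − σ = 0, the shifts add up to 2 ∑ᵢ (c − cᵢ) |Aᵢ|.
∑-shifts : ∀ (D : Digraph) {k} (H : Fin k → Digraph) →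
  order D ≡ ∑ℕ (λ i → order (H i)) → #loops D ≡ ∑ℕ (λ i → #loops (H i)) →
  (A : ∀ i → Subset (order (H i))) →
  let e = λ i → loopRatio D ℚ.- loopRatio (H i)
      S = ∑ℚ (λ i → e i ℚ.* fromℕ ∣ A i ∣)
  in ∑ℚ (λ i → ∑ℚ (λ j → if Vec.lookup (A i) j then e i else ℚ.- e i)) ≡ S ℚ.+ S
∑-shifts D {k} H n≡∑ σ≡∑ A = begin
  ∑ℚ (λ i → ∑ℚ (λ j → if Vec.lookup (A i) j then e i else ℚ.- e i))
    ≡⟨ ℚ-Sum.sum-cong-≗ shift ⟩
  ∑ℚ (λ i → (g i ℚ.+ g i) ℚ.+ (fromℕ (#loops (H i)) ℚ.+ ℚ.- c ℚ.* fromℕ (order (H i))))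
    ≡⟨ ℚ-Sum.∑-distrib-+ (λ i → g i ℚ.+ g i) (λ i → fromℕ (#loops (H i)) ℚ.+ ℚ.- c ℚ.* fromℕ (order (H i))) ⟩
  ∑ℚ (λ i → g i ℚ.+ g i) ℚ.+ ∑ℚ (λ i → fromℕ (#loops (H i)) ℚ.+ ℚ.- c ℚ.* fromℕ (order (H i)))
    ≡⟨ cong₂ ℚ._+_ (ℚ-Sum.∑-distrib-+ g g)
         (ℚ-Sum.∑-distrib-+ (λ i → fromℕ (#loops (H i))) (λ i → ℚ.- c ℚ.* fromℕ (order (H i)))) ⟩
  (∑ℚ g ℚ.+ ∑ℚ g) ℚ.+ (∑ℚ (λ i → fromℕ (#loops (H i))) ℚ.+ ∑ℚ (λ i → ℚ.- c ℚ.* fromℕ (order (H i))))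
    ≡⟨ cong (∑ℚ g ℚ.+ ∑ℚ g ℚ.+_) balance ⟩
  (∑ℚ g ℚ.+ ∑ℚ g) ℚ.+ 0ℚ
    ≡⟨ ℚₚ.+-identityʳ (∑ℚ g ℚ.+ ∑ℚ g) ⟩
  ∑ℚ g ℚ.+ ∑ℚ g ∎
  where
  open ≡.≡-Reasoning
  c = loopRatio D
  e g : Vector ℚ k
  e i = c ℚ.- loopRatio (H i)
  g i = e i ℚ.* fromℕ ∣ A i ∣

  split : ∀ c r a n → (c ℚ.- r) ℚ.* a ℚ.+ (c ℚ.- r) ℚ.* a ℚ.- (c ℚ.- r) ℚ.* n
    ≡ ((c ℚ.- r) ℚ.* a ℚ.+ (c ℚ.- r) ℚ.* a) ℚ.+ (r ℚ.* n ℚ.+ ℚ.- c ℚ.* n)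
  split = solve 4 (λ c r a n → (c :- r) :* a :+ (c :- r) :* a :- (c :- r) :* n
    := ((c :- r) :* a :+ (c :- r) :* a) :+ (r :* n :+ (:- c) :* n)) refl

  shift : ∀ i → ∑ℚ (λ j → if Vec.lookup (A i) j then e i else ℚ.- e i) ≡
    (g i ℚ.+ g i) ℚ.+ (fromℕ (#loops (H i)) ℚ.+ ℚ.- c ℚ.* fromℕ (order (H i)))
  shift i = trans (∑-± (e i) (A i)) (trans
    (split c (loopRatio (H i)) (fromℕ ∣ A i ∣) (fromℕ (order (H i))))
    (cong (λ s → (g i ℚ.+ g i) ℚ.+ (s ℚ.+ ℚ.- c ℚ.* fromℕ (order (H i)))) (loopRatio-*-order (H i))))

  balance : ∑ℚ (λ i → fromℕ (#loops (H i))) ℚ.+ ∑ℚ (λ i → ℚ.- c ℚ.* fromℕ (order (H i))) ≡ 0ℚ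
  balance = begin
    ∑ℚ (λ i → fromℕ (#loops (H i))) ℚ.+ ∑ℚ (λ i → ℚ.- c ℚ.* fromℕ (order (H i)))
      ≡⟨ cong₂ ℚ._+_ (trans (∑-fromℕ (λ i → #loops (H i))) (cong fromℕ (sym σ≡∑)))
           (trans (sym (ℚ-Sum.*-distribˡ-sum (ℚ.- c) (λ i → fromℕ (order (H i)))))
             (cong (ℚ.- c ℚ.*_) (trans (∑-fromℕ (λ i → order (H i))) (cong fromℕ (sym n≡∑))))) ⟩
    fromℕ (#loops D) ℚ.+ ℚ.- c ℚ.* fromℕ (order D)
      ≡⟨ cong (ℚ._+ ℚ.- c ℚ.* fromℕ (order D)) (sym (loopRatio-*-order D)) ⟩
    c ℚ.* fromℕ (order D) ℚ.+ ℚ.- c ℚ.* fromℕ (order D)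
      ≡⟨ solve 2 (λ c n → c :* n :+ (:- c) :* n := con 0ℚ) refl c (fromℕ (order D)) ⟩
    0ℚ ∎

+-cancelˡ-≤ : ∀ p {q r} → p ℚ.+ q ℚ.≤ p ℚ.+ r → q ℚ.≤ r
+-cancelˡ-≤ p h = ℚₚ.≮⇒≥ λ r<q → ℚₚ.<-irrefl refl (ℚₚ.<-≤-trans (ℚₚ.+-monoʳ-< p r<q) h)

+-cancelˡ-< : ∀ p {q r} → p ℚ.+ q ℚ.< p ℚ.+ r → q ℚ.< r
+-cancelˡ-< p h = ℚₚ.≰⇒> λ r≤q → ℚₚ.<-irrefl refl (ℚₚ.<-≤-trans h (ℚₚ.+-monoʳ-≤ p r≤q))

theorem3p9 :
  (D : Digraph) (k : ℕ) (C : Fin k → SubDigraph D) →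
  AreTheStrongComponents C →
  order D ≡ ∑ℕ (λ i → order (digraph (C i))) →
  #loops D ≡ ∑ℕ (λ i → #loops (digraph (C i))) →
  (μ : Vector ℂ (order D)) →
  IsSpectrum (adjacency D) μ →
  (λs : ∀ i → Vector ℂ (order (digraph (C i)))) →
  (∀ i → IsSpectrum (adjacency (digraph (C i))) (λs i)) →
  (l : ℕ) → 1 ℕ.≤ l → l ℕ.< k →
  (∀ i → toℕ i ℕ.< l → loopRatio D ℚ.< loopRatio (digraph (C i))) →
  (∀ i → l ℕ.≤ toℕ i → loopRatio (digraph (C i)) ℚ.≤ loopRatio D) →
  (A : ∀ i → Subset (order (digraph (C i)))) →
  (∀ i j → j ∈ A i ⇔ fromℚ (loopRatio D) <ℝ Re (λs i j)) →
  let excess  = ∑ℚ-upTo l (λ i →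
                  (loopRatio (digraph (C i)) ℚ.- loopRatio D) ℚ.* fromℕ ∣ A i ∣)
      deficit = ∑ℚ-after l (λ i →
                  (loopRatio D ℚ.- loopRatio (digraph (C i))) ℚ.* fromℕ ∣ A i ∣)
      ∑E      = ∑ℝ (λ i → energy (digraph (C i)) (λs i))
  in (excess ℚ.≤ deficit → energy D μ ≤ℝ ∑E) ×
     (excess ℚ.< deficit → energy D μ <ℝ ∑E)
theorem3p9 D k C areComponents n≡∑ σ≡∑ μ μ-spectrum λs λs-spectrum l _ _ _ _ A ∈A⇔ =
    -- Cancelling `excess` in `excess + 0 ≤ excess + S` gives the sign of `S`, and the shifts add up
    -- to `S + S`.
    (λ excess≤deficit → let 0≤S = +-cancelˡ-≤ excess (subst₂ ℚ._≤_ (sym (ℚₚ.+-identityʳ excess)) deficit≡ excess≤deficit) in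
      proj₁ compare (subst (0ℚ ℚ.≤_) (sym shifts) (ℚₚ.+-mono-≤ 0≤S 0≤S)))
  , (λ excess<deficit → let 0<S = +-cancelˡ-< excess (subst₂ ℚ._<_ (sym (ℚₚ.+-identityʳ excess)) deficit≡ excess<deficit) in
      proj₂ compare (subst (0ℚ ℚ.<_) (sym shifts) (ℚₚ.+-mono-< 0<S 0<S)))
  where
  c = loopRatio D
  r f g : Vector ℚ k
  r i = loopRatio (digraph (C i))
  f i = (r i ℚ.- c) ℚ.* fromℕ ∣ A i ∣
  g i = (c ℚ.- r i) ℚ.* fromℕ ∣ A i ∣
  excess = ∑ℚ-upTo l f
  S = ∑ℚ g

  deficit≡ : ∑ℚ-after l g ≡ excess ℚ.+ S
  deficit≡ = ∑-after≡∑-upTo+∑ l f g λ i → negate (r i) c (fromℕ ∣ A i ∣)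
    where
    negate : ∀ r c a → (r ℚ.- c) ℚ.* a ≡ ℚ.- ((c ℚ.- r) ℚ.* a)
    negate = solve 3 (λ r c a → (r :- c) :* a := :- ((c :- r) :* a)) refl

  shifts = ∑-shifts D (λ i → digraph (C i)) n≡∑ σ≡∑ A

  compare = ∑ℝ-compare {k} {energy D μ} {∑ℝ (λ i → energy (digraph (C i)) (λs i))}
    (λ i → ∑ℝ (λ j → deviation (loopRatio D) (λs i j)))
    (λ i → ∑ℚ (λ j → if Vec.lookup (A i) j
      then loopRatio D ℚ.- loopRatio (digraph (C i)) else ℚ.- (loopRatio D ℚ.- loopRatio (digraph (C i)))))
    (λ i → energy (digraph (C i)) (λs i))
    (energy-components D C areComponents n≡∑ μ μ-spectrum λs λs-spectrum)
    (λ i → energy-lowerBound (digraph (C i)) (λs i) (loopRatio D) (A i) (∈A⇔ i))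
    (≈ℝ-refl {∑ℝ (λ i → energy (digraph (C i)) (λs i))})
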